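{- A matroid $M$ is an excluded series minor for the class of circuit-difference matroids if and only if either $M\cong U_{n,n+2}$ for some $n\ge 2$, or $M^*$ can be obtained (up to isomorphism) from $AG(r-1,2)+e$, for some $r\ge 3$, by deleting some set $X$ such that $e\notin X$ and $AG(r-1,2)|X$ does not contain a copy of $AG(r-3,2)$.
   Context: All matroids are finite. A matroid $M$ is circuit-difference if the symmetric difference $C_1\triangle C_2$ is a circuit of $M$ whenever $C_1$ and $C_2$ are distinct circuits of $M$ with $C_1\cap C_2\neq\emptyset$. A series contraction of a matroid is the contraction of an element $e$ for which there is an element $f\neq e$ such that $\{e,f\}$ is a cocircuit. A series minor of $M$ is a matroid obtained from $M$ by a (possibly empty) sequence of single-element deletions and series contractions. An excluded series minor for a class of matroids is a matroid that is not in the class but all of whose proper series minors are in the class. $U_{r,n}$ is the uniform matroid of rank $r$ on $n$ elements. $AG(r-1,2)$ is the rank-$r$ binary affine geometry, obtained from the binary projective geometry $PG(r-1,2)$ by deleting all the elements of a hyperplane; $AG(0,2)$ is a single non-loop element. $AG(r-1,2)+e$ denotes the unique (up to isomorphism) simple binary rank-$r$ single-element extension of $AG(r-1,2)$, where $e$ is the added element; equivalently, it is obtained from $PG(r-1,2)$ by deleting all elements of a hyperplane except for one element $e$ of that hyperplane. "$AG(r-1,2)|X$ contains a copy of $AG(r-3,2)$" means that some restriction of $AG(r-1,2)|X$ is isomorphic to $AG(r-3,2)$. -}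

module Defs where

open import Algebra.Bundles using (CommutativeMonoid; CommutativeRing)
open import Data.Bool.Base using (Bool; true; false; not; _∧_; _xor_)
import Data.Bool.Properties as Bool
open import Data.Empty using (⊥-elim)
open import Data.Fin.Base using (Fin; zero; suc; combine; finToFun; remQuot)
open import Data.Fin.Properties using (any?; all?; 2↔Bool; pigeonhole; combine-injective; combine-remQuot)
import Data.Fin.Properties as Fin
open import Data.Fin.Subset
open import Data.Fin.Subset.Properties
open import Data.Nat.Base using (ℕ; zero; suc; _+_; _∸_; _^_; _≤_; _<_; z≤n; s≤s)
import Data.Nat.Properties as ℕ
open import Data.Product.Base using (∃; _×_; _,_; proj₁; proj₂)
open import Data.Sum.Base using (inj₁; inj₂)
open import Data.Vec.Base using ([]; _∷_; here; there; lookup; tabulate; tail; zipWith)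
open import Data.Vec.Properties using (≡-dec)
open import Function.Base using (_∘_)
open import Function.Bundles using (_⇔_; _↔_; Inverse)
open import Relation.Binary.Construct.Closure.ReflexiveTransitive using (Star)
open import Relation.Binary.PropositionalEquality
open import Relation.Nullary using (¬_; Dec; yes; no; contradiction; does)
open import Relation.Nullary.Decidable using (_×-dec_; _→-dec_; ¬?; decidable-stable)
open import Relation.Unary using (Decidable)

open import Algebra.Properties.CommutativeSemigroup
  (CommutativeMonoid.commutativeSemigroup
    (CommutativeRing.+-commutativeMonoid Bool.xor-∧-commutativeRing)) using (interchange)
open import Algebra.Properties.Semiring.Sum
  (CommutativeRing.semiring Bool.xor-∧-commutativeRing) using (sum)

private
  variable
    m n k : ℕ

infixr 6 _△_

_△_ : Subset n → Subset n → Subset n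
_△_ = zipWith _xor_

_≟ˢ_ : (p q : Subset n) → Dec (p ≡ q)
_≟ˢ_ = ≡-dec Bool._≟_

allSubset? : {P : Subset n → Set} → Decidable P → Dec (∀ p → P p)
allSubset? P? with anySubset? (¬? ∘ P?)
... | yes (p , ¬Pp) = no (λ f → ¬Pp (f p))
... | no ¬∃ = yes (λ p → decidable-stable (P? p) (λ ¬Pp → ¬∃ (p , ¬Pp)))

∪-⊆ : {p q r : Subset n} → p ⊆ r → q ⊆ r → p ∪ q ⊆ r
∪-⊆ {p = p} {q} p⊆r q⊆r x∈ with x∈p∪q⁻ p q x∈
... | inj₁ x∈p = p⊆r x∈p
... | inj₂ x∈q = q⊆r x∈q

⁅⁆-⊆ : {x : Fin n} {p : Subset n} → x ∈ p → ⁅ x ⁆ ⊆ p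
⁅⁆-⊆ {x = x} {p} x∈p y∈ = subst (_∈ p) (sym (x∈⁅y⁆⇒x≡y x y∈)) x∈p

x∈p─q⇒x∉q : (p q : Subset n) {x : Fin n} → x ∈ p ─ q → x ∉ q
x∈p─q⇒x∉q (_ ∷ p) (outside ∷ q) here       ()
x∈p─q⇒x∉q (_ ∷ p) (_ ∷ q)       (there x∈) (there x∈q) = x∈p─q⇒x∉q p q x∈ x∈q

∣p∪⁅x⁆∣ : (p : Subset n) {x : Fin n} → x ∉ p → ∣ p ∪ ⁅ x ⁆ ∣ ≡ suc ∣ p ∣
∣p∪⁅x⁆∣ (inside  ∷ p) {zero}  x∉ = contradiction here x∉
∣p∪⁅x⁆∣ (outside ∷ p) {zero}  x∉ = cong (suc ∘ ∣_∣) (∪-identityʳ p)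
∣p∪⁅x⁆∣ (inside  ∷ p) {suc x} x∉ = cong suc (∣p∪⁅x⁆∣ p (x∉ ∘ there))
∣p∪⁅x⁆∣ (outside ∷ p) {suc x} x∉ = ∣p∪⁅x⁆∣ p (x∉ ∘ there)

∣p∣-split : (p q : Subset n) → ∣ p ∣ ≡ ∣ p ∩ q ∣ + ∣ p ─ q ∣
∣p∣-split []            []            = refl
∣p∣-split (inside  ∷ p) (inside  ∷ q) = cong suc (∣p∣-split p q)
∣p∣-split (inside  ∷ p) (outside ∷ q) =
  trans (cong suc (∣p∣-split p q)) (sym (ℕ.+-suc ∣ p ∩ q ∣ ∣ p ─ q ∣))
∣p∣-split (outside ∷ p) (inside  ∷ q) = ∣p∣-split p q
∣p∣-split (outside ∷ p) (outside ∷ q) = ∣p∣-split p q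

∃∈─ : (p q : Subset n) → ∣ p ∣ < ∣ q ∣ → ∃ λ x → x ∈ q × x ∉ p
∃∈─ p q p<q with nonempty? (q ─ p)
... | yes (x , x∈) = x , p─q⊆p q p x∈ , x∈p─q⇒x∉q q p x∈
... | no empty = contradiction (p⊆q⇒∣p∣≤∣q∣ q⊆p) (ℕ.<⇒≱ p<q)
  where
  q⊆p : q ⊆ p
  q⊆p {x} x∈q with x ∈? p
  ... | yes x∈p = x∈p
  ... | no x∉p = contradiction (x , x∈p∧x∉q⇒x∈p─q x∈q x∉p) empty

-- The ground set E is a subset of the ambient set Fin n, so that a minor
-- lives on the same ambient set. Indep is decidable because matroids are
-- finite: without this, membership in the family of independent sets
-- would not be a classical (two-valued) notion.
record Matroid (n : ℕ) : Set₁ where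
  field
    E        : Subset n
    Indep    : Subset n → Set
    Indep?   : Decidable Indep
    indep⊆E  : ∀ {I} → Indep I → I ⊆ E
    ⊥-indep  : Indep ⊥
    indep-⊆  : ∀ {I J} → I ⊆ J → Indep J → Indep I
    augment  : ∀ {I J} → Indep I → Indep J → ∣ I ∣ < ∣ J ∣ →
               ∃ λ x → x ∈ J × x ∉ I × Indep (I ∪ ⁅ x ⁆)

  Base : Subset n → Set
  Base B = Indep B × (∀ I → Indep I → B ⊆ I → I ≡ B)

  Circuit : Subset n → Set
  Circuit C = C ⊆ E × ¬ Indep C × (∀ D → D ⊂ C → Indep D)

  Element : Set
  Element = ∃ λ x → x ∈ E

  Base? : Decidable Base
  Base? B = Indep? B ×-dec
    allSubset? (λ I → Indep? I →-dec (B ⊆? I →-dec (I ≟ˢ B)))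

  base-max : ∀ {B I} → Base B → Indep I → ∣ I ∣ ≤ ∣ B ∣
  base-max {B} {I} (iB , maxB) iI with ∣ I ∣ ℕ.≤? ∣ B ∣
  ... | yes I≤B = I≤B
  ... | no I≰B with augment iB iI (ℕ.≰⇒> I≰B)
  ...   | x , _ , x∉B , iB+x = contradiction
          (subst (x ∈_) (maxB _ iB+x (p⊆p∪q ⁅ x ⁆)) (q⊆p∪q B ⁅ x ⁆ (x∈⁅x⁆ x))) x∉B

  max-base : ∀ {B J} → Base B → Indep J → ∣ B ∣ ≤ ∣ J ∣ → Base J
  max-base {B} {J} bB iJ B≤J = iJ , max
    where
    max : ∀ I → Indep I → J ⊆ I → I ≡ J
    max I iI J⊆I = ⊆-antisym I⊆J J⊆I
      where
      I⊆J : I ⊆ J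
      I⊆J {x} x∈I with x ∈? J
      ... | yes x∈J = x∈J
      ... | no x∉J = contradiction
        (ℕ.≤-trans (p⊂q⇒∣p∣<∣q∣ (J⊆I , x , x∈I , x∉J)) (ℕ.≤-trans (base-max bB iI) B≤J))
        (ℕ.<-irrefl refl)

  extend : ∀ {I J} → Indep I → Indep J →
           ∃ λ K → I ⊆ K × K ⊆ I ∪ J × Indep K × ∣ J ∣ ≤ ∣ K ∣
  extend {I} {J} iI iJ = go ∣ J ∣ I iI (ℕ.m≤m+n ∣ J ∣ ∣ I ∣)
    where
    go : ∀ d I → Indep I → ∣ J ∣ ≤ d + ∣ I ∣ →
         ∃ λ K → I ⊆ K × K ⊆ I ∪ J × Indep K × ∣ J ∣ ≤ ∣ K ∣
    go zero I iI J≤ = I , ⊆-refl , p⊆p∪q J , iI , J≤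
    go (suc d) I iI J≤ with ∣ J ∣ ℕ.≤? ∣ I ∣
    ... | yes J≤I = I , ⊆-refl , p⊆p∪q J , iI , J≤I
    ... | no J≰I with augment iI iJ (ℕ.≰⇒> J≰I)
    ...   | x , x∈J , x∉I , iI+x
            with go d (I ∪ ⁅ x ⁆) iI+x (subst (∣ J ∣ ≤_)
                   (trans (sym (ℕ.+-suc d ∣ I ∣)) (cong (d +_) (sym (∣p∪⁅x⁆∣ I x∉I)))) J≤)
    ...     | K , I+x⊆K , K⊆ , iK , J≤K =
              K , I+x⊆K ∘ p⊆p∪q ⁅ x ⁆ ,
              ∪-⊆ (∪-⊆ (p⊆p∪q J) (⁅⁆-⊆ (q⊆p∪q I J x∈J))) (q⊆p∪q I J) ∘ K⊆ , iK , J≤K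

open Matroid public using (E; Indep; Base; Circuit; Element)

-- In preserves, the hypotheses say that J is the image of I.
record _≅_ (M : Matroid m) (N : Matroid n) : Set where
  field
    bijection : Element M ↔ Element N
    preserves : ∀ {I J} → I ⊆ E M → J ⊆ E N →
                (∀ x → proj₁ x ∈ I ⇔ proj₁ (Inverse.to bijection x) ∈ J) →
                Indep M I ⇔ Indep N J

infix 4 _≅_

_* : Matroid n → Matroid n
_* {n} M = record
  { E       = M.E
  ; Indep   = Coindep
  ; Indep?  = Coindep?
  ; indep⊆E = λ { (B , _ , I⊆) → p─q⊆p M.E B ∘ I⊆ }
  ; ⊥-indep = ⊥-coindep
  ; indep-⊆ = λ { I⊆J (B , bB , J⊆) → B , bB , J⊆ ∘ I⊆J }
  ; augment = coaugment
  }
  where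
  module M = Matroid M

  Coindep : Subset n → Set
  Coindep I = ∃ λ B → M.Base B × I ⊆ M.E ─ B

  Coindep? : Decidable Coindep
  Coindep? I = anySubset? (λ B → M.Base? B ×-dec I ⊆? (M.E ─ B))

  ⊥-coindep : Coindep ⊥
  ⊥-coindep = go n ⊥ M.⊥-indep (ℕ.m≤m+n n _)
    where
    go : ∀ d I → M.Indep I → n ≤ d + ∣ I ∣ → Coindep ⊥
    go d I iI n≤ with M.Base? I
    ... | yes bI = I , bI , ⊥⊆
    ... | no ¬bI with any? (λ x → ¬? (x ∈? I) ×-dec M.Indep? (I ∪ ⁅ x ⁆))
    ...   | no ¬∃ = contradiction (iI , max) ¬bI
      where
      max : ∀ J → M.Indep J → I ⊆ J → J ≡ I
      max J iJ I⊆J = ⊆-antisym J⊆I I⊆J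
        where
        J⊆I : J ⊆ I
        J⊆I {x} x∈J with x ∈? I
        ... | yes x∈I = x∈I
        ... | no x∉I = contradiction
          (x , x∉I , M.indep-⊆ (∪-⊆ I⊆J (⁅⁆-⊆ x∈J)) iJ) ¬∃
    go zero I iI n≤ | no ¬bI | yes (x , x∉I , _) = contradiction
      (subst (x ∈_) (sym (∣p∣≡n⇒p≡⊤ (ℕ.≤-antisym (∣p∣≤n I) n≤))) ∈⊤) x∉I
    go (suc d) I iI n≤ | no ¬bI | yes (x , x∉I , iI+x) = go d (I ∪ ⁅ x ⁆) iI+x
      (subst (n ≤_) (trans (sym (ℕ.+-suc d ∣ I ∣)) (cong (d +_) (sym (∣p∪⁅x⁆∣ I x∉I)))) n≤)

  coaugment : ∀ {I J} → Coindep I → Coindep J → ∣ I ∣ < ∣ J ∣ →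
              ∃ λ x → x ∈ J × x ∉ I × Coindep (I ∪ ⁅ x ⁆)
  coaugment {I} {J} (A , bA , I⊆) (B , bB , J⊆) I<J
    with any? (λ x → x ∈? J ×-dec (¬? (x ∈? I) ×-dec Coindep? (I ∪ ⁅ x ⁆)))
  ... | yes found = found
  ... | no ¬∃ with M.extend (M.indep-⊆ (p─q⊆p B I) (proj₁ bB)) (proj₁ bA)
  ...   | K , B─I⊆K , K⊆ , iK , A≤K = contradiction (M.base-max bB iK) (ℕ.<⇒≱ B<K)
    where
    bK : M.Base K
    bK = M.max-base bA iK A≤K

    I∩K : ∀ {x} → x ∈ I → x ∉ K
    I∩K x∈I x∈K with x∈p∪q⁻ (B ─ I) A (K⊆ x∈K)
    ... | inj₁ x∈B─I = x∈p─q⇒x∉q B I x∈B─I x∈I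
    ... | inj₂ x∈A = x∈p─q⇒x∉q M.E A (I⊆ x∈I) x∈A

    J─I⊆K : J ─ I ⊆ K
    J─I⊆K {x} x∈ with x ∈? K
    ... | yes x∈K = x∈K
    ... | no x∉K = ⊥-elim (¬∃
      (x , p─q⊆p J I x∈ , x∈p─q⇒x∉q J I x∈ , K , bK , I+x⊆))
      where
      I+x⊆ : I ∪ ⁅ x ⁆ ⊆ M.E ─ K
      I+x⊆ = ∪-⊆ (λ y∈I → x∈p∧x∉q⇒x∈p─q (p─q⊆p M.E A (I⊆ y∈I)) (I∩K y∈I))
        (⁅⁆-⊆ (x∈p∧x∉q⇒x∈p─q (p─q⊆p M.E B (J⊆ (p─q⊆p J I x∈))) x∉K))

    B∩I⊆I─J : B ∩ I ⊆ I ─ J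
    B∩I⊆I─J x∈ with x∈p∩q⁻ B I x∈
    ... | x∈B , x∈I = x∈p∧x∉q⇒x∈p─q x∈I (λ x∈J → x∈p─q⇒x∉q M.E B (J⊆ x∈J) x∈B)

    I─J<J─I : ∣ I ─ J ∣ < ∣ J ─ I ∣
    I─J<J─I = ℕ.+-cancelˡ-< ∣ I ∩ J ∣ _ _
      (subst₂ _<_ (∣p∣-split I J)
        (trans (∣p∣-split J I) (cong (λ p → ∣ p ∣ + ∣ J ─ I ∣) (∩-comm J I))) I<J)

    B─I⊆K─J : B ─ I ⊆ K ─ (J ─ I)
    B─I⊆K─J x∈ = x∈p∧x∉q⇒x∈p─q (B─I⊆K x∈)
      (λ x∈J─I → x∈p─q⇒x∉q M.E B (J⊆ (p─q⊆p J I x∈J─I)) (p─q⊆p B I x∈))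

    B<K : ∣ B ∣ < ∣ K ∣
    B<K = begin-strict
      ∣ B ∣                                   ≡⟨ ∣p∣-split B I ⟩
      ∣ B ∩ I ∣ + ∣ B ─ I ∣                   ≤⟨ ℕ.+-monoˡ-≤ _ (p⊆q⇒∣p∣≤∣q∣ B∩I⊆I─J) ⟩
      ∣ I ─ J ∣ + ∣ B ─ I ∣                   <⟨ ℕ.+-monoˡ-< _ I─J<J─I ⟩
      ∣ J ─ I ∣ + ∣ B ─ I ∣                   ≤⟨ ℕ.+-mono-≤
                                                   (p⊆q⇒∣p∣≤∣q∣ (λ x∈ → x∈p∩q⁺ (J─I⊆K x∈ , x∈)))
                                                   (p⊆q⇒∣p∣≤∣q∣ B─I⊆K─J) ⟩
      ∣ K ∩ (J ─ I) ∣ + ∣ K ─ (J ─ I) ∣       ≡⟨ ∣p∣-split K (J ─ I) ⟨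
      ∣ K ∣                                   ∎
      where open ℕ.≤-Reasoning

_↾_ : Matroid n → Subset n → Matroid n
M ↾ X = record
  { E       = M.E ∩ X
  ; Indep   = λ I → M.Indep I × I ⊆ X
  ; Indep?  = λ I → M.Indep? I ×-dec I ⊆? X
  ; indep⊆E = λ { (iI , I⊆X) x∈I → x∈p∩q⁺ (M.indep⊆E iI x∈I , I⊆X x∈I) }
  ; ⊥-indep = M.⊥-indep , ⊥⊆
  ; indep-⊆ = λ { I⊆J (iJ , J⊆X) → M.indep-⊆ I⊆J iJ , J⊆X ∘ I⊆J }
  ; augment = λ { (iI , I⊆X) (iJ , J⊆X) I<J →
      let x , x∈J , x∉I , iI+x = M.augment iI iJ I<J
      in x , x∈J , x∉I , iI+x , ∪-⊆ I⊆X (⁅⁆-⊆ (J⊆X x∈J)) }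
  }
  where module M = Matroid M

_╲_ : Matroid n → Subset n → Matroid n
M ╲ X = M ↾ ∁ X

_／_ : Matroid n → Subset n → Matroid n
M ／ X = ((M *) ╲ X) *

infixl 8 _*
infixl 7 _↾_ _╲_ _／_

_Contains_ : Matroid m → Matroid n → Set
M Contains N = ∃ λ Y → Y ⊆ E M × M ↾ Y ≅ N

data SeriesStep {n : ℕ} (M : Matroid n) : Matroid n → Set₁ where
  delete   : ∀ {e} → e ∈ E M → SeriesStep M (M ╲ ⁅ e ⁆)
  contract : ∀ {e f} → e ≢ f → Circuit (M *) (⁅ e ⁆ ∪ ⁅ f ⁆) → SeriesStep M (M ／ ⁅ e ⁆)

_SeriesMinorOf_ : Matroid n → Matroid n → Set₁
N SeriesMinorOf M = Star SeriesStep M N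

-- Every step removes an element from the ground set, so the series minors
-- N ≢ M are those reached by at least one step.
ExcludedSeriesMinor : (∀ {n} → Matroid n → Set) → Matroid n → Set₁
ExcludedSeriesMinor 𝒞 M = ¬ 𝒞 M × (∀ N → N SeriesMinorOf M → N ≢ M → 𝒞 N)

CircuitDifference : Matroid n → Set
CircuitDifference M = ∀ C₁ C₂ → Circuit M C₁ → Circuit M C₂ →
  C₁ ≢ C₂ → Nonempty (C₁ ∩ C₂) → Circuit M (C₁ △ C₂)

U : ℕ → (n : ℕ) → Matroid n
U r n = record
  { E       = ⊤
  ; Indep   = λ I → ∣ I ∣ ≤ r
  ; Indep?  = λ I → ∣ I ∣ ℕ.≤? r
  ; indep⊆E = λ _ → ⊆⊤
  ; ⊥-indep = subst (_≤ r) (sym (∣⊥∣≡0 n)) z≤n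
  ; indep-⊆ = λ I⊆J → ℕ.≤-trans (p⊆q⇒∣p∣≤∣q∣ I⊆J)
  ; augment = λ {I} {J} _ J≤r I<J →
      let x , x∈J , x∉I = ∃∈─ I J I<J
      in x , x∈J , x∉I , subst (_≤ r) (sym (∣p∪⁅x⁆∣ I x∉I)) (ℕ.≤-trans I<J J≤r)
  }

-- GF(2) is Bool with _xor_ and _∧_; a subset D is its own 0/1 vector of
-- coefficients.
lincomb : (Fin n → Fin k → Bool) → Subset n → Fin k → Bool
lincomb v D j = sum (λ x → lookup D x ∧ v x j)

LinearlyIndependent : (Fin n → Fin k → Bool) → Subset n → Set
LinearlyIndependent v I = ∀ D → D ⊆ I → (∀ j → lincomb v D j ≡ false) → D ≡ ⊥

lincomb-⊥ : (v : Fin n → Fin k → Bool) → ∀ j → lincomb v ⊥ j ≡ false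
lincomb-⊥ {zero}  v j = refl
lincomb-⊥ {suc n} v j = lincomb-⊥ (v ∘ suc) j

lincomb-⁅⁆ : (v : Fin n → Fin k → Bool) → ∀ x j → lincomb v ⁅ x ⁆ j ≡ v x j
lincomb-⁅⁆ v zero    j = trans (cong (v zero j xor_) (lincomb-⊥ (v ∘ suc) j)) (Bool.xor-identityʳ _)
lincomb-⁅⁆ v (suc x) j = lincomb-⁅⁆ (v ∘ suc) x j

lincomb-△ : (v : Fin n → Fin k → Bool) → ∀ p q j →
            lincomb v (p △ q) j ≡ lincomb v p j xor lincomb v q j
lincomb-△ v []      []      j = refl
lincomb-△ v (a ∷ p) (b ∷ q) j = trans
  (cong₂ _xor_ (Bool.∧-distribʳ-xor (v zero j) a b) (lincomb-△ (v ∘ suc) p q j))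
  (interchange (a ∧ v zero j) (b ∧ v zero j) _ _)

lincomb-closed : (v : Fin n → Fin k → Bool) (P : (Fin k → Bool) → Set) →
  (∀ {f g} → (∀ j → f j ≡ g j) → P f → P g) → P (λ _ → false) →
  (∀ {f g} → P f → P g → P (λ j → f j xor g j)) →
  ∀ D → (∀ x → x ∈ D → P (v x)) → P (lincomb v D)
lincomb-closed v P resp P0 P+ [] PD = P0
lincomb-closed v P resp P0 P+ (outside ∷ D) PD =
  lincomb-closed (v ∘ suc) P resp P0 P+ D (λ x x∈D → PD (suc x) (there x∈D))
lincomb-closed v P resp P0 P+ (inside ∷ D) PD =
  P+ (PD zero here) (lincomb-closed (v ∘ suc) P resp P0 P+ D (λ x x∈D → PD (suc x) (there x∈D)))

△-⊆ : {p q r : Subset n} → p ⊆ r → q ⊆ r → p △ q ⊆ r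
△-⊆ {p = inside  ∷ p} {_ ∷ q}       p⊆r q⊆r {zero} _ = p⊆r here
△-⊆ {p = outside ∷ p} {inside  ∷ q} p⊆r q⊆r {zero} _ = q⊆r here
△-⊆ {p = outside ∷ p} {outside ∷ q} p⊆r q⊆r {zero} ()
△-⊆ {p = _ ∷ p} {_ ∷ q} {_ ∷ r} p⊆r q⊆r {suc _} (there x∈) =
  there (△-⊆ (drop-∷-⊆ p⊆r) (drop-∷-⊆ q⊆r) x∈)

p△q≡⊥⇒p≡q : (p q : Subset n) → p △ q ≡ ⊥ → p ≡ q
p△q≡⊥⇒p≡q []            []            eq = refl
p△q≡⊥⇒p≡q (inside  ∷ p) (inside  ∷ q) eq = cong (inside ∷_) (p△q≡⊥⇒p≡q p q (cong tail eq))
p△q≡⊥⇒p≡q (inside  ∷ p) (outside ∷ q) ()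
p△q≡⊥⇒p≡q (outside ∷ p) (inside  ∷ q) ()
p△q≡⊥⇒p≡q (outside ∷ p) (outside ∷ q) eq = cong (outside ∷_) (p△q≡⊥⇒p≡q p q (cong tail eq))

x∈p⇒x∉p△⁅x⁆ : (p : Subset n) {x : Fin n} → x ∈ p → x ∉ p △ ⁅ x ⁆
x∈p⇒x∉p△⁅x⁆ (_ ∷ p) here       ()
x∈p⇒x∉p△⁅x⁆ (_ ∷ p) (there x∈) (there x∈′) = x∈p⇒x∉p△⁅x⁆ p x∈ x∈′

private
  module B = Inverse 2↔Bool

  bit-injective : ∀ {a b} → B.from a ≡ B.from b → a ≡ b
  bit-injective {a} {b} eq = trans (sym (B.inverseˡ refl)) (trans (cong B.to eq) (B.inverseˡ refl))

-- encode I and decode I number the subsets of I, for the pigeonhole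
-- argument that proves augmentation in vectorMatroid.
encode : (I : Subset n) → Subset n → Fin (2 ^ ∣ I ∣)
encode []            D       = zero
encode (outside ∷ I) (d ∷ D) = encode I D
encode (inside  ∷ I) (d ∷ D) = combine (B.from d) (encode I D)

encode-injective : (I : Subset n) {C D : Subset n} → C ⊆ I → D ⊆ I → encode I C ≡ encode I D → C ≡ D
encode-injective [] {[]} {[]} _ _ _ = refl
encode-injective (outside ∷ I) {inside ∷ C} C⊆ _ _ with () ← C⊆ here
encode-injective (outside ∷ I) {outside ∷ C} {inside ∷ D} _ D⊆ _ with () ← D⊆ here
encode-injective (outside ∷ I) {outside ∷ C} {outside ∷ D} C⊆ D⊆ eq =
  cong (outside ∷_) (encode-injective I (drop-∷-⊆ C⊆) (drop-∷-⊆ D⊆) eq)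
encode-injective (inside ∷ I) {c ∷ C} {d ∷ D} C⊆ D⊆ eq
  with c≡d , C≡D ← combine-injective (B.from c) (encode I C) (B.from d) (encode I D) eq =
  cong₂ _∷_ (bit-injective c≡d) (encode-injective I (drop-∷-⊆ C⊆) (drop-∷-⊆ D⊆) C≡D)

decode : (J : Subset n) → Fin (2 ^ ∣ J ∣) → Subset n
decode []            i = []
decode (outside ∷ J) i = outside ∷ decode J i
decode (inside  ∷ J) i = let b , i′ = remQuot {2} (2 ^ ∣ J ∣) i in B.to b ∷ decode J i′

decode-⊆ : (J : Subset n) (i : Fin (2 ^ ∣ J ∣)) → decode J i ⊆ J
decode-⊆ (outside ∷ J) i (there x∈) = there (decode-⊆ J i x∈)
decode-⊆ (inside  ∷ J) i {zero}  x∈ = here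
decode-⊆ (inside  ∷ J) i {suc _} (there x∈) = there (decode-⊆ J _ x∈)

encode-decode : (J : Subset n) (i : Fin (2 ^ ∣ J ∣)) → encode J (decode J i) ≡ i
encode-decode []            zero = refl
encode-decode (outside ∷ J) i    = encode-decode J i
encode-decode (inside  ∷ J) i    = trans
  (cong₂ combine (B.strictlyInverseʳ (proj₁ (remQuot {2} (2 ^ ∣ J ∣) i)))
    (encode-decode J (proj₂ (remQuot {2} (2 ^ ∣ J ∣) i))))
  (combine-remQuot {2} (2 ^ ∣ J ∣) i)

vectorMatroid : (Fin n → Fin k → Bool) → Matroid n
vectorMatroid {n} {k} v = record
  { E       = ⊤
  ; Indep   = LI
  ; Indep?  = LI?
  ; indep⊆E = λ _ → ⊆⊤
  ; ⊥-indep = λ D D⊆⊥ _ → ⊆-antisym D⊆⊥ ⊥⊆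
  ; indep-⊆ = λ I⊆J iJ D D⊆I → iJ D (I⊆J ∘ D⊆I)
  ; augment = aug
  }
  where
  LI : Subset n → Set
  LI = LinearlyIndependent v

  zero? : ∀ D → Dec (∀ j → lincomb v D j ≡ false)
  zero? D = all? (λ j → lincomb v D j Bool.≟ false)

  LI? : Decidable LI
  LI? I = allSubset? (λ D → D ⊆? I →-dec (zero? D →-dec (D ≟ˢ ⊥)))

  Span : Subset n → (Fin k → Bool) → Set
  Span I w = ∃ λ D → D ⊆ I × (∀ j → lincomb v D j ≡ w j)

  aug : ∀ {I J} → LI I → LI J → ∣ I ∣ < ∣ J ∣ → ∃ λ x → x ∈ J × x ∉ I × LI (I ∪ ⁅ x ⁆)
  aug {I} {J} iI iJ I<J
    with any? (λ x → x ∈? J ×-dec (¬? (x ∈? I) ×-dec LI? (I ∪ ⁅ x ⁆)))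
  ... | yes found = found
  ... | no ¬∃ = contradiction s≡t (Fin.<⇒≢ s<t)
    where
    dependent : ∀ x → x ∉ I → ¬ LI (I ∪ ⁅ x ⁆) → Span I (v x)
    dependent x x∉I ¬li with anySubset? (λ D → D ⊆? (I ∪ ⁅ x ⁆) ×-dec (zero? D ×-dec ¬? (D ≟ˢ ⊥)))
    ... | no none = ⊥-elim (¬li (λ D D⊆ D≡0 →
      decidable-stable (D ≟ˢ ⊥) (λ D≢⊥ → none (D , D⊆ , D≡0 , D≢⊥))))
    ... | yes (D , D⊆ , D≡0 , D≢⊥) with x ∈? D
    ...   | no x∉D = contradiction (iI D D⊆I D≡0) D≢⊥
      where
      D⊆I : D ⊆ I
      D⊆I {y} y∈D with x∈p∪q⁻ I ⁅ x ⁆ (D⊆ y∈D)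
      ... | inj₁ y∈I = y∈I
      ... | inj₂ y∈x = contradiction (subst (_∈ D) (x∈⁅y⁆⇒x≡y x y∈x) y∈D) x∉D
    ...   | yes x∈D = D △ ⁅ x ⁆ , D△x⊆I , λ j → trans (lincomb-△ v D ⁅ x ⁆ j)
              (cong₂ _xor_ (D≡0 j) (lincomb-⁅⁆ v x j))
      where
      D△x⊆I : D △ ⁅ x ⁆ ⊆ I
      D△x⊆I {y} y∈ with x∈p∪q⁻ I ⁅ x ⁆ (△-⊆ D⊆ (q⊆p∪q I ⁅ x ⁆) y∈)
      ... | inj₁ y∈I = y∈I
      ... | inj₂ y∈x = contradiction (subst (_∈ D △ ⁅ x ⁆) (x∈⁅y⁆⇒x≡y x y∈x) y∈) (x∈p⇒x∉p△⁅x⁆ D x∈D)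

    element : ∀ x → x ∈ J → Span I (v x)
    element x x∈J with x ∈? I
    ... | yes x∈I = ⁅ x ⁆ , ⁅⁆-⊆ x∈I , lincomb-⁅⁆ v x
    ... | no x∉I = dependent x x∉I (λ li → ¬∃ (x , x∈J , x∉I , li))

    spans : ∀ T → T ⊆ J → Span I (lincomb v T)
    spans T T⊆J = lincomb-closed v (Span I)
      (λ { f≡g (D , D⊆ , D≡) → D , D⊆ , λ j → trans (D≡ j) (f≡g j) })
      (⊥ , ⊥⊆ , lincomb-⊥ v)
      (λ { (C , C⊆ , C≡) (D , D⊆ , D≡) → C △ D , △-⊆ C⊆ D⊆ ,
           λ j → trans (lincomb-△ v C D j) (cong₂ _xor_ (C≡ j) (D≡ j)) })
      T (λ x x∈T → element x (T⊆J x∈T))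

    span : (i : Fin (2 ^ ∣ J ∣)) → Span I (lincomb v (decode J i))
    span i = spans (decode J i) (decode-⊆ J i)

    collision = pigeonhole (ℕ.^-monoʳ-< 2 (s≤s (s≤s z≤n)) I<J) (λ i → encode I (proj₁ (span i)))
    s = proj₁ collision
    t = proj₁ (proj₂ collision)
    s<t = proj₁ (proj₂ (proj₂ collision))

    same : proj₁ (span s) ≡ proj₁ (span t)
    same = encode-injective I (proj₁ (proj₂ (span s))) (proj₁ (proj₂ (span t)))
      (proj₂ (proj₂ (proj₂ collision)))

    agree : ∀ j → lincomb v (decode J s) j ≡ lincomb v (decode J t) j
    agree j = trans (sym (proj₂ (proj₂ (span s)) j))
      (trans (cong (λ D → lincomb v D j) same) (proj₂ (proj₂ (span t)) j))

    s≡t : s ≡ t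
    s≡t = trans (sym (encode-decode J s)) (trans (cong (encode J)
      (p△q≡⊥⇒p≡q (decode J s) (decode J t)
        (iJ (decode J s △ decode J t) (△-⊆ (decode-⊆ J s) (decode-⊆ J t)) (λ j →
          trans (lincomb-△ v (decode J s) (decode J t) j)
            (trans (cong (_xor lincomb v (decode J t) j) (agree j)) (Bool.xor-same (lincomb v (decode J t) j)))))))
      (encode-decode J t))

-- x runs over all of GF(2)^m, through its binary digits.
vector : (m : ℕ) → Fin (2 ^ m) → Fin m → Bool
vector m x j = Inverse.to 2↔Bool (finToFun x j)

-- In PG d, AG d and AG+ d e the index d is the projective or affine
-- dimension: these matroids have rank d + 1.
PG : (d : ℕ) → Matroid (2 ^ suc d)
PG d = vectorMatroid (vector (suc d)) ↾ nonzero
  where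
  nonzero : Subset (2 ^ suc d)
  nonzero = tabulate (λ x → does (any? (λ j → vector (suc d) x j Bool.≟ true)))

-- The hyperplane of PG d where the first coordinate vanishes. All
-- hyperplanes are equivalent under the automorphisms of PG d.
H : (d : ℕ) → Subset (2 ^ suc d)
H d = E (PG d) ∩ tabulate (λ x → not (vector (suc d) x zero))

AG : (d : ℕ) → Matroid (2 ^ suc d)
AG d = PG d ╲ H d

-- For e ∈ H d this is the extension AG(d,2)+e; up to isomorphism it does
-- not depend on the choice of e in H d.
AG+ : (d : ℕ) → Fin (2 ^ suc d) → Matroid (2 ^ suc d)
AG+ d e = PG d ╲ (H d - e)

{-# OPTIONS --safe #-}

-- Series contraction preserves and reflects the circuit-difference property,
-- so M is an excluded series minor exactly when M * is simple (given that
-- every element lies in a circuit), some pair of intersecting circuits has a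
-- difference that is not a circuit, and every such pair covers E M.
-- If M has nullity 2, it is U k (k + 2). If the nullity is at least 3, two
-- circuits whose union has nullity 2 do not cover E M, so their difference is
-- a circuit; hence every circuit is a sum of fundamental circuits with respect
-- to every base, and M * is binary. The circuits of M are then the minimal
-- supports of linear functionals. For a covering pair c₁, c₂ write
-- φ = c₁ △ c₂; since pairs that do not cover E M behave well, c₁ and c₂ meet
-- in a single point e, the complement of φ, and every functional other than 0
-- and φ is a circuit. The latter says that the points with φ = 1 meet every
-- flat of codimension 2 of the affine geometry φ = 1, that is, the set X of
-- missing points contains no AG(r-3,2).

module Submission where

open import Defs
open import Data.Bool.Base using (Bool; true; false; not; _∧_; _xor_; if_then_else_)
import Data.Bool.Properties as Bool
open import Data.Empty using (⊥-elim) renaming (⊥ to False)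
open import Data.Fin.Base using (Fin; zero; suc; combine; finToFun; funToFin)
open import Data.Fin.Properties using (any?; 2↔Bool; suc-injective)
import Data.Fin.Properties as Fin
open import Data.Fin.Subset
open import Data.Fin.Subset.Properties
open import Data.Nat.Base using (ℕ; zero; suc; _+_; _∸_; _^_; _≤_; _<_; z≤n; s≤s)
import Data.Nat.Properties as ℕ
open import Data.Product.Base using (∃; _×_; _,_; proj₁; proj₂)
open import Data.Sum.Base using (_⊎_; inj₁; inj₂)
open import Data.Vec.Base using ([]; _∷_; here; there; lookup; tabulate; insertAt; removeAt)
import Data.Vec.Properties as Vec
open import Function.Base using (_∘_; id)
open import Function.Bundles using (_⇔_; _↔_; Inverse; Equivalence; mk⇔; mk↔ₛ′)
open import Relation.Binary.Construct.Closure.ReflexiveTransitive using (ε; _◅_)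
open import Relation.Binary.PropositionalEquality using (_≡_; _≢_; refl; sym; trans; cong; cong₂; subst; subst₂)
open import Relation.Nullary using (¬_; Dec; yes; no; contradiction; does)
open import Relation.Nullary.Decidable using (_×-dec_; _→-dec_; ¬?; decidable-stable; dec-true)
open import Relation.Unary using (Decidable)
open import Algebra.Bundles using (CommutativeMonoid; CommutativeRing)
open import Algebra.Properties.CommutativeSemigroup
  (CommutativeMonoid.commutativeSemigroup
    (CommutativeRing.+-commutativeMonoid Bool.xor-∧-commutativeRing)) using (interchange)

-- In a series pair every circuit contains both elements or neither, so contracting one of them
-- keeps all information about circuits and their differences; hence no series pair survives, and
-- only deletions are left to exploit. Deleting one element turns the hypothesis into a closure
-- rule: distinct intersecting circuits that both avoid some element have a circuit as difference.
-- Everything about a violating pair is drawn from this rule. That all functionals other than 0 and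
-- `φ` are circuits rests on complementation. Adding `φ` sends circuits to circuits, and off `e` it
-- complements supports, hence reverses inclusion. A circuit below `a` that agrees with `a` at `e`
-- is therefore `a` itself. Conversely, an inclusion `b ≼ a` forbids points with `a = 0` and
-- `b = 1`, so the affine flat where `a` and `b + φ` vanish has no point of the matroid; two
-- equations cut out this flat, whence codimension two.

private
  variable
    m n k : ℕ

-- Finite subsets

⟪_⟫ : {P : Fin n → Set} → Decidable P → Subset n
⟪ P? ⟫ = tabulate (λ x → does (P? x))

∈⟪⟫⁺ : {P : Fin n → Set} (P? : Decidable P) {x : Fin n} → P x → x ∈ ⟪ P? ⟫
∈⟪⟫⁺ P? {x} Px = Vec.lookup⇒[]= x _ (trans (Vec.lookup∘tabulate _ x) (dec-true (P? x) Px))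

∈⟪⟫⁻ : {P : Fin n → Set} (P? : Decidable P) {x : Fin n} → x ∈ ⟪ P? ⟫ → P x
∈⟪⟫⁻ P? {x} x∈ with P? x in eq
... | yes Px = Px
... | no _ with () ← trans (sym (Vec.[]=⇒lookup x∈)) (trans (Vec.lookup∘tabulate _ x) (cong does eq))

lookup-∉ : (p : Subset n) {x : Fin n} → x ∉ p → lookup p x ≡ false
lookup-∉ p {x} x∉p with lookup p x in eq
... | true = contradiction (Vec.lookup⇒[]= x p eq) x∉p
... | false = refl

lookup⇒∉ : (p : Subset n) {x : Fin n} → lookup p x ≡ false → x ∉ p
lookup⇒∉ p eq x∈p with () ← trans (sym (Vec.[]=⇒lookup x∈p)) eq

lookup-ext : {p q : Subset n} → (∀ x → lookup p x ≡ lookup q x) → p ≡ q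
lookup-ext {p = p} {q} eq =
  trans (sym (Vec.tabulate∘lookup p)) (trans (Vec.tabulate-cong eq) (Vec.tabulate∘lookup q))

lookup-△ : (p q : Subset n) (x : Fin n) → lookup (p △ q) x ≡ lookup p x xor lookup q x
lookup-△ p q x = Vec.lookup-zipWith _xor_ x p q

lookup-⊥ : (x : Fin n) → lookup ⊥ x ≡ false
lookup-⊥ {n} x = lookup-∉ (⊥ {n}) ∉⊥

∈△⁺ˡ : (p q : Subset n) {x : Fin n} → x ∈ p → x ∉ q → x ∈ p △ q
∈△⁺ˡ p q {x} x∈p x∉q = Vec.lookup⇒[]= x _
  (trans (lookup-△ p q x) (cong₂ _xor_ (Vec.[]=⇒lookup x∈p) (lookup-∉ q x∉q)))

∈△⁺ʳ : (p q : Subset n) {x : Fin n} → x ∉ p → x ∈ q → x ∈ p △ q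
∈△⁺ʳ p q {x} x∉p x∈q = Vec.lookup⇒[]= x _
  (trans (lookup-△ p q x) (cong₂ _xor_ (lookup-∉ p x∉p) (Vec.[]=⇒lookup x∈q)))

∉△ : (p q : Subset n) {x : Fin n} → x ∈ p → x ∈ q → x ∉ p △ q
∉△ p q {x} x∈p x∈q = lookup⇒∉ (p △ q)
  (trans (lookup-△ p q x) (cong₂ _xor_ (Vec.[]=⇒lookup x∈p) (Vec.[]=⇒lookup x∈q)))

∉△′ : (p q : Subset n) {x : Fin n} → x ∉ p → x ∉ q → x ∉ p △ q
∉△′ p q {x} x∉p x∉q = lookup⇒∉ (p △ q)
  (trans (lookup-△ p q x) (cong₂ _xor_ (lookup-∉ p x∉p) (lookup-∉ q x∉q)))

∈△⁻ : (p q : Subset n) {x : Fin n} → x ∈ p △ q → (x ∈ p × x ∉ q) ⊎ (x ∉ p × x ∈ q)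
∈△⁻ p q {x} x∈ with x ∈? p | x ∈? q
... | yes x∈p | yes x∈q = contradiction x∈ (∉△ p q x∈p x∈q)
... | yes x∈p | no x∉q = inj₁ (x∈p , x∉q)
... | no x∉p | yes x∈q = inj₂ (x∉p , x∈q)
... | no x∉p | no x∉q = contradiction x∈ (∉△′ p q x∉p x∉q)

△-comm : (p q : Subset n) → p △ q ≡ q △ p
△-comm = Vec.zipWith-comm Bool.xor-comm

△-assoc : (p q r : Subset n) → (p △ q) △ r ≡ p △ (q △ r)
△-assoc = Vec.zipWith-assoc Bool.xor-assoc

△-identityˡ : (p : Subset n) → ⊥ △ p ≡ p
△-identityˡ = Vec.zipWith-identityˡ Bool.xor-identityˡ

△-identityʳ : (p : Subset n) → p △ ⊥ ≡ p
△-identityʳ p = trans (△-comm p ⊥) (△-identityˡ p)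

△-self : (p : Subset n) → p △ p ≡ ⊥
△-self p = lookup-ext λ x →
  trans (lookup-△ p p x) (trans (Bool.xor-same (lookup p x)) (sym (lookup-⊥ x)))

△-cancelˡ : (p q : Subset n) → p △ (p △ q) ≡ q
△-cancelˡ p q = trans (sym (△-assoc p p q)) (trans (cong (_△ q) (△-self p)) (△-identityˡ q))

△-cancelʳ : (p q : Subset n) → (p △ q) △ q ≡ p
△-cancelʳ p q = trans (△-assoc p q q) (trans (cong (p △_) (△-self q)) (△-identityʳ p))

△-cross : (p q r : Subset n) → (p △ q) △ (p △ r) ≡ q △ r
△-cross p q r = trans (cong (_△ (p △ r)) (△-comm p q)) (trans (△-assoc q p (p △ r)) (cong (q △_) (△-cancelˡ p r)))

△-≢⊥ : {p q : Subset n} → p ≢ q → p △ q ≢ ⊥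
△-≢⊥ {p = p} {q} p≢q eq = p≢q (p△q≡⊥⇒p≡q p q eq)

⊆∧≢⇒⊂ : {p q : Subset n} → p ⊆ q → p ≢ q → p ⊂ q
⊆∧≢⇒⊂ {p = p} {q} p⊆q p≢q with any? (λ x → x ∈? q ×-dec ¬? (x ∈? p))
... | yes found = p⊆q , found
... | no ¬∃ = contradiction (⊆-antisym p⊆q q⊆p) p≢q
  where
  q⊆p : q ⊆ p
  q⊆p {x} x∈q with x ∈? p
  ... | yes x∈p = x∈p
  ... | no x∉p = contradiction (x , x∈q , x∉p) ¬∃

⊆∧∣∣≤⇒≡ : {p q : Subset n} → p ⊆ q → ∣ q ∣ ≤ ∣ p ∣ → p ≡ q
⊆∧∣∣≤⇒≡ {p = p} {q} p⊆q q≤p with p ≟ˢ q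
... | yes p≡q = p≡q
... | no p≢q = contradiction q≤p (ℕ.<⇒≱ (p⊂q⇒∣p∣<∣q∣ (⊆∧≢⇒⊂ p⊆q p≢q)))

∉-∪ : {p q : Subset n} {x : Fin n} → x ∉ p → x ∉ q → x ∉ p ∪ q
∉-∪ {p = p} {q} x∉p x∉q x∈ with x∈p∪q⁻ p q x∈
... | inj₁ x∈p = x∉p x∈p
... | inj₂ x∈q = x∉q x∈q

∈∪⁅⁆ : (p : Subset n) (x : Fin n) → x ∈ p ∪ ⁅ x ⁆
∈∪⁅⁆ p x = q⊆p∪q p ⁅ x ⁆ (x∈⁅x⁆ x)

∈∪⁅⁆⁻ : (p : Subset n) {x y : Fin n} → y ∈ p ∪ ⁅ x ⁆ → y ≢ x → y ∈ p
∈∪⁅⁆⁻ p {x} y∈ y≢x with x∈p∪q⁻ p ⁅ x ⁆ y∈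
... | inj₁ y∈p = y∈p
... | inj₂ y∈x = contradiction (x∈⁅y⁆⇒x≡y x y∈x) y≢x

-- The fuel `d` bounds the measure, so each strictly smaller candidate leaves enough of it.
-- Abstracting the order lets one search serve inclusion, reverse inclusion and `≼`.
size-minimal : {A : Set} (size : A → ℕ) (_<ᴬ_ : A → A → Set) → (∀ {a b} → a <ᴬ b → size a < size b) →
  {P : A → Set} → (∀ b → Dec (∃ λ a → P a × a <ᴬ b)) → ∀ {a} → P a →
  ∃ λ b → P b × (∀ c → P c → ¬ c <ᴬ b)
size-minimal {A} size _<ᴬ_ mono {P} search {a} Pa = go (size a) a Pa ℕ.≤-refl
  where
  go : ∀ d b → P b → size b ≤ d → ∃ λ c → P c × (∀ c′ → P c′ → ¬ c′ <ᴬ c)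
  go d b Pb b≤d with search b
  go d b Pb b≤d | no ¬∃ = b , Pb , λ c Pc c<b → ¬∃ (c , Pc , c<b)
  go zero b Pb b≤d | yes (c , Pc , c<b) = contradiction (ℕ.≤-trans (mono c<b) b≤d) λ ()
  go (suc d) b Pb b≤d | yes (c , Pc , c<b) = go d c Pc (ℕ.≤-pred (ℕ.≤-trans (mono c<b) b≤d))

minimal : {P : Subset n → Set} → Decidable P → ∀ {A} → P A →
          ∃ λ B → P B × B ⊆ A × (∀ C → P C → C ⊆ B → C ≡ B)
minimal {P = P} P? {A} PA
  with size-minimal ∣_∣ _⊂_ p⊂q⇒∣p∣<∣q∣ {λ B → P B × B ⊆ A}
    (λ B → anySubset? (λ C → (P? C ×-dec C ⊆? A) ×-dec C ⊂? B)) (PA , ⊆-refl)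
... | B , (PB , B⊆A) , min = B , PB , B⊆A , λ C PC C⊆B → decidable-stable (C ≟ˢ B)
  (λ C≢B → min C (PC , ⊆-trans C⊆B B⊆A) (⊆∧≢⇒⊂ C⊆B C≢B))

maximal : {P : Subset n → Set} → Decidable P → ∀ {A} → P A →
          ∃ λ B → P B × A ⊆ B × (∀ C → P C → B ⊆ C → C ≡ B)
maximal {n = n} {P} P? {A} PA
  with size-minimal (∣_∣ ∘ ∁) (λ p q → q ⊂ p) (λ { {a} {b} b⊂a → p⊂q⇒∣p∣<∣q∣ (p⊂q⇒∁p⊃∁q b⊂a) })
    {λ B → P B × A ⊆ B} (λ B → anySubset? (λ C → (P? C ×-dec A ⊆? C) ×-dec B ⊂? C)) (PA , ⊆-refl)
... | B , (PB , A⊆B) , max = B , PB , A⊆B , λ C PC B⊆C → decidable-stable (C ≟ˢ B)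
  (λ C≢B → max C (PC , ⊆-trans A⊆B B⊆C) (⊆∧≢⇒⊂ B⊆C (C≢B ∘ sym)))

element : (p : Subset n) → Fin ∣ p ∣ → Fin n
element (inside  ∷ p) zero    = zero
element (inside  ∷ p) (suc i) = suc (element p i)
element (outside ∷ p) i       = suc (element p i)

element-∈ : (p : Subset n) (i : Fin ∣ p ∣) → element p i ∈ p
element-∈ (inside  ∷ p) zero    = here
element-∈ (inside  ∷ p) (suc i) = there (element-∈ p i)
element-∈ (outside ∷ p) i       = there (element-∈ p i)

element-injective : (p : Subset n) {i j : Fin ∣ p ∣} → element p i ≡ element p j → i ≡ j
element-injective (inside  ∷ p) {zero}  {zero}  eq = refl
element-injective (inside  ∷ p) {suc i} {suc j} eq = cong suc (element-injective p (suc-injective eq))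
element-injective (outside ∷ p) eq = element-injective p (suc-injective eq)

position : (p : Subset n) {x : Fin n} → x ∈ p → Fin ∣ p ∣
position (inside  ∷ p) here       = zero
position (inside  ∷ p) (there x∈) = suc (position p x∈)
position (outside ∷ p) (there x∈) = position p x∈

element-position : (p : Subset n) {x : Fin n} (x∈ : x ∈ p) → element p (position p x∈) ≡ x
element-position (inside  ∷ p) here       = refl
element-position (inside  ∷ p) (there x∈) = cong suc (element-position p x∈)
element-position (outside ∷ p) (there x∈) = cong suc (element-position p x∈)

∣∣-injection : (p : Subset m) (q : Subset n) (f : ∀ {x} → x ∈ p → Fin n) →
  (∀ {x} (x∈ : x ∈ p) → f x∈ ∈ q) →
  (∀ {x y} (x∈ : x ∈ p) (y∈ : y ∈ p) → f x∈ ≡ f y∈ → x ≡ y) → ∣ p ∣ ≤ ∣ q ∣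
∣∣-injection p q f f∈ inj = Fin.injective⇒≤ {f = λ i → position q (f∈ (element-∈ p i))} λ {i} {j} eq →
  element-injective p (inj (element-∈ p i) (element-∈ p j)
    (trans (sym (element-position q (f∈ (element-∈ p i))))
      (trans (cong (element q) eq) (element-position q (f∈ (element-∈ p j))))))

∈-irrelevant : {p : Subset n} {x : Fin n} (a b : x ∈ p) → a ≡ b
∈-irrelevant here      here      = refl
∈-irrelevant (there a) (there b) = cong there (∈-irrelevant a b)

∣p-x∣ : (p : Subset n) {x : Fin n} → x ∈ p → ∣ p ∣ ≡ suc ∣ p - x ∣
∣p-x∣ p {x} x∈p = trans (cong ∣_∣ p≡) (∣p∪⁅x⁆∣ (p - x) (λ x∈ → x∈p─q⇒x∉q p ⁅ x ⁆ x∈ (x∈⁅x⁆ x)))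
  where
  p⊆ : p ⊆ (p - x) ∪ ⁅ x ⁆
  p⊆ {y} y∈p with y Fin.≟ x
  ... | yes refl = ∈∪⁅⁆ (p - x) x
  ... | no y≢x = p⊆p∪q ⁅ x ⁆ (x∈p∧x≢y⇒x∈p-y y∈p y≢x)

  p≡ : p ≡ (p - x) ∪ ⁅ x ⁆
  p≡ = ⊆-antisym p⊆ (∪-⊆ (p─q⊆p p ⁅ x ⁆) (⁅⁆-⊆ x∈p))

x∉p-x : (p : Subset n) {x : Fin n} → x ∉ p - x
x∉p-x p {x} x∈ = x∈p─q⇒x∉q p ⁅ x ⁆ x∈ (x∈⁅x⁆ x)

∣p∣>0⇒∃ : (p : Subset n) → 0 < ∣ p ∣ → ∃ λ x → x ∈ p
∣p∣>0⇒∃ {n} p 0<p = let x , x∈ , _ = ∃∈─ ⊥ p (subst (_< ∣ p ∣) (sym (∣⊥∣≡0 n)) 0<p) in x , x∈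

-- Circuits as minimal supports of functionals

-- Pt are the points of a matroid represented over GF(2), and ev a x is the
-- value at x of the functional with coefficients a.
module Functionals {Pt : Set} (_≟ᴾ_ : (x y : Pt) → Dec (x ≡ y))
  (some? : ∀ {P : Pt → Set} → Decidable P → Dec (∃ P))
  (ev : Subset k → Pt → Bool)
  (ev-△ : ∀ a b x → ev (a △ b) x ≡ ev a x xor ev b x)
  (faithful : ∀ {a} → (∀ x → ev a x ≡ false) → a ≡ ⊥)
  (size : Subset k → ℕ)
  (size-mono : ∀ {a b} → (∀ x → ev a x ≡ true → ev b x ≡ true) → a ≢ b → size a < size b)
  where

  infix 4 _≼_

  _≼_ : Subset k → Subset k → Set
  a ≼ b = ∀ x → ev a x ≡ true → ev b x ≡ true

  -- The support of a is a circuit of the dual matroid.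
  Circ : Subset k → Set
  Circ a = a ≢ ⊥ × (∀ b → b ≢ ⊥ → b ≼ a → b ≡ a)

  bit : (b : Bool) → b ≡ true ⊎ b ≡ false
  bit true  = inj₁ refl
  bit false = inj₂ refl

  clash : {b : Bool} {A : Set} → b ≡ true → b ≡ false → A
  clash refl ()

  infixr 6 _⊕_

  -- The values at a point are mostly closed booleans, so `p xor q` reduces and the value of the sum
  -- comes out as plain `true` or `false`.
  _⊕_ : ∀ {a b x p q} → ev a x ≡ p → ev b x ≡ q → ev (a △ b) x ≡ p xor q
  _⊕_ {a} {b} {x} ea eb = trans (ev-△ a b x) (cong₂ _xor_ ea eb)

  differ : ∀ {a b x} → ev a x ≡ true → ev b x ≡ false → a ≢ b
  differ ea eb refl = clash ea eb

  differ′ : ∀ {a b x} → ev a x ≡ false → ev b x ≡ true → a ≢ b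
  differ′ ea eb refl = clash eb ea

  ev-⊥ : ∀ x → ev ⊥ x ≡ false
  ev-⊥ x = trans (cong (λ a → ev a x) (sym (△-self ⊥)))
    (trans (ev-△ ⊥ ⊥ x) (Bool.xor-same (ev ⊥ x)))

  nonzero : ∀ {a x} → ev a x ≡ true → a ≢ ⊥
  nonzero {x = x} ea = differ ea (ev-⊥ x)

  ev-ext : ∀ {a b} → (∀ x → ev a x ≡ ev b x) → a ≡ b
  ev-ext {a} {b} eq = p△q≡⊥⇒p≡q a b (faithful λ x →
    trans (ev-△ a b x) (trans (cong (_xor ev b x) (eq x)) (Bool.xor-same (ev b x))))

  ≼-trans : ∀ {a b c} → a ≼ b → b ≼ c → a ≼ c
  ≼-trans a≼b b≼c x = b≼c x ∘ a≼b x

  _≼?_ : ∀ a b → Dec (a ≼ b)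
  a ≼? b with some? (λ x → ev a x Bool.≟ true ×-dec ev b x Bool.≟ false)
  ... | yes (x , ea , eb) = no (λ a≼b → clash (a≼b x ea) eb)
  ... | no ¬∃ = yes a≼b
    where
    a≼b : a ≼ b
    a≼b x ea with bit (ev b x)
    ... | inj₁ eb = eb
    ... | inj₂ eb = contradiction (x , ea , eb) ¬∃

  △-≼ : ∀ {a b} → b ≼ a → a △ b ≼ a
  △-≼ {a} {b} b≼a x e with bit (ev a x) | bit (ev b x)
  ... | inj₁ ea | _       = ea
  ... | inj₂ ea | inj₁ eb = b≼a x eb
  ... | inj₂ ea | inj₂ eb = clash e (ea ⊕ eb)

  ≼-witness : ∀ {a} → a ≢ ⊥ → ∃ λ x → ev a x ≡ true
  ≼-witness {a} a≢⊥ with some? (λ x → ev a x Bool.≟ true)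
  ... | yes found = found
  ... | no ¬∃ = contradiction (faithful λ x → Bool.¬-not (λ ea → ¬∃ (x , ea))) a≢⊥

  -- Take `b` minimal among the functionals below `a` that are 1 at `x`. A nonzero `c` below `b`
  -- either is 1 at `x`, hence equals `b`, or misses `x`, and then `b △ c` would be smaller than
  -- `b`.
  circ-through : ∀ {a x} → ev a x ≡ true → ∃ λ b → Circ b × b ≼ a × ev b x ≡ true
  circ-through {a} {x} ea
    with size-minimal size (λ b c → b ≼ c × b ≢ c) (λ (b≼c , b≢c) → size-mono b≼c b≢c)
      {λ b → b ≼ a × ev b x ≡ true}
      (λ b → anySubset? (λ c → (c ≼? a ×-dec ev c x Bool.≟ true) ×-dec (c ≼? b ×-dec ¬? (c ≟ˢ b))))
      ((λ _ → id) , ea)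
  ... | b , (b≼a , eb) , min = b , (nonzero eb , circ) , b≼a , eb
    where
    circ : ∀ c → c ≢ ⊥ → c ≼ b → c ≡ b
    circ c c≢⊥ c≼b with bit (ev c x)
    ... | inj₁ ec = decidable-stable (c ≟ˢ b) (λ c≢b → min c (≼-trans c≼b b≼a , ec) (c≼b , c≢b))
    ... | inj₂ ec = contradiction
      (≼-trans (△-≼ c≼b) b≼a , (eb ⊕ ec)) (λ Pbc → min (b △ c) Pbc (△-≼ c≼b , b△c≢b))
      where
      b△c≢b : b △ c ≢ b
      b△c≢b eq = c≢⊥ (trans (sym (△-cancelˡ b c)) (trans (cong (b △_) eq) (△-self b)))

  circ-below : ∀ {a} → a ≢ ⊥ → ∃ λ b → Circ b × b ≼ a
  circ-below a≢⊥ with ≼-witness a≢⊥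
  ... | x , ea with circ-through ea
  ...   | b , circ , b≼a , _ = b , circ , b≼a

  disjoint-not-circ : ∀ {a b} → a ≢ ⊥ → b ≢ ⊥ → (∀ x → ev a x ≡ true → ev b x ≡ false) → ¬ Circ (a △ b)
  disjoint-not-circ {a} {b} a≢⊥ b≢⊥ disj (_ , min) = b≢⊥
    (trans (sym (△-cancelˡ a b)) (trans (cong (a △_) (sym a≡)) (△-self a)))
    where
    a≡ : a ≡ a △ b
    a≡ = min a a≢⊥ (λ x ea → ea ⊕ disj x ea)

  -- The consequence of minimality of an excluded series minor: only pairs of
  -- circuits that cover the ground set can violate the circuit-difference
  -- property.
  Closed : Set
  Closed = ∀ {a b} → Circ a → Circ b → a ≢ b → ∀ {x y} →
    ev a x ≡ true → ev b x ≡ true → ev a y ≡ false → ev b y ≡ false → Circ (a △ b)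

  Values : (c₁ c₂ c₃ c₄ : Subset k) (b₁ b₂ b₃ b₄ : Bool) → Pt → Set
  Values c₁ c₂ c₃ c₄ b₁ b₂ b₃ b₄ x =
    ev c₁ x ≡ b₁ × ev c₂ x ≡ b₂ × ev c₃ x ≡ b₃ × ev c₄ x ≡ b₄

  -- Every point lies in exactly two of the four circuits. The sixth pair does not occur, `c₃` and
  -- `c₄` being disjoint.
  data Pattern (c₁ c₂ c₃ c₄ : Subset k) (x : Pt) : Set where
    in-12 : Values c₁ c₂ c₃ c₄ true true false false x → Pattern c₁ c₂ c₃ c₄ x
    in-13 : Values c₁ c₂ c₃ c₄ true false true false x → Pattern c₁ c₂ c₃ c₄ x
    in-14 : Values c₁ c₂ c₃ c₄ true false false true x → Pattern c₁ c₂ c₃ c₄ x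
    in-23 : Values c₁ c₂ c₃ c₄ false true true false x → Pattern c₁ c₂ c₃ c₄ x
    in-24 : Values c₁ c₂ c₃ c₄ false true false true x → Pattern c₁ c₂ c₃ c₄ x

  -- A violation of the circuit-difference property: c₁ △ c₂ splits into the
  -- disjoint circuits c₃ and c₄.
  record Split (c₁ c₂ c₃ c₄ : Subset k) (e : Pt) : Set where
    field
      circ₁   : Circ c₁
      circ₂   : Circ c₂
      circ₃   : Circ c₃
      circ₄   : Circ c₄
      sum     : c₁ △ c₂ ≡ c₃ △ c₄
      ¬circ   : ¬ Circ (c₃ △ c₄)
      e∈c₁    : ev c₁ e ≡ true
      e∈c₂    : ev c₂ e ≡ true
      pattern-at : ∀ x → Pattern c₁ c₂ c₃ c₄ x
      some-13 : ∃ (Values c₁ c₂ c₃ c₄ true false true false)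
      some-14 : ∃ (Values c₁ c₂ c₃ c₄ true false false true)
      some-23 : ∃ (Values c₁ c₂ c₃ c₄ false true true false)
      some-24 : ∃ (Values c₁ c₂ c₃ c₄ false true false true)

    at-common : ∀ {x} → ev c₁ x ≡ true → ev c₂ x ≡ true → ev c₃ x ≡ false × ev c₄ x ≡ false
    at-common {x} h₁ h₂ with pattern-at x
    ... | in-12 (_ , _ , h₃ , h₄) = h₃ , h₄
    ... | in-13 (_ , h , _) = clash h₂ h
    ... | in-14 (_ , h , _) = clash h₂ h
    ... | in-23 (h , _) = clash h₁ h
    ... | in-24 (h , _) = clash h₁ h

    e∉c₃ : ev c₃ e ≡ false
    e∉c₃ = proj₁ (at-common e∈c₁ e∈c₂)

    e∉c₄ : ev c₄ e ≡ false
    e∉c₄ = proj₂ (at-common e∈c₁ e∈c₂)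

    disjoint₃₄ : ∀ {x} → ev c₃ x ≡ true → ev c₄ x ≡ false
    disjoint₃₄ {x} x₃ with pattern-at x
    ... | in-12 (_ , _ , _ , h) = h
    ... | in-13 (_ , _ , _ , h) = h
    ... | in-14 (_ , _ , h , _) = clash x₃ h
    ... | in-23 (_ , _ , _ , h) = h
    ... | in-24 (_ , _ , h , _) = clash x₃ h

    disjoint₄₃ : ∀ {x} → ev c₄ x ≡ true → ev c₃ x ≡ false
    disjoint₄₃ {x} x₄ with bit (ev c₃ x)
    ... | inj₁ x₃ = clash x₄ (disjoint₃₄ x₃)
    ... | inj₂ x₃ = x₃

  swap₃₄ : ∀ {c₁ c₂ c₃ c₄ e} → Split c₁ c₂ c₃ c₄ e → Split c₁ c₂ c₄ c₃ e
  swap₃₄ {c₁} {c₂} {c₃} {c₄} s = record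
    { circ₁ = S.circ₁ ; circ₂ = S.circ₂ ; circ₃ = S.circ₄ ; circ₄ = S.circ₃
    ; sum = trans (S.sum) (△-comm c₃ c₄) ; ¬circ = S.¬circ ∘ subst Circ (△-comm c₄ c₃)
    ; e∈c₁ = S.e∈c₁ ; e∈c₂ = S.e∈c₂
    ; pattern-at = λ x → swap-pattern (S.pattern-at x)
    ; some-13 = swap (S.some-14) ; some-14 = swap (S.some-13)
    ; some-23 = swap (S.some-24) ; some-24 = swap (S.some-23) }
    where
    module S = Split s

    swap-values : ∀ {b₁ b₂ b₃ b₄ x} → Values c₁ c₂ c₃ c₄ b₁ b₂ b₃ b₄ x → Values c₁ c₂ c₄ c₃ b₁ b₂ b₄ b₃ x
    swap-values (h₁ , h₂ , h₃ , h₄) = h₁ , h₂ , h₄ , h₃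

    swap : ∀ {b₁ b₂ b₃ b₄} → ∃ (Values c₁ c₂ c₃ c₄ b₁ b₂ b₃ b₄) → ∃ (Values c₁ c₂ c₄ c₃ b₁ b₂ b₄ b₃)
    swap (x , h) = x , swap-values h

    swap-pattern : ∀ {x} → Pattern c₁ c₂ c₃ c₄ x → Pattern c₁ c₂ c₄ c₃ x
    swap-pattern (in-12 h) = in-12 (swap-values h)
    swap-pattern (in-13 h) = in-14 (swap-values h)
    swap-pattern (in-14 h) = in-13 (swap-values h)
    swap-pattern (in-23 h) = in-24 (swap-values h)
    swap-pattern (in-24 h) = in-23 (swap-values h)

  -- Structure of a pair of circuits that violates the property

  module BadPair (closed : Closed) where

    module _ {c₁ c₂ e} (circ₁ : Circ c₁) (circ₂ : Circ c₂) (c₁≢c₂ : c₁ ≢ c₂)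
      (e₁ : ev c₁ e ≡ true) (e₂ : ev c₂ e ≡ true) (¬circφ : ¬ Circ (c₁ △ c₂))
      {c₃ c₄} (circ₃ : Circ c₃) (circ₄ : Circ c₄)
      (c₃≼φ : c₃ ≼ c₁ △ c₂) (c₄≼φ+c₃ : c₄ ≼ (c₁ △ c₂) △ c₃)
      where

      private
        φ = c₁ △ c₂

      cover : ∀ {y} {A : Set} → ev c₁ y ≡ false → ev c₂ y ≡ false → A
      cover h₁ h₂ = ⊥-elim (¬circφ (closed circ₁ circ₂ c₁≢c₂ e₁ e₂ h₁ h₂))

      c₄≼φ : c₄ ≼ φ
      c₄≼φ = ≼-trans c₄≼φ+c₃ (△-≼ c₃≼φ)

      disjoint : ∀ {x} → ev c₄ x ≡ true → ev c₃ x ≡ false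
      disjoint {x} h₄ with bit (ev c₃ x)
      ... | inj₁ h₃ = clash (c₄≼φ+c₃ x h₄) (c₃≼φ x h₃ ⊕ h₃)
      ... | inj₂ h₃ = h₃

      disjoint′ : ∀ {x} → ev c₃ x ≡ true → ev c₄ x ≡ false
      disjoint′ {x} h₃ with bit (ev c₄ x)
      ... | inj₁ h₄ = clash h₃ (disjoint h₄)
      ... | inj₂ h₄ = h₄

      e∉φ : ev φ e ≡ false
      e∉φ = e₁ ⊕ e₂

      -- Otherwise `c` would lie below the circuit `b` and equal it, although `b` contains `e` and
      -- `φ` does not.
      meets : ∀ {c a b} → Circ c → c ≼ φ → Circ b → ev b e ≡ true →
        (∀ {x} → ev a x ≡ false → ev b x ≡ false → ¬ Pt) → ∃ λ x → ev c x ≡ true × ev a x ≡ true × ev b x ≡ false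
      meets {c} {a} {b} circ c≼φ circ-b be covered
        with some? (λ x → ev c x Bool.≟ true ×-dec (ev a x Bool.≟ true ×-dec ev b x Bool.≟ false))
      ... | yes found = found
      ... | no ¬∃ = clash (c≼φ e (trans (cong (λ d → ev d e) (proj₂ circ-b c (proj₁ circ) c≼b)) be)) e∉φ
        where
        c≼b : c ≼ b
        c≼b x h with bit (ev a x) | bit (ev b x)
        ... | _      | inj₁ bx = bx
        ... | inj₁ ax | inj₂ bx = contradiction (x , h , ax , bx) ¬∃
        ... | inj₂ ax | inj₂ bx = contradiction x (covered ax bx)

      meets₁ : ∀ {c} → Circ c → c ≼ φ → ∃ λ x → ev c x ≡ true × ev c₁ x ≡ true × ev c₂ x ≡ false
      meets₁ circ c≼φ = meets circ c≼φ circ₂ e₂ cover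

      meets₂ : ∀ {c} → Circ c → c ≼ φ → ∃ λ x → ev c x ≡ true × ev c₂ x ≡ true × ev c₁ x ≡ false
      meets₂ circ c≼φ = meets circ c≼φ circ₁ e₁ (λ h₂ h₁ → cover h₁ h₂)

      s₁₃ : ∃ (Values c₁ c₂ c₃ c₄ true false true false)
      s₁₃ = let x , h₃ , h₁ , h₂ = meets₁ circ₃ c₃≼φ in x , h₁ , h₂ , h₃ , disjoint′ h₃

      s₁₄ : ∃ (Values c₁ c₂ c₃ c₄ true false false true)
      s₁₄ = let x , h₄ , h₁ , h₂ = meets₁ circ₄ c₄≼φ in x , h₁ , h₂ , disjoint h₄ , h₄

      s₂₃ : ∃ (Values c₁ c₂ c₃ c₄ false true true false)
      s₂₃ = let x , h₃ , h₂ , h₁ = meets₂ circ₃ c₃≼φ in x , h₁ , h₂ , h₃ , disjoint′ h₃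

      s₂₄ : ∃ (Values c₁ c₂ c₃ c₄ false true false true)
      s₂₄ = let x , h₄ , h₂ , h₁ = meets₂ circ₄ c₄≼φ in x , h₁ , h₂ , disjoint h₄ , h₄

      ¬circ₃₄ : ¬ Circ (c₃ △ c₄)
      ¬circ₃₄ = disjoint-not-circ (proj₁ circ₃) (proj₁ circ₄) (λ _ → disjoint′)

      e₃ : ev c₃ e ≡ false
      e₃ = Bool.¬-not (λ h → clash (c₃≼φ e h) e∉φ)

      e₄ : ev c₄ e ≡ false
      e₄ = Bool.¬-not (λ h → clash (c₄≼φ e h) e∉φ)

      -- If x lay in neither c₃ nor c₄, the circuits c △ c₃ and c △ c₄ would
      -- both avoid x, so their difference c₃ △ c₄ would be a circuit.
      not-missed : ∀ {c x} {A : Set} → Circ c → ev c e ≡ true →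
        (∃ λ y → ev c y ≡ true × ev c₃ y ≡ true) → (∃ λ y → ev c y ≡ false × ev c₃ y ≡ true) →
        (∃ λ y → ev c y ≡ true × ev c₄ y ≡ true) → (∃ λ y → ev c y ≡ false × ev c₄ y ≡ true) →
        ev c x ≡ false → ev c₃ x ≡ false → ev c₄ x ≡ false → A
      not-missed {c} circ e∈ (y₁ , h₁ , h₁′) (y₂ , h₂ , h₂′) (y₃ , h₃ , h₃′) (y₄ , h₄ , h₄′) hx h₃x h₄x =
        ⊥-elim (¬circ₃₄ (subst Circ (△-cross c c₃ c₄)
          (closed c+c₃ c+c₄ (differ′ (h₁ ⊕ h₁′) (h₁ ⊕ disjoint′ h₁′))
            (e∈ ⊕ e₃) (e∈ ⊕ e₄) (hx ⊕ h₃x) (hx ⊕ h₄x))))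
        where
        c+c₃ : Circ (c △ c₃)
        c+c₃ = closed circ circ₃ (differ e∈ e₃) h₁ h₁′ h₄ (disjoint h₄′)

        c+c₄ : Circ (c △ c₄)
        c+c₄ = closed circ circ₄ (differ e∈ e₄) h₃ h₃′ h₂ (disjoint′ h₂′)

      not-missed₁ : ∀ {x} {A : Set} → ev c₁ x ≡ false → ev c₃ x ≡ false → ev c₄ x ≡ false → A
      not-missed₁ =
        let y₁ , h₁ , _ , h₁′ , _ = s₁₃ ; y₂ , h₂ , _ , h₂′ , _ = s₂₃
            y₃ , h₃ , _ , _ , h₃′ = s₁₄ ; y₄ , h₄ , _ , _ , h₄′ = s₂₄
        in not-missed circ₁ e₁ (y₁ , h₁ , h₁′) (y₂ , h₂ , h₂′) (y₃ , h₃ , h₃′) (y₄ , h₄ , h₄′)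

      not-missed₂ : ∀ {x} {A : Set} → ev c₂ x ≡ false → ev c₃ x ≡ false → ev c₄ x ≡ false → A
      not-missed₂ =
        let y₁ , _ , h₁ , h₁′ , _ = s₂₃ ; y₂ , _ , h₂ , h₂′ , _ = s₁₃
            y₃ , _ , h₃ , _ , h₃′ = s₂₄ ; y₄ , _ , h₄ , _ , h₄′ = s₁₄
        in not-missed circ₂ e₂ (y₁ , h₁ , h₁′) (y₂ , h₂ , h₂′) (y₃ , h₃ , h₃′) (y₄ , h₄ , h₄′)

      -- Besides excluding impossible positions, this shows that `c₃` and `c₄` exhaust `φ`: a point
      -- of `φ` in neither is ruled out by `not-missed₁` or `not-missed₂`.
      pat : ∀ x → Pattern c₁ c₂ c₃ c₄ x
      pat x with bit (ev c₁ x) | bit (ev c₂ x) | bit (ev c₃ x) | bit (ev c₄ x)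
      ... | inj₂ h₁ | inj₂ h₂ | _ | _ = cover h₁ h₂
      ... | _ | _ | inj₁ h₃ | inj₁ h₄ = clash h₃ (disjoint h₄)
      ... | inj₁ h₁ | inj₁ h₂ | inj₁ h₃ | inj₂ h₄ = clash (c₃≼φ x h₃) (h₁ ⊕ h₂)
      ... | inj₁ h₁ | inj₁ h₂ | inj₂ h₃ | inj₁ h₄ = clash (c₄≼φ x h₄) (h₁ ⊕ h₂)
      ... | inj₁ h₁ | inj₁ h₂ | inj₂ h₃ | inj₂ h₄ = in-12 (h₁ , h₂ , h₃ , h₄)
      ... | inj₁ h₁ | inj₂ h₂ | inj₁ h₃ | inj₂ h₄ = in-13 (h₁ , h₂ , h₃ , h₄)
      ... | inj₁ h₁ | inj₂ h₂ | inj₂ h₃ | inj₁ h₄ = in-14 (h₁ , h₂ , h₃ , h₄)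
      ... | inj₁ h₁ | inj₂ h₂ | inj₂ h₃ | inj₂ h₄ = not-missed₂ h₂ h₃ h₄
      ... | inj₂ h₁ | inj₁ h₂ | inj₁ h₃ | inj₂ h₄ = in-23 (h₁ , h₂ , h₃ , h₄)
      ... | inj₂ h₁ | inj₁ h₂ | inj₂ h₃ | inj₁ h₄ = in-24 (h₁ , h₂ , h₃ , h₄)
      ... | inj₂ h₁ | inj₁ h₂ | inj₂ h₃ | inj₂ h₄ = not-missed₁ h₁ h₃ h₄

      sum-at : ∀ x → ev (c₁ △ c₂) x ≡ ev (c₃ △ c₄) x
      sum-at x with pat x
      ... | in-12 (h₁ , h₂ , h₃ , h₄) = trans (h₁ ⊕ h₂) (sym (h₃ ⊕ h₄))
      ... | in-13 (h₁ , h₂ , h₃ , h₄) = trans (h₁ ⊕ h₂) (sym (h₃ ⊕ h₄))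
      ... | in-14 (h₁ , h₂ , h₃ , h₄) = trans (h₁ ⊕ h₂) (sym (h₃ ⊕ h₄))
      ... | in-23 (h₁ , h₂ , h₃ , h₄) = trans (h₁ ⊕ h₂) (sym (h₃ ⊕ h₄))
      ... | in-24 (h₁ , h₂ , h₃ , h₄) = trans (h₁ ⊕ h₂) (sym (h₃ ⊕ h₄))

      split : Split c₁ c₂ c₃ c₄ e
      split = record
        { circ₁ = circ₁ ; circ₂ = circ₂ ; circ₃ = circ₃ ; circ₄ = circ₄
        ; sum = ev-ext sum-at ; ¬circ = ¬circ₃₄
        ; e∈c₁ = e₁ ; e∈c₂ = e₂ ; pattern-at = pat
        ; some-13 = s₁₃ ; some-14 = s₁₄ ; some-23 = s₂₃ ; some-24 = s₂₄ }

    split-exists : ∀ {c₁ c₂ e} → Circ c₁ → Circ c₂ → c₁ ≢ c₂ → ev c₁ e ≡ true → ev c₂ e ≡ true →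
      ¬ Circ (c₁ △ c₂) → ∃ λ c₃ → ∃ λ c₄ → Split c₁ c₂ c₃ c₄ e
    split-exists circ₁ circ₂ c₁≢c₂ e₁ e₂ ¬circφ with circ-below (△-≢⊥ c₁≢c₂)
    -- The remainder `φ △ c₃` is nonzero, since `c₃` is a circuit and `φ` is not.
    ... | c₃ , circ₃ , c₃≼φ with circ-below (△-≢⊥ (λ φ≡c₃ → ¬circφ (subst Circ (sym φ≡c₃) circ₃)))
    ...   | c₄ , circ₄ , c₄≼ = c₃ , c₄ , split circ₁ circ₂ c₁≢c₂ e₁ e₂ ¬circφ circ₃ circ₄ c₃≼φ c₄≼

    +circ₃ : ∀ {c₁ c₂ c₃ c₄ e} → Split c₁ c₂ c₃ c₄ e → Circ (c₁ △ c₃)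
    +circ₃ s =
      let _ , h₁ , _ , h₃ , _ = some-13 ; _ , h₁′ , _ , h₃′ , _ = some-24
      in closed circ₁ circ₃ (differ e∈c₁ e∉c₃) h₁ h₃ h₁′ h₃′
      where open Split s

    -- d △ c₃ and d △ c₄ would be circuits avoiding y with difference c₃ △ c₄.
    not-both : ∀ {c₁ c₂ c₃ c₄ e d x y u w} → Split c₁ c₂ c₃ c₄ e → Circ d →
      ev d x ≡ true → ev d y ≡ false →
      ev c₃ x ≡ false → ev c₄ x ≡ false → ev c₃ y ≡ false → ev c₄ y ≡ false →
      ev d u ≡ true → ev c₃ u ≡ true → ev c₄ u ≡ false →
      ev d w ≡ true → ev c₄ w ≡ true → ∀ {A : Set} → A
    not-both {c₃ = c₃} {c₄} {d = d} s circ dx dy x₃ x₄ y₃ y₄ du u₃ u₄ dw w₄ = ⊥-elim (¬circ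
      (subst Circ (△-cross d c₃ c₄)
        (closed (closed circ circ₃ (differ dx x₃) du u₃ dy y₃)
          (closed circ circ₄ (differ dx x₄) dw w₄ dy y₄)
          (differ′ (du ⊕ u₃) (du ⊕ u₄)) (dx ⊕ x₃) (dx ⊕ x₄) (dy ⊕ y₃) (dy ⊕ y₄))))
      where open Split s

    -- As `d` avoids `c₄`, the set `d △ c₁` is a circuit that meets `c₄` and separates `y` from `x`
    -- in the opposite direction. If `d` reached into `c₂ ∩ c₃`, then `d △ c₁` would also meet `c₃`,
    -- against `not-both`. So `d` lies below `c₁` and equals it, although `y` is in `c₁` only.
    misses-c₄ : ∀ {c₁ c₂ c₃ c₄ e d x y} → Split c₁ c₂ c₃ c₄ e → Circ d → ev d x ≡ true → ev d y ≡ false →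
      ev c₁ x ≡ true → ev c₂ x ≡ true → ev c₁ y ≡ true → ev c₂ y ≡ true →
      (∀ z → ev c₄ z ≡ true → ev d z ≡ false) → ∀ {A : Set} → A
    misses-c₄ {c₁} {d = d} {x} {y} s circ dx dy x₁ x₂ y₁ y₂ miss =
      clash y₁ (trans (cong (λ a → ev a y) (sym (proj₂ circ₁ d (proj₁ circ) d≼c₁))) dy)
      where
      open Split s

      circ′ : Circ (d △ c₁)
      circ′ = let w , h₁ , _ , _ , h₄ = some-24
              in closed circ circ₁ (differ′ dy y₁) dx x₁ (miss w h₄) h₁

      d≼c₁ : d ≼ c₁
      d≼c₁ z dz with pattern-at z
      ... | in-12 (h , _) = h
      ... | in-13 (h , _) = h
      ... | in-14 (h , _) = h
      ... | in-23 (h₁ , _ , h₃ , h₄) =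
        let w , w₁ , _ , _ , w₄ = some-14
            x₃ , x₄ = at-common x₁ x₂ ; y₃ , y₄ = at-common y₁ y₂
        in not-both s circ′ (dy ⊕ y₁) (dx ⊕ x₁) y₃ y₄ x₃ x₄ (dz ⊕ h₁) h₃ h₄ (miss w w₄ ⊕ w₁) w₄
      ... | in-24 (_ , _ , _ , h₄) = clash dz (miss z h₄)

    -- No circuit tells two points of `c₁ ∩ c₂` apart: one that meets both `c₃` and `c₄` falls to
    -- `not-both`, one that misses either of them to `misses-c₄`, up to exchanging the two.
    separated : ∀ {c₁ c₂ c₃ c₄ e d x y} → Split c₁ c₂ c₃ c₄ e → Circ d → ev d x ≡ true → ev d y ≡ false →
      ev c₁ x ≡ true → ev c₂ x ≡ true → ev c₁ y ≡ true → ev c₂ y ≡ true → ∀ {A : Set} → A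
    separated {c₃ = c₃} {c₄} {d = d} s circ dx dy x₁ x₂ y₁ y₂
      with some? (λ z → ev c₃ z Bool.≟ true ×-dec (ev c₄ z Bool.≟ false ×-dec ev d z Bool.≟ true))
         | some? (λ z → ev c₄ z Bool.≟ true ×-dec (ev c₃ z Bool.≟ false ×-dec ev d z Bool.≟ true))
    ... | yes (u , u₃ , u₄ , du) | yes (w , w₄ , w₃ , dw) =
      let x₃ , x₄ = at-common x₁ x₂ ; y₃ , y₄ = at-common y₁ y₂
      in not-both s circ dx dy x₃ x₄ y₃ y₄ du u₃ u₄ dw w₄
      where open Split s
    ... | no ¬∃ | _ = misses-c₄ (swap₃₄ s) circ dx dy x₁ x₂ y₁ y₂
      (λ z z₃ → Bool.¬-not (λ dz → ¬∃ (z , z₃ , Split.disjoint₃₄ s z₃ , dz)))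
    ... | _ | no ¬∃ = misses-c₄ s circ dx dy x₁ x₂ y₁ y₂
      (λ z z₄ → Bool.¬-not (λ dz → ¬∃ (z , z₄ , Split.disjoint₄₃ s z₄ , dz)))

    module Separated (separate : ∀ {x y} → x ≢ y → ∃ λ a → ev a x ≢ ev a y) where

      -- A functional that separates two points contains a circuit that still separates them, and
      -- `separated` forbids this inside `c₁ ∩ c₂`.
      common-unique : ∀ {c₁ c₂ c₃ c₄ e x} → Split c₁ c₂ c₃ c₄ e →
        ev c₁ x ≡ true → ev c₂ x ≡ true → x ≡ e
      common-unique {e = e} {x} s x₁ x₂ with x ≟ᴾ e
      ... | yes x≡e = x≡e
      ... | no x≢e with separate x≢e
      ...   | a , ax≢ae with bit (ev a x) | bit (ev a e)
      ...     | inj₁ ax | inj₁ ae = contradiction (trans ax (sym ae)) ax≢ae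
      ...     | inj₂ ax | inj₂ ae = contradiction (trans ax (sym ae)) ax≢ae
      ...     | inj₁ ax | inj₂ ae with circ-through ax
      ...       | d , circ , d≼a , dx = separated s circ dx (Bool.¬-not (λ de → clash (d≼a e de) ae))
        x₁ x₂ (Split.e∈c₁ s) (Split.e∈c₂ s)
      common-unique {e = e} {x} s x₁ x₂ | no x≢e | a , ax≢ae | inj₂ ax | inj₁ ae with circ-through ae
      ...       | d , circ , d≼a , de = separated s circ de (Bool.¬-not (λ dx → clash (d≼a x dx) ax))
        (Split.e∈c₁ s) (Split.e∈c₂ s) x₁ x₂

      module Complement {c₁ c₂ c₃ c₄ e} (s : Split c₁ c₂ c₃ c₄ e) where
        open Split s

        -- A circuit d ∋ e disjoint from c₃ contains c₁ ∩ c₄ or c₂ ∩ c₄: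
        -- otherwise d △ c₁ and c₁ △ c₃ would be circuits with difference d △ c₃.
        inside-c₄ : ∀ {d} → Circ d → ev d e ≡ true → (∀ z → ev c₃ z ≡ true → ev d z ≡ false) →
          (∀ z → ev c₁ z ≡ true → ev c₄ z ≡ true → ev d z ≡ true) ⊎
          (∀ z → ev c₂ z ≡ true → ev c₄ z ≡ true → ev d z ≡ true)
        inside-c₄ {d} circ de miss
          with some? (λ z → ev c₁ z Bool.≟ true ×-dec (ev c₄ z Bool.≟ true ×-dec ev d z Bool.≟ false))
             | some? (λ z → ev c₂ z Bool.≟ true ×-dec (ev c₄ z Bool.≟ true ×-dec ev d z Bool.≟ false))
        ... | no ¬∃ | _ = inj₁ λ z h₁ h₄ → decidable-stable (_ Bool.≟ _) λ ¬dz → ¬∃ (z , h₁ , h₄ , Bool.¬-not ¬dz)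
        ... | _ | no ¬∃ = inj₂ λ z h₂ h₄ → decidable-stable (_ Bool.≟ _) λ ¬dz → ¬∃ (z , h₂ , h₄ , Bool.¬-not ¬dz)
        ... | yes (z , z₁ , z₄ , dz) | yes (w , w₂ , w₄ , dw) =
          contradiction (subst Circ d+c₃ (closed circ₁′ (+circ₃ s) (differ′ (de ⊕ e∈c₁) (e∈c₁ ⊕ e∉c₃))
            (dz ⊕ z₁) (z₁ ⊕ disjoint₄₃ z₄) (dw ⊕ w₁) (w₁ ⊕ disjoint₄₃ w₄)))
            (disjoint-not-circ (proj₁ circ) (proj₁ circ₃) (λ x dx → Bool.¬-not (λ h₃ → clash dx (miss x h₃))))
          where
          w₁ : ev c₁ w ≡ false
          w₁ with pattern-at w
          ... | in-12 (_ , _ , _ , h) = clash w₄ h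
          ... | in-13 (_ , h , _) = clash w₂ h
          ... | in-14 (_ , h , _) = clash w₂ h
          ... | in-23 (h , _) = h
          ... | in-24 (h , _) = h

          circ₁′ : Circ (d △ c₁)
          circ₁′ = let _ , p₁ , _ , p₃ , _ = some-13 ; _ , q₁ , _ , q₃ , _ = some-23
                   in closed circ circ₁ (differ′ (miss _ p₃) p₁) de e∈c₁ (miss _ q₃) q₁

          d+c₃ : (d △ c₁) △ (c₁ △ c₃) ≡ d △ c₃
          d+c₃ = trans (cong (_△ (c₁ △ c₃)) (△-comm d c₁)) (△-cross c₁ d c₃)

        -- A circuit `d` through `e` that avoids `c₃` meets `c₄`, as it is not below `c₁`; then
        -- `d △ c₄` is another circuit through `e` that avoids `c₃`. By `inside-c₄` each contains
        -- `c₁ ∩ c₄` or `c₂ ∩ c₄`, and being complementary on `c₄` they contain different ones. So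
        -- `d` misses one of these two parts and lies below `c₁` or `c₂`, which contradicts
        -- minimality.
        meets-c₃ : ∀ {d} → Circ d → ev d e ≡ true → ∃ λ u → ev c₃ u ≡ true × ev d u ≡ true
        meets-c₃ {d} circ de with some? (λ u → ev c₃ u Bool.≟ true ×-dec ev d u Bool.≟ true)
        ... | yes found = found
        ... | no ¬∃ = conclude (inside-c₄ circ de miss)
                (inside-c₄ circ₄′ (de ⊕ e∉c₄) (λ z h₃ → miss z h₃ ⊕ disjoint₃₄ h₃))
          where
          miss : ∀ z → ev c₃ z ≡ true → ev d z ≡ false
          miss z h₃ = Bool.¬-not (λ dz → ¬∃ (z , h₃ , dz))

          equal₁ : d ≼ c₁ → ∀ {A : Set} → A
          equal₁ d≼c₁ = let p , p₁ , _ , p₃ , _ = some-13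
            in clash p₁ (trans (cong (λ a → ev a p) (sym (proj₂ circ₁ d (proj₁ circ) d≼c₁))) (miss p p₃))

          equal₂ : d ≼ c₂ → ∀ {A : Set} → A
          equal₂ d≼c₂ = let q , _ , q₂ , q₃ , _ = some-23
            in clash q₂ (trans (cong (λ a → ev a q) (sym (proj₂ circ₂ d (proj₁ circ) d≼c₂))) (miss q q₃))

          meets-c₄ : ∃ λ u → ev c₄ u ≡ true × ev d u ≡ true
          meets-c₄ with some? (λ u → ev c₄ u Bool.≟ true ×-dec ev d u Bool.≟ true)
          ... | yes found = found
          ... | no ¬∃ = equal₁ λ z dz → case z dz (pattern-at z)
            where
            case : ∀ z → ev d z ≡ true → Pattern c₁ c₂ c₃ c₄ z → ev c₁ z ≡ true
            case z dz (in-12 (h , _)) = h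
            case z dz (in-13 (h , _)) = h
            case z dz (in-14 (h , _)) = h
            case z dz (in-23 (_ , _ , h , _)) = clash dz (miss z h)
            case z dz (in-24 (_ , _ , _ , h)) = contradiction (z , h , dz) ¬∃

          circ₄′ : Circ (d △ c₄)
          circ₄′ = let _ , u₄ , du = meets-c₄ ; p , _ , _ , p₃ , p₄ = some-13
                   in closed circ circ₄ (differ de e∉c₄) du u₄ (miss p p₃) p₄

          ⊆₁ : ∀ d → Set
          ⊆₁ d = ∀ z → ev c₁ z ≡ true → ev c₄ z ≡ true → ev d z ≡ true

          ⊆₂ : ∀ d → Set
          ⊆₂ d = ∀ z → ev c₂ z ≡ true → ev c₄ z ≡ true → ev d z ≡ true

          conclude : ⊆₁ d ⊎ ⊆₂ d → ⊆₁ (d △ c₄) ⊎ ⊆₂ (d △ c₄) → ∀ {A : Set} → A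
          conclude (inj₁ f) (inj₁ g) = let z , z₁ , _ , _ , z₄ = some-14 in clash (g z z₁ z₄) (f z z₁ z₄ ⊕ z₄)
          conclude (inj₂ f) (inj₂ g) = let z , _ , z₂ , _ , z₄ = some-24 in clash (g z z₂ z₄) (f z z₂ z₄ ⊕ z₄)
          conclude (inj₁ f) (inj₂ g) = equal₁ λ z dz → case z dz (pattern-at z)
            where
            case : ∀ z → ev d z ≡ true → Pattern c₁ c₂ c₃ c₄ z → ev c₁ z ≡ true
            case z dz (in-12 (h , _)) = h
            case z dz (in-13 (h , _)) = h
            case z dz (in-14 (h , _)) = h
            case z dz (in-23 (_ , _ , h , _)) = clash dz (miss z h)
            case z dz (in-24 (_ , h₂ , _ , h₄)) = clash (g z h₂ h₄) (dz ⊕ h₄)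
          conclude (inj₂ f) (inj₁ g) = equal₂ λ z dz → case z dz (pattern-at z)
            where
            case : ∀ z → ev d z ≡ true → Pattern c₁ c₂ c₃ c₄ z → ev c₂ z ≡ true
            case z dz (in-12 (_ , h , _)) = h
            case z dz (in-13 (_ , _ , h , _)) = clash dz (miss z h)
            case z dz (in-14 (h₁ , _ , _ , h₄)) = clash (g z h₁ h₄) (dz ⊕ h₄)
            case z dz (in-23 (_ , h , _)) = h
            case z dz (in-24 (_ , h , _)) = h

      module Shift {c₁ c₂ c₃ c₄ e} (s : Split c₁ c₂ c₃ c₄ e) where
        open Split s

        φ : Subset k
        φ = c₃ △ c₄

        ev-φ-e : ev φ e ≡ false
        ev-φ-e = e∉c₃ ⊕ e∉c₄

        ev-φ : ∀ {x} → x ≢ e → ev φ x ≡ true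
        ev-φ {x} x≢e with pattern-at x
        ... | in-12 (h₁ , h₂ , _) = contradiction (common-unique s h₁ h₂) x≢e
        ... | in-13 (_ , _ , h₃ , h₄) = h₃ ⊕ h₄
        ... | in-14 (_ , _ , h₃ , h₄) = h₃ ⊕ h₄
        ... | in-23 (_ , _ , h₃ , h₄) = h₃ ⊕ h₄
        ... | in-24 (_ , _ , h₃ , h₄) = h₃ ⊕ h₄

        not-above : ∀ {d c} → Circ d → ev d e ≡ true → c ≢ ⊥ → ev c e ≡ false →
          ∃ λ w → ev c w ≡ true × ev d w ≡ false
        not-above {d} {c} circ de c≢⊥ ec
          with some? (λ w → ev c w Bool.≟ true ×-dec ev d w Bool.≟ false)
        ... | yes found = found
        ... | no ¬∃ = clash de (trans (cong (λ a → ev a e) (sym (proj₂ circ c c≢⊥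
          (λ z cz → decidable-stable (_ Bool.≟ _) λ ¬dz → ¬∃ (z , cz , Bool.¬-not ¬dz))))) ec)

        -- `φ` is added in two steps, first `c₃` and then `c₄`. The point that both circuits avoid
        -- is in `c₄` but not in `d` for the first step, and in `c₃ ∩ d` for the second.
        shift-∋ : ∀ {d} → Circ d → ev d e ≡ true → Circ (d △ φ)
        shift-∋ {d} circ de = subst Circ (△-assoc d c₃ c₄)
          (let u , u₃ , du = Complement.meets-c₃ s circ de
               v , v₄ , dv = Complement.meets-c₃ (swap₃₄ s) circ de
               w , w₄ , dw = not-above circ de (proj₁ circ₄) e∉c₄
           in closed (closed circ circ₃ (differ de e∉c₃) du u₃ dw (disjoint₄₃ w₄)) circ₄
                (differ (de ⊕ e∉c₃) e∉c₄) (dv ⊕ disjoint₄₃ v₄) v₄ (du ⊕ u₃) (disjoint₃₄ u₃))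

        △-swap : ∀ (a b c : Subset k) → (a △ b) △ c ≡ (a △ c) △ b
        △-swap a b c = trans (△-assoc a b c) (trans (cong (a △_) (△-comm b c)) (sym (△-assoc a c b)))

        -- Conjugation by `c₁`: the circuit `d △ c₁` passes through `e`, so `shift-∋` applies to it,
        -- and adding `c₁` once more cancels. The required intersections exist because a circuit
        -- avoiding `e` that missed `c₁` or `c₂` would lie below the other.
        shift-∌ : ∀ {d} → Circ d → ev d e ≡ false → Circ (d △ φ)
        shift-∌ {d} circ de = subst Circ back
          (let y , y₁ , dy = avoids
               u , u₁ , du = meets-c₁
               z , z₂ , dz = meets-c₂
           in closed (shift-∋ (closed circ circ₁ (differ′ de e∈c₁) du u₁ dy y₁) (de ⊕ e∈c₁)) circ₁ ne
                ((de ⊕ e∈c₁) ⊕ ev-φ-e) e∈c₁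
                ((dz ⊕ not-c₁ z₂ dz) ⊕ ev-φ (≢e dz)) (not-c₁ z₂ dz))
          where
          ≢e : ∀ {x} → ev d x ≡ true → x ≢ e
          ≢e dx refl = clash dx de

          back : ((d △ c₁) △ φ) △ c₁ ≡ d △ φ
          back = trans (cong (_△ c₁) (△-swap d c₁ φ)) (△-cancelʳ (d △ φ) c₁)

          d≢φ : d ≢ φ
          d≢φ refl = ¬circ circ

          ne : (d △ c₁) △ φ ≢ c₁
          ne eq = d≢φ (p△q≡⊥⇒p≡q d φ (trans (sym back) (trans (cong (_△ c₁) eq) (△-self c₁))))

          not-c₁ : ∀ {x} → ev c₂ x ≡ true → ev d x ≡ true → ev c₁ x ≡ false
          not-c₁ h₂ dx = Bool.¬-not (λ h₁ → ≢e dx (common-unique s h₁ h₂))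

          meets-c₁ : ∃ λ u → ev c₁ u ≡ true × ev d u ≡ true
          meets-c₁ with some? (λ u → ev c₁ u Bool.≟ true ×-dec ev d u Bool.≟ true)
          ... | yes found = found
          ... | no ¬∃ = clash e∈c₂ (trans (cong (λ a → ev a e) (sym (proj₂ circ₂ d (proj₁ circ)
            (λ z dz → case z dz (pattern-at z))))) de)
            where
            case : ∀ z → ev d z ≡ true → Pattern c₁ c₂ c₃ c₄ z → ev c₂ z ≡ true
            case z dz (in-12 (_ , h , _)) = h
            case z dz (in-13 (h , _)) = contradiction (z , h , dz) ¬∃
            case z dz (in-14 (h , _)) = contradiction (z , h , dz) ¬∃
            case z dz (in-23 (_ , h , _)) = h
            case z dz (in-24 (_ , h , _)) = h

          meets-c₂ : ∃ λ u → ev c₂ u ≡ true × ev d u ≡ true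
          meets-c₂ with some? (λ u → ev c₂ u Bool.≟ true ×-dec ev d u Bool.≟ true)
          ... | yes found = found
          ... | no ¬∃ = clash e∈c₁ (trans (cong (λ a → ev a e) (sym (proj₂ circ₁ d (proj₁ circ)
            (λ z dz → case z dz (pattern-at z))))) de)
            where
            case : ∀ z → ev d z ≡ true → Pattern c₁ c₂ c₃ c₄ z → ev c₁ z ≡ true
            case z dz (in-12 (h , _)) = h
            case z dz (in-13 (h , _)) = h
            case z dz (in-14 (h , _)) = h
            case z dz (in-23 (_ , h , _)) = contradiction (z , h , dz) ¬∃
            case z dz (in-24 (_ , h , _)) = contradiction (z , h , dz) ¬∃

          -- If d contained the complement of c₁, then d △ c₂ would be contained
          -- in c₁, and d would be c₁ △ c₂ = φ.
          avoids : ∃ λ y → ev c₁ y ≡ false × ev d y ≡ false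
          avoids with some? (λ y → ev c₁ y Bool.≟ false ×-dec ev d y Bool.≟ false)
          ... | yes found = found
          ... | no ¬∃ = contradiction d≡φ d≢φ
            where
            d∋ : ∀ z → ev c₁ z ≡ false → ev d z ≡ true
            d∋ z h₁ = decidable-stable (_ Bool.≟ _) λ ¬dz → ¬∃ (z , h₁ , Bool.¬-not ¬dz)

            case : ∀ z → ev (d △ c₂) z ≡ true → Pattern c₁ c₂ c₃ c₄ z → ev c₁ z ≡ true
            case z dz (in-12 (h , _)) = h
            case z dz (in-13 (h , _)) = h
            case z dz (in-14 (h , _)) = h
            case z dz (in-23 (h₁ , h₂ , _)) = clash dz (d∋ z h₁ ⊕ h₂)
            case z dz (in-24 (h₁ , h₂ , _)) = clash dz (d∋ z h₁ ⊕ h₂)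

            d+c₂ : d △ c₂ ≡ c₁
            d+c₂ = proj₂ circ₁ (d △ c₂) (nonzero (de ⊕ e∈c₂)) (λ z dz → case z dz (pattern-at z))

            d≡φ : d ≡ φ
            d≡φ = trans (sym (△-cancelʳ d c₂)) (trans (cong (_△ c₂) d+c₂) sum)

        shift : ∀ {d} → Circ d → Circ (d △ φ)
        shift {d} circ with bit (ev d e)
        ... | inj₁ de = shift-∋ circ de
        ... | inj₂ de = shift-∌ circ de

        -- Off `e`, adding `φ` complements supports and so reverses `≼`; at `e` the two functionals
        -- agree. Hence `a △ φ` lies below the circuit `d △ φ`, and the two are equal.
        circ-of-below : ∀ {a d} → a ≢ φ → Circ d → d ≼ a → ev d e ≡ ev a e → Circ a
        circ-of-below {a} {d} a≢φ circ d≼a de≡ae = subst Circ d≡a circ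
          where
          at : ∀ z → ev (a △ φ) z ≡ true → ev (d △ φ) z ≡ true
          at z h with z ≟ᴾ e
          ... | yes refl = trans (ev-△ d φ z) (trans (cong (_xor ev φ z) de≡ae) (trans (sym (ev-△ a φ z)) h))
          ... | no z≢e with bit (ev d z)
          ...   | inj₁ dz = clash h (d≼a z dz ⊕ ev-φ z≢e)
          ...   | inj₂ dz = dz ⊕ ev-φ z≢e

          d≡a : d ≡ a
          d≡a = trans (sym (△-cancelʳ d φ)) (trans (cong (_△ φ)
            (sym (proj₂ (shift circ) (a △ φ) (△-≢⊥ a≢φ) at))) (△-cancelʳ a φ))

        all-circ : ∀ {a} → a ≢ ⊥ → a ≢ φ → Circ a
        all-circ {a} a≢⊥ a≢φ with bit (ev a e)
        ... | inj₁ ae with circ-through ae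
        ...   | d , circ , d≼a , de = circ-of-below a≢φ circ d≼a (trans de (sym ae))
        all-circ {a} a≢⊥ a≢φ | inj₂ ae with circ-below a≢⊥
        ...   | d , circ , d≼a = circ-of-below a≢φ circ d≼a
          (trans (Bool.¬-not (λ de → clash (d≼a e de) ae)) (sym ae))

  -- In terms of the points: every flat of codimension two of the affine part
  -- φ = 1 contains a point.
  Hits : Subset k → Pt → Set
  Hits φ e = ∀ {α β} → α ≢ ⊥ → α ≢ φ → β ≢ ⊥ → β ≢ φ → β ≢ α → β ≢ α △ φ →
    ∃ λ z → z ≢ e × ev α z ≡ false × ev β z ≡ false

  module AlmostAffine {φ e} (ev-φ-e : ev φ e ≡ false) (ev-φ : ∀ {x} → x ≢ e → ev φ x ≡ true) where

    -- If the flat had no point other than `e`, then off `e` the support of `α △ φ` would lie in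
    -- that of `β`, and that of `β △ φ` in that of `α`. For any values at `e`, one of these
    -- inclusions extends to `e`, and minimality of the larger circuit forces the forbidden
    -- equality.
    hits : (∀ {a} → a ≢ ⊥ → a ≢ φ → Circ a) → Hits φ e
    hits all-circ {α} {β} α≢⊥ α≢φ β≢⊥ β≢φ β≢α β≢α+φ
      with some? (λ z → ¬? (z ≟ᴾ e) ×-dec (ev α z Bool.≟ false ×-dec ev β z Bool.≟ false))
    ... | yes found = found
    ... | no ¬∃ = contradiction (conclude (bit (ev α e)) (bit (ev β e))) β≢α+φ
      where
      below : ∀ {α β} → ev α e ≡ false ⊎ ev β e ≡ true →
        (∀ {z} → z ≢ e → ev α z ≡ false → ev β z ≡ false → ¬ Pt) → α △ φ ≼ β
      below h ¬∃ z αφz with z ≟ᴾ e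
      below (inj₁ αe) ¬∃ z αφz | yes refl = clash αφz (αe ⊕ ev-φ-e)
      below (inj₂ βe) ¬∃ z αφz | yes refl = βe
      below {α} {β} h ¬∃ z αφz | no z≢e with bit (ev α z) | bit (ev β z)
      ... | _       | inj₁ βz = βz
      ... | inj₁ αz | inj₂ βz = clash αφz (αz ⊕ ev-φ z≢e)
      ... | inj₂ αz | inj₂ βz = contradiction z (¬∃ z≢e αz βz)

      via-β : ev α e ≡ false ⊎ ev β e ≡ true → β ≡ α △ φ
      via-β h = sym (proj₂ (all-circ β≢⊥ β≢φ) (α △ φ) (△-≢⊥ α≢φ)
        (below h (λ z≢e αz βz _ → ¬∃ (_ , z≢e , αz , βz))))

      conclude : ev α e ≡ true ⊎ ev α e ≡ false → ev β e ≡ true ⊎ ev β e ≡ false → β ≡ α △ φ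
      conclude (inj₂ αe) _ = via-β (inj₁ αe)
      conclude _ (inj₁ βe) = via-β (inj₂ βe)
      conclude (inj₁ αe) (inj₂ βe) = trans (sym (△-cancelʳ β φ)) (cong (_△ φ)
        (proj₂ (all-circ α≢⊥ α≢φ) (β △ φ) (△-≢⊥ β≢φ)
          (below (inj₁ βe) (λ z≢e βz αz _ → ¬∃ (_ , z≢e , αz , βz)))))

    -- If `b ≼ a`, a point where `a` and `b △ φ` vanish has `b = 1` and `a = 0`, which is absurd.
    -- For `b` equal to `φ` or `a △ φ` these two functionals define no flat of codimension two;
    -- there any affine point with `a = 0` does, and `third` supplies the second equation that
    -- yields one.
    all-circ : (∀ a → ∃ λ β → β ≢ ⊥ × β ≢ φ × β ≢ a × β ≢ a △ φ) → Hits φ e →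
      ∀ {a} → a ≢ ⊥ → a ≢ φ → Circ a
    all-circ third hits {a} a≢⊥ a≢φ = a≢⊥ , min
      where
      outside-a : ∃ λ z → z ≢ e × ev a z ≡ false
      outside-a with third a
      ... | β , β≢⊥ , β≢φ , β≢a , β≢a+φ with hits a≢⊥ a≢φ β≢⊥ β≢φ β≢a β≢a+φ
      ...   | z , z≢e , az , _ = z , z≢e , az

      min : ∀ b → b ≢ ⊥ → b ≼ a → b ≡ a
      min b b≢⊥ b≼a with b ≟ˢ a
      ... | yes b≡a = b≡a
      ... | no b≢a with b ≟ˢ φ | b ≟ˢ (a △ φ)
      ...   | yes refl | _ = let z , z≢e , az = outside-a in clash (b≼a z (ev-φ z≢e)) az
      ...   | no _ | yes refl = let z , z≢e , az = outside-a in clash (b≼a z (az ⊕ ev-φ z≢e)) az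
      ...   | no b≢φ | no b≢a+φ
              with hits a≢⊥ a≢φ (△-≢⊥ b≢φ) (λ eq → b≢⊥ (trans (sym (△-cancelʳ b φ)) (trans (cong (_△ φ) eq) (△-self φ))))
                (λ eq → b≢a+φ (trans (sym (△-cancelʳ b φ)) (cong (_△ φ) eq)))
                (λ eq → b≢a (trans (sym (△-cancelʳ b φ)) (trans (cong (_△ φ) eq) (△-cancelʳ a φ))))
      ...     | z , z≢e , az , bφz with bit (ev b z)
      ...       | inj₁ bz = clash (b≼a z bz) az
      ...       | inj₂ bz = clash (bz ⊕ ev-φ z≢e) bφz

-- Linear algebra over GF(2)

dot : Subset k → Subset k → Bool
dot []      []      = false
dot (a ∷ p) (b ∷ q) = (a ∧ b) xor dot p q

dot-comm : (p q : Subset k) → dot p q ≡ dot q p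
dot-comm []      []      = refl
dot-comm (a ∷ p) (b ∷ q) = cong₂ _xor_ (Bool.∧-comm a b) (dot-comm p q)

dot-△ˡ : (p q r : Subset k) → dot (p △ q) r ≡ dot p r xor dot q r
dot-△ˡ []      []      []      = refl
dot-△ˡ (a ∷ p) (b ∷ q) (c ∷ r) = trans
  (cong₂ _xor_ (Bool.∧-distribʳ-xor c a b) (dot-△ˡ p q r))
  (interchange (a ∧ c) (b ∧ c) (dot p r) (dot q r))

dot-△ʳ : (p q r : Subset k) → dot p (q △ r) ≡ dot p q xor dot p r
dot-△ʳ p q r = trans (dot-comm p (q △ r))
  (trans (dot-△ˡ q r p) (cong₂ _xor_ (dot-comm q p) (dot-comm r p)))

dot-⊥ˡ : (p : Subset k) → dot ⊥ p ≡ false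
dot-⊥ˡ []      = refl
dot-⊥ˡ (_ ∷ p) = dot-⊥ˡ p

dot-⊥ʳ : (p : Subset k) → dot p ⊥ ≡ false
dot-⊥ʳ p = trans (dot-comm p ⊥) (dot-⊥ˡ p)

dot-⁅⁆ˡ : (j : Fin k) (p : Subset k) → dot ⁅ j ⁆ p ≡ lookup p j
dot-⁅⁆ˡ zero    (b ∷ p) = trans (cong (b xor_) (dot-⊥ˡ p)) (Bool.xor-identityʳ b)
dot-⁅⁆ˡ (suc j) (b ∷ p) = dot-⁅⁆ˡ j p

dot-⁅⁆ʳ : (p : Subset k) (j : Fin k) → dot p ⁅ j ⁆ ≡ lookup p j
dot-⁅⁆ʳ p j = trans (dot-comm p ⁅ j ⁆) (dot-⁅⁆ˡ j p)

scale : Bool → Subset k → Subset k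
scale b p = if b then p else ⊥

dot-scaleˡ : (b : Bool) (p q : Subset k) → dot (scale b p) q ≡ b ∧ dot p q
dot-scaleˡ true  p q = refl
dot-scaleˡ false p q = dot-⊥ˡ q

dot-split : (a y : Subset (suc k)) (j : Fin (suc k)) →
  dot a y ≡ (lookup a j ∧ lookup y j) xor dot (removeAt a j) (removeAt y j)
dot-split (_ ∷ _) (_ ∷ _) zero = refl
dot-split (b ∷ a@(_ ∷ _)) (c ∷ y@(_ ∷ _)) (suc j) = trans
  (cong ((b ∧ c) xor_) (dot-split a y j))
  (trans (sym (Bool.xor-assoc (b ∧ c) u w)) (trans (cong (_xor w) (Bool.xor-comm (b ∧ c) u)) (Bool.xor-assoc u (b ∧ c) w)))
  where
  u = lookup a j ∧ lookup y j
  w = dot (removeAt a j) (removeAt y j)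

comb : (Fin n → Subset k) → Subset n → Subset k
comb V []      = ⊥
comb V (b ∷ D) = scale b (V zero) △ comb (V ∘ suc) D

lookup-comb : {v : Fin n → Fin k → Bool} {V : Fin n → Subset k} → (∀ x j → lookup (V x) j ≡ v x j) →
  ∀ D j → lookup (comb V D) j ≡ lincomb v D j
lookup-comb {v = v} {V} eq []            j = lookup-⊥ j
lookup-comb {v = v} {V} eq (inside  ∷ D) j = trans (lookup-△ (V zero) _ j)
  (cong₂ _xor_ (eq zero j) (lookup-comb (eq ∘ suc) D j))
lookup-comb {v = v} {V} eq (outside ∷ D) j = trans (lookup-△ ⊥ _ j)
  (cong₂ _xor_ (lookup-⊥ j) (lookup-comb (eq ∘ suc) D j))

lookup-comb′ : (V : Fin n → Subset k) → ∀ D j → lookup (comb V D) j ≡ lincomb (lookup ∘ V) D j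
lookup-comb′ V = lookup-comb {v = lookup ∘ V} (λ _ _ → refl)

comb-△ : (V : Fin n → Subset k) (C D : Subset n) → comb V (C △ D) ≡ comb V C △ comb V D
comb-△ V C D = lookup-ext λ j → trans (lookup-comb′ V (C △ D) j)
  (trans (lincomb-△ (lookup ∘ V) C D j) (sym (trans (lookup-△ (comb V C) (comb V D) j)
    (cong₂ _xor_ (lookup-comb′ V C j) (lookup-comb′ V D j)))))

comb-⊥ : (V : Fin n → Subset k) → comb V ⊥ ≡ ⊥
comb-⊥ V = lookup-ext λ j → trans (lookup-comb′ V ⊥ j) (trans (lincomb-⊥ (lookup ∘ V) j) (sym (lookup-⊥ j)))

comb-⁅⁆ : (V : Fin n → Subset k) (x : Fin n) → comb V ⁅ x ⁆ ≡ V x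
comb-⁅⁆ V x = lookup-ext λ j → trans (lookup-comb′ V ⁅ x ⁆ j) (lincomb-⁅⁆ (lookup ∘ V) x j)

dot-comb-zero : (V : Fin n → Subset k) (a : Subset k) (D : Subset n) →
  (∀ {x} → x ∈ D → dot a (V x) ≡ false) → dot a (comb V D) ≡ false
dot-comb-zero V a []            zeros = dot-⊥ʳ a
dot-comb-zero V a (outside ∷ D) zeros = trans (cong (dot a) (△-identityˡ (comb (V ∘ suc) D)))
  (dot-comb-zero (V ∘ suc) a D (zeros ∘ there))
dot-comb-zero V a (inside  ∷ D) zeros = trans (dot-△ʳ a (V zero) (comb (V ∘ suc) D))
  (cong₂ _xor_ (zeros here) (dot-comb-zero (V ∘ suc) a D (zeros ∘ there)))

Free : (Fin n → Subset k) → Subset n → Set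
Free V I = ∀ D → D ⊆ I → comb V D ≡ ⊥ → D ≡ ⊥

LI⇔Free : {v : Fin n → Fin k → Bool} {V : Fin n → Subset k} → (∀ x j → lookup (V x) j ≡ v x j) →
  ∀ {I} → LinearlyIndependent v I ⇔ Free V I
LI⇔Free eq = mk⇔
  (λ li D D⊆I null → li D D⊆I (λ j → trans (sym (lookup-comb eq D j)) (trans (cong (λ p → lookup p j) null) (lookup-⊥ j))))
  (λ free D D⊆I null → free D D⊆I (lookup-ext λ j → trans (lookup-comb eq D j) (trans (null j) (sym (lookup-⊥ j)))))

Spanned : (Fin n → Subset k) → Subset n → Subset k → Set
Spanned V D u = ∃ λ C → C ⊆ D × comb V C ≡ u

Separator : (Fin n → Subset k) → Subset n → Subset k → Set
Separator V D u = ∃ λ a → (∀ {x} → x ∈ D → dot a (V x) ≡ false) × dot a u ≡ true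

-- Induction on `D`. If neither `u` nor `u △ V zero` is spanned by the rest, both have separating
-- functionals, and one of these or their sum vanishes at `V zero` while being 1 at `u`.
fredholm : (V : Fin n → Subset k) (D : Subset n) (u : Subset k) → Spanned V D u ⊎ Separator V D u
fredholm V [] u with any? (λ j → lookup u j Bool.≟ true)
... | yes (j , uj) = inj₂ (⁅ j ⁆ , (λ ()) , trans (dot-⁅⁆ˡ j u) uj)
... | no ¬∃ = inj₁ ([] , (λ x∈ → x∈) , lookup-ext (λ j → trans (lookup-⊥ j) (sym (Bool.¬-not (λ uj → ¬∃ (j , uj))))))
fredholm V (outside ∷ D) u with fredholm (V ∘ suc) D u
... | inj₁ (C , C⊆D , eq) = inj₁ (outside ∷ C , s⊆s C⊆D , trans (△-identityˡ _) eq)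
... | inj₂ (a , zeros , au) = inj₂ (a , (λ { (there x∈) → zeros x∈ }) , au)
fredholm V (inside ∷ D) u with fredholm (V ∘ suc) D u | fredholm (V ∘ suc) D (u △ V zero)
... | inj₁ (C , C⊆D , eq) | _ = inj₁ (outside ∷ C , out⊆ C⊆D , trans (△-identityˡ _) eq)
... | inj₂ _ | inj₁ (C , C⊆D , eq) = inj₁ (inside ∷ C , in⊆in C⊆D ,
        trans (cong (V zero △_) (trans eq (△-comm u (V zero)))) (△-cancelˡ (V zero) u))
... | inj₂ (a , az , au) | inj₂ (b , bz , bu) with dot a (V zero) in a₀ | dot b (V zero) in b₀
...   | false | _ = inj₂ (a , (λ { here → a₀ ; (there x∈) → az x∈ }) , au)
...   | true | false = inj₂ (b , (λ { here → b₀ ; (there x∈) → bz x∈ }) ,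
          trans (sym (Bool.xor-identityʳ _)) (trans (cong (dot b u xor_) (sym b₀)) (trans (sym (dot-△ʳ b u (V zero))) bu)))
...   | true | true = inj₂ (a △ b ,
          (λ { here → trans (dot-△ˡ a b _) (cong₂ _xor_ a₀ b₀)
             ; (there x∈) → trans (dot-△ˡ a b _) (cong₂ _xor_ (az x∈) (bz x∈)) }) ,
          trans (dot-△ˡ a b u) (cong₂ _xor_ au bu′))
  where
  bu′ : dot b u ≡ false
  bu′ with dot b u | trans (sym (dot-△ʳ b u (V zero))) bu
  ... | false | _ = refl
  ... | true | h with () ← trans (sym (cong not b₀)) h

Spanned? : (V : Fin n → Subset k) (D : Subset n) (u : Subset k) → Dec (Spanned V D u)
Spanned? V D u with fredholm V D u
... | inj₁ spanned = yes spanned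
... | inj₂ (a , zeros , au) = no λ { (C , C⊆D , refl) →
        contradiction (trans (sym au) (dot-comb-zero V a C (λ x∈ → zeros (C⊆D x∈)))) λ () }

Separated : (Fin n → Subset k) → Subset n → Set
Separated V I = ∀ {x} → x ∈ I → ∃ λ a → dot a (V x) ≡ true × (∀ {y} → y ∈ I → y ≢ x → dot a (V y) ≡ false)

dot-comb-one : (V : Fin n → Subset k) (a : Subset k) (D : Subset n) {x : Fin n} → x ∈ D →
  dot a (V x) ≡ true → (∀ {y} → y ∈ D → y ≢ x → dot a (V y) ≡ false) → dot a (comb V D) ≡ true
dot-comb-one V a D {x} x∈D ax zeros = trans (cong (dot a) split)
  (trans (dot-△ʳ a (comb V (D △ ⁅ x ⁆)) (V x)) (cong₂ _xor_
    (dot-comb-zero V a (D △ ⁅ x ⁆) (λ {y} y∈ → zeros′ (∈△⁻ D ⁅ x ⁆ y∈))) ax))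
  where
  split : comb V D ≡ comb V (D △ ⁅ x ⁆) △ V x
  split = trans (cong (comb V) (sym (△-cancelʳ D ⁅ x ⁆)))
    (trans (comb-△ V (D △ ⁅ x ⁆) ⁅ x ⁆) (cong (comb V (D △ ⁅ x ⁆) △_) (comb-⁅⁆ V x)))

  zeros′ : ∀ {y} → (y ∈ D × y ∉ ⁅ x ⁆) ⊎ (y ∉ D × y ∈ ⁅ x ⁆) → dot a (V y) ≡ false
  zeros′ (inj₁ (y∈D , y∉x)) = zeros y∈D (x∉⁅y⁆⇒x≢y y∉x)
  zeros′ (inj₂ (y∉D , y∈x)) = contradiction (subst (_∈ D) (sym (x∈⁅y⁆⇒x≡y x y∈x)) x∈D) y∉D

-- In a free set `V x` is not spanned by the other vectors, and `fredholm` gives its coordinate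
-- functional. Conversely that functional takes the value 1 on every combination using `x`, so none
-- is zero. In this form independence passes along a linear map by pulling functionals back.
Free⇔Separated : (V : Fin n → Subset k) {I : Subset n} → Free V I ⇔ Separated V I
Free⇔Separated V {I} = mk⇔ to from
  where
  to : Free V I → Separated V I
  to free {x} x∈I with fredholm V (I - x) (V x)
  ... | inj₂ (a , zeros , ax) = a , ax , λ y∈I y≢x → zeros (x∈p∧x≢y⇒x∈p-y y∈I y≢x)
  ... | inj₁ (C , C⊆ , eq) = contradiction (subst (x ∈_)
          (free (C △ ⁅ x ⁆) (△-⊆ (⊆-trans C⊆ (p─q⊆p I ⁅ x ⁆)) (⁅⁆-⊆ x∈I))
            (trans (comb-△ V C ⁅ x ⁆) (trans (cong₂ _△_ eq (comb-⁅⁆ V x)) (△-self (V x)))))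
          (∈△⁺ʳ C ⁅ x ⁆ (λ x∈C → x∉p-x I (C⊆ x∈C)) (x∈⁅x⁆ x))) ∉⊥

  from : Separated V I → Free V I
  from sep D D⊆I null with nonempty? D
  ... | no empty = Empty-unique empty
  ... | yes (x , x∈D) with sep (D⊆I x∈D)
  ...   | a , ax , zeros = contradiction
          (trans (sym (dot-comb-one V a D x∈D ax (λ y∈D → zeros (D⊆I y∈D)))) (trans (cong (dot a) null) (dot-⊥ʳ a))) λ ()

Free-∪⁅⁆ : {V : Fin n → Subset k} {I : Subset n} {x : Fin n} → Free V I → ¬ Spanned V I (V x) →
  Free V (I ∪ ⁅ x ⁆)
Free-∪⁅⁆ {V = V} {I} {x} free ¬span D D⊆ null with x ∈? D
... | no x∉D = free D (λ {y} y∈D → ∈∪⁅⁆⁻ I (D⊆ y∈D) (λ { refl → x∉D y∈D })) null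
... | yes x∈D = ⊥-elim (¬span (D △ ⁅ x ⁆ , D△x⊆I , eq))
  where
  D△x⊆I : D △ ⁅ x ⁆ ⊆ I
  D△x⊆I {y} y∈ = ∈∪⁅⁆⁻ I (△-⊆ D⊆ (q⊆p∪q I ⁅ x ⁆) y∈) (λ { refl → x∈p⇒x∉p△⁅x⁆ D x∈D y∈ })

  eq : comb V (D △ ⁅ x ⁆) ≡ V x
  eq = trans (comb-△ V D ⁅ x ⁆) (trans (cong₂ _△_ null (comb-⁅⁆ V x)) (△-identityˡ (V x)))

-- Numbering of vectors and dimension by counting

private
  module Bit = Inverse 2↔Bool

vec : (k : ℕ) → Fin (2 ^ k) → Subset k
vec k x = tabulate (vector k x)

index : Subset k → Fin (2 ^ k)
index u = funToFin (λ j → Bit.from (lookup u j))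

vec-index : (u : Subset k) → vec k (index u) ≡ u
vec-index u = trans (Vec.tabulate-cong λ j →
  trans (cong Bit.to (Fin.finToFun-funToFin (λ j → Bit.from (lookup u j)) j)) (Bit.strictlyInverseˡ (lookup u j)))
  (Vec.tabulate∘lookup u)

funToFin-cong : {f g : Fin m → Fin n} → (∀ i → f i ≡ g i) → funToFin f ≡ funToFin g
funToFin-cong {zero}  eq = refl
funToFin-cong {suc m} eq = cong₂ combine (eq zero) (funToFin-cong (eq ∘ suc))

index-vec : (k : ℕ) (x : Fin (2 ^ k)) → index (vec k x) ≡ x
index-vec k x = trans (funToFin-cong λ j →
  trans (cong Bit.from (Vec.lookup∘tabulate (vector k x) j)) (Bit.strictlyInverseʳ (finToFun x j)))
  (Fin.funToFin-finToFin {k} x)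

vec-injective : (k : ℕ) {x y : Fin (2 ^ k)} → vec k x ≡ vec k y → x ≡ y
vec-injective k {x} {y} eq = trans (sym (index-vec k x)) (trans (cong index eq) (index-vec k y))

index-injective : {p q : Subset k} → index p ≡ index q → p ≡ q
index-injective {p = p} {q} eq = trans (sym (vec-index p)) (trans (cong (vec _) eq) (vec-index q))

2^-cancel-≤ : 2 ^ m ≤ 2 ^ n → m ≤ n
2^-cancel-≤ {m} {n} le with m ℕ.≤? n
... | yes m≤n = m≤n
... | no m≰n = contradiction le (ℕ.<⇒≱ (ℕ.^-monoʳ-< 2 (s≤s (s≤s z≤n)) (ℕ.≰⇒> m≰n)))

-- The `2 ^ ∣ I ∣` subsets of a free set have different sums among `2 ^ k` vectors. Counting stands
-- in for dimension theory here and in `spanning-∣∣≥`.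
Free-∣∣≤ : {V : Fin n → Subset k} {I : Subset n} → Free V I → ∣ I ∣ ≤ k
Free-∣∣≤ {k = k} {V} {I} free = 2^-cancel-≤ (Fin.injective⇒≤ {f = λ i → index (comb V (decode I i))} inj)
  where
  inj : ∀ {i j} → index (comb V (decode I i)) ≡ index (comb V (decode I j)) → i ≡ j
  inj {i} {j} eq = trans (sym (encode-decode I i)) (trans (cong (encode I)
    (p△q≡⊥⇒p≡q _ _ (free (decode I i △ decode I j) (△-⊆ (decode-⊆ I i) (decode-⊆ I j))
      (trans (comb-△ V (decode I i) (decode I j)) (trans (cong (_△ comb V (decode I j)) (index-injective {p = comb V (decode I i)} eq)) (△-self (comb V (decode I j))))))))
    (encode-decode I j))

spanning-∣∣≥ : {V : Fin n → Subset k} {I : Subset n} → (∀ u → Spanned V I u) → k ≤ ∣ I ∣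
spanning-∣∣≥ {k = k} {V} {I} span = 2^-cancel-≤ (Fin.injective⇒≤ {f = λ x → encode I (proj₁ (span (vec k x)))} inj)
  where
  inj : ∀ {x y} → encode I (proj₁ (span (vec k x))) ≡ encode I (proj₁ (span (vec k y))) → x ≡ y
  inj {x} {y} eq = vec-injective k (trans (sym (proj₂ (proj₂ (span (vec k x)))))
    (trans (cong (comb V) (encode-injective I (proj₁ (proj₂ (span (vec k x)))) (proj₁ (proj₂ (span (vec k y)))) eq))
      (proj₂ (proj₂ (span (vec k y))))))

not-spanned : (V : Fin n → Subset k) (I : Subset n) → ∣ I ∣ < k → ∃ λ u → ¬ Spanned V I u
not-spanned V I I<k with anySubset? (λ u → ¬? (Spanned? V I u))
... | yes found = found
... | no ¬∃ = contradiction
  (spanning-∣∣≥ (λ u → decidable-stable (Spanned? V I u) (λ ¬span → ¬∃ (u , ¬span)))) (ℕ.<⇒≱ I<k)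

-- Linear embeddings of GF(2)^k in GF(2)^l, with the transposed map and a
-- section of it.
record Embedding (k l : ℕ) : Set where
  field
    to       : Subset k → Subset l
    adjoint  : Subset l → Subset k
    lift     : Subset k → Subset l
    dot-to   : ∀ b x → dot b (to x) ≡ dot (adjoint b) x
    dot-lift : ∀ a x → dot (lift a) (to x) ≡ dot a x

  injective : ∀ {x y} → to x ≡ to y → x ≡ y
  injective {x} {y} eq = lookup-ext λ j → trans (sym (dot-⁅⁆ˡ j x))
    (trans (sym (dot-lift ⁅ j ⁆ x)) (trans (cong (dot (lift ⁅ j ⁆)) eq) (trans (dot-lift ⁅ j ⁆ y) (dot-⁅⁆ˡ j y))))

  to-⊥ : to ⊥ ≡ ⊥
  to-⊥ = lookup-ext λ j → trans (sym (dot-⁅⁆ˡ j (to ⊥)))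
    (trans (dot-to ⁅ j ⁆ ⊥) (trans (dot-⊥ʳ (adjoint ⁅ j ⁆)) (sym (lookup-⊥ j))))

  separated⁺ : (V : Fin n → Subset k) {I : Subset n} → Separated V I → Separated (to ∘ V) I
  separated⁺ V sep x∈ =
    let a , ax , zeros = sep x∈
    in lift a , trans (dot-lift a _) ax , λ y∈ y≢x → trans (dot-lift a _) (zeros y∈ y≢x)

  separated⁻ : (V : Fin n → Subset k) {I : Subset n} → Separated (to ∘ V) I → Separated V I
  separated⁻ V sep x∈ =
    let b , bx , zeros = sep x∈
    in adjoint b , trans (sym (dot-to b _)) bx , λ y∈ y≢x → trans (sym (dot-to b _)) (zeros y∈ y≢x)

_∘ᴱ_ : ∀ {k l m} → Embedding l m → Embedding k l → Embedding k m
g ∘ᴱ f = record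
  { to = G.to ∘ F.to ; adjoint = F.adjoint ∘ G.adjoint ; lift = G.lift ∘ F.lift
  ; dot-to = λ b x → trans (G.dot-to b (F.to x)) (F.dot-to (G.adjoint b) x)
  ; dot-lift = λ a x → trans (G.dot-lift (F.lift a) (F.to x)) (F.dot-lift a x) }
  where
  module F = Embedding f
  module G = Embedding g

dot-insertAt : (a : Subset (suc k)) (x : Subset k) (j : Fin (suc k)) (b : Bool) →
  dot a (insertAt x j b) ≡ (lookup a j ∧ b) xor dot (removeAt a j) x
dot-insertAt a x j b = trans (dot-split a (insertAt x j b) j)
  (cong₂ _xor_ (cong (lookup a j ∧_) (Vec.insertAt-lookup x j b)) (cong (dot (removeAt a j)) (Vec.removeAt-insertAt x j b)))

-- The hyperplane `α = 0` is parametrised by the coordinates other than `j`; coordinate `j` is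
-- solved from the equation, which is correct once `lookup α j` is `true`.
kernel : (α : Subset (suc k)) (j : Fin (suc k)) → Embedding k (suc k)
kernel α j = record
  { to = λ x → insertAt x j (dot (removeAt α j) x)
  ; adjoint = λ b → scale (lookup b j) (removeAt α j) △ removeAt b j
  ; lift = λ a → insertAt a j false
  ; dot-to = λ b x → trans (dot-insertAt b x j _) (sym (trans (dot-△ˡ (scale (lookup b j) (removeAt α j)) (removeAt b j) x)
      (cong (_xor dot (removeAt b j) x) (dot-scaleˡ (lookup b j) (removeAt α j) x))))
  ; dot-lift = λ a x → trans (dot-insertAt (insertAt a j false) x j _)
      (cong₂ (λ c p → (c ∧ dot (removeAt α j) x) xor dot p x) (Vec.insertAt-lookup a j false) (Vec.removeAt-insertAt a j false)) }

module _ (α : Subset (suc k)) {j : Fin (suc k)} (αj : lookup α j ≡ true) where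

  kernel-dot : ∀ x → dot α (Embedding.to (kernel α j) x) ≡ false
  kernel-dot x = trans (dot-insertAt α x j _)
    (trans (cong (λ c → (c ∧ dot (removeAt α j) x) xor dot (removeAt α j) x) αj) (Bool.xor-same (dot (removeAt α j) x)))

  kernel-onto : ∀ {y} → dot α y ≡ false → Embedding.to (kernel α j) (removeAt y j) ≡ y
  kernel-onto {y} αy = trans (cong (insertAt (removeAt y j) j) (sym yj)) (Vec.insertAt-removeAt y j)
    where
    yj : lookup y j ≡ dot (removeAt α j) (removeAt y j)
    yj with lookup y j | dot (removeAt α j) (removeAt y j) | trans (sym (dot-split α y j)) αy
    ... | b | c | h with trans (cong (λ d → (d ∧ b) xor c) (sym αj)) h
    ...   | h′ with b | c
    ...     | true  | true  = refl
    ...     | false | false = refl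

  -- `adjoint` restricts functionals to the hyperplane, and those that vanish there are the
  -- multiples of its equation.
  kernel-adjoint-⊥ : ∀ {b} → Embedding.adjoint (kernel α j) b ≡ ⊥ → b ≡ ⊥ ⊎ b ≡ α
  kernel-adjoint-⊥ {b} eq with lookup b j in bj
  ... | true  = inj₂ (trans (sym (Vec.insertAt-removeAt b j)) (trans (cong₂ (λ p c → insertAt p j c)
          (sym (p△q≡⊥⇒p≡q _ _ eq)) (trans bj (sym αj))) (Vec.insertAt-removeAt α j)))
  ... | false = inj₁ b≡
    where
    b≡ : b ≡ ⊥
    b≡ = trans (sym (Vec.insertAt-removeAt b j))
      (trans (cong₂ (λ p c → insertAt p j c) (trans (sym (△-identityˡ (removeAt b j))) eq) bj) (insertAt-⊥ j))
      where
      insertAt-⊥ : ∀ {k} (j : Fin (suc k)) → insertAt (⊥ {k}) j false ≡ ⊥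
      insertAt-⊥ zero = refl
      insertAt-⊥ {suc k} (suc j) = cong (false ∷_) (insertAt-⊥ j)

-- A change of coordinates that makes `φ` the first coordinate. Coordinate `j` may be dropped in
-- exchange, as `φ` has coefficient 1 there.
front : (φ : Subset (suc k)) (j : Fin (suc k)) → lookup φ j ≡ true → Embedding (suc k) (suc k)
front φ j φj = record
  { to = λ x → dot φ x ∷ removeAt x j
  ; adjoint = λ { (c ∷ b) → scale c φ △ insertAt b j false }
  -- Express coordinate `j` of `x` through `dot φ x` and the remaining coordinates, substitute in
  -- `dot a x` and collect coefficients.
  ; lift = λ a → lookup a j ∷ (removeAt a j △ scale (lookup a j) (removeAt φ j))
  ; dot-to = λ { (c ∷ b) x → sym (trans (dot-△ˡ (scale c φ) (insertAt b j false) x)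
      (cong₂ _xor_ (dot-scaleˡ c φ x) (trans (dot-comm (insertAt b j false) x) (trans (dot-insertAt x b j false)
        (cong₂ _xor_ (Bool.∧-zeroʳ (lookup x j)) (dot-comm (removeAt x j) b)))))) }
  ; dot-lift = dot-lift }
  where
  dot-lift : ∀ a x → dot (lookup a j ∷ (removeAt a j △ scale (lookup a j) (removeAt φ j))) (dot φ x ∷ removeAt x j) ≡ dot a x
  dot-lift a x = trans (cong ((lookup a j ∧ dot φ x) xor_) (trans (dot-△ˡ (removeAt a j) _ (removeAt x j))
    (cong (dot (removeAt a j) (removeAt x j) xor_) (dot-scaleˡ (lookup a j) (removeAt φ j) (removeAt x j)))))
    (trans (cong (λ d → (lookup a j ∧ d) xor (dot (removeAt a j) (removeAt x j) xor (lookup a j ∧ dot (removeAt φ j) (removeAt x j))))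
      (trans (dot-split φ x j) (cong (λ c → (c ∧ lookup x j) xor dot (removeAt φ j) (removeAt x j)) φj)))
    (trans (finish (lookup a j) (lookup x j) (dot (removeAt a j) (removeAt x j)) (dot (removeAt φ j) (removeAt x j)))
      (sym (dot-split a x j))))
    where
    finish : ∀ a x p q → (a ∧ (x xor q)) xor (p xor (a ∧ q)) ≡ (a ∧ x) xor p
    finish false x p q = Bool.xor-identityʳ p
    finish true true true true = refl
    finish true true true false = refl
    finish true true false true = refl
    finish true true false false = refl
    finish true false true true = refl
    finish true false true false = refl
    finish true false false true = refl
    finish true false false false = refl

-- Deletion and series contraction

∈-⁻ : (p : Subset n) {x y : Fin n} → y ∈ p - x → y ∈ p × y ≢ x
∈-⁻ p {x} y∈ = p─q⊆p p ⁅ x ⁆ y∈ , λ { refl → x∉p-x p y∈ }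

∉⇒∈∁⁅⁆ : {x y : Fin n} → y ≢ x → y ∈ ∁ ⁅ x ⁆
∉⇒∈∁⁅⁆ y≢x = x∉p⇒x∈∁p (x≢y⇒x∉⁅y⁆ y≢x)

△--distrib : (p q : Subset n) (x : Fin n) → (p △ q) - x ≡ (p - x) △ (q - x)
△--distrib p q x = ⊆-antisym to from
  where
  to : (p △ q) - x ⊆ (p - x) △ (q - x)
  to y∈ with ∈-⁻ (p △ q) y∈
  ... | y∈△ , y≢x with ∈△⁻ p q y∈△
  ...   | inj₁ (y∈p , y∉q) = ∈△⁺ˡ (p - x) (q - x) (x∈p∧x≢y⇒x∈p-y y∈p y≢x) (y∉q ∘ proj₁ ∘ ∈-⁻ q)
  ...   | inj₂ (y∉p , y∈q) = ∈△⁺ʳ (p - x) (q - x) (y∉p ∘ proj₁ ∘ ∈-⁻ p) (x∈p∧x≢y⇒x∈p-y y∈q y≢x)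

  from : (p - x) △ (q - x) ⊆ (p △ q) - x
  from y∈ with ∈△⁻ (p - x) (q - x) y∈
  ... | inj₁ (y∈p-x , y∉q-x) = let y∈p , y≢x = ∈-⁻ p y∈p-x
          in x∈p∧x≢y⇒x∈p-y (∈△⁺ˡ p q y∈p (λ y∈q → y∉q-x (x∈p∧x≢y⇒x∈p-y y∈q y≢x))) y≢x
  ... | inj₂ (y∉p-x , y∈q-x) = let y∈q , y≢x = ∈-⁻ q y∈q-x
          in x∈p∧x≢y⇒x∈p-y (∈△⁺ʳ p q (λ y∈p → y∉p-x (x∈p∧x≢y⇒x∈p-y y∈p y≢x)) y∈q) y≢x

-- Circuits, bases and series pairs

module MatroidProperties (M : Matroid n) where
  open Matroid M hiding (E; Indep; Base; Circuit; Element)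

  private
    module M = Matroid M

  Coindep : Subset n → Set
  Coindep = Matroid.Indep (M *)

  Coindep? : Decidable Coindep
  Coindep? = Matroid.Indep? (M *)

  Circuit? : Decidable M.Circuit
  Circuit? C = C ⊆? M.E ×-dec (¬? (Indep? C) ×-dec allSubset? (λ D → D ⊂? C →-dec Indep? D))

  circuit-in : ∀ {D} → D ⊆ M.E → ¬ M.Indep D → ∃ λ C → M.Circuit C × C ⊆ D
  circuit-in D⊆E dep with minimal {P = λ C → C ⊆ M.E × ¬ M.Indep C} (λ C → C ⊆? M.E ×-dec ¬? (Indep? C)) (D⊆E , dep)
  ... | C , (C⊆E , ¬iC) , C⊆D , min = C , (C⊆E , ¬iC , λ F F⊂C → decidable-stable (Indep? F)
    (λ ¬iF → ⊂-irref (min F (⊆-trans (proj₁ F⊂C) C⊆E , ¬iF) (proj₁ F⊂C)) F⊂C)) , C⊆D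

  circuit-⊆ : ∀ {C D} → M.Circuit C → M.Circuit D → C ⊆ D → C ≡ D
  circuit-⊆ {C} {D} (_ , ¬iC , _) (_ , _ , min) C⊆D =
    decidable-stable (C ≟ˢ D) (λ C≢D → ¬iC (min C (⊆∧≢⇒⊂ C⊆D C≢D)))

  circuit-- : ∀ {C x} → M.Circuit C → x ∈ C → M.Indep (C - x)
  circuit-- {C} {x} (_ , _ , min) x∈C = min (C - x) (x∈p⇒p-x⊂p x∈C)

  circuit-nonempty : ∀ {C} → M.Circuit C → Nonempty C
  circuit-nonempty {C} (_ , ¬iC , _) with nonempty? C
  ... | yes found = found
  ... | no empty = contradiction (subst M.Indep (sym (Empty-unique empty)) ⊥-indep) ¬iC

  base-⊇ : ∀ {I} → M.Indep I → ∃ λ B → M.Base B × I ⊆ B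
  base-⊇ iI with maximal Indep? iI
  ... | B , iB , I⊆B , max = B , (iB , max) , I⊆B

  some-base : ∃ M.Base
  some-base with base-⊇ ⊥-indep
  ... | B , bB , _ = B , bB

  base-size : ∀ {A B} → M.Base A → M.Base B → ∣ A ∣ ≡ ∣ B ∣
  base-size bA bB = ℕ.≤-antisym (base-max bB (proj₁ bA)) (base-max bA (proj₁ bB))

  -- Extending `C - x` from `B` cannot pick up `x`, which would complete `C`. The upper bound on `K`
  -- keeps out every element that is in neither `C` nor `B`.
  base-⊇-circuit : ∀ {C x B} → M.Circuit C → x ∈ C → M.Base B →
    ∃ λ K → M.Base K × C - x ⊆ K × K ⊆ (C - x) ∪ B × x ∉ K
  base-⊇-circuit {C} {x} circ x∈C bB with extend (circuit-- circ x∈C) (proj₁ bB)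
  ... | K , C-x⊆K , K⊆ , iK , B≤K = K , max-base bB iK B≤K , C-x⊆K , K⊆ ,
    λ x∈K → proj₁ (proj₂ circ) (indep-⊆ (C⊆K x∈K) iK)
    where
    C⊆K : x ∈ K → C ⊆ K
    C⊆K x∈K {y} y∈C with y Fin.≟ x
    ... | yes refl = x∈K
    ... | no y≢x = C-x⊆K (x∈p∧x≢y⇒x∈p-y y∈C y≢x)

  fundamental : ∀ {B x} → M.Base B → x ∈ M.E → x ∉ B → ∃ λ C → M.Circuit C × C ⊆ B ∪ ⁅ x ⁆ × x ∈ C
  fundamental {B} {x} (iB , max) x∈E x∉B
    with circuit-in {B ∪ ⁅ x ⁆} (∪-⊆ (indep⊆E iB) (⁅⁆-⊆ x∈E))
      (λ i → x∉B (subst (x ∈_) (max _ i (p⊆p∪q ⁅ x ⁆)) (∈∪⁅⁆ B x)))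
  ... | C , circ , C⊆ with x ∈? C
  ...   | yes x∈C = C , circ , C⊆ , x∈C
  ...   | no x∉C = contradiction
          (indep-⊆ (λ {y} y∈C → ∈∪⁅⁆⁻ B (C⊆ y∈C) (λ { refl → x∉C y∈C })) iB) (proj₁ (proj₂ circ))

  coindep-⁅⁆ : ∀ {C x} → M.Circuit C → x ∈ C → Coindep ⁅ x ⁆
  coindep-⁅⁆ circ x∈C with some-base
  ... | B , bB with base-⊇-circuit circ x∈C bB
  ...   | K , bK , _ , _ , x∉K = K , bK , ⁅⁆-⊆ (x∈p∧x∉q⇒x∈p─q (proj₁ circ x∈C) x∉K)

  BadPair : Set
  BadPair = ∃ λ C → ∃ λ D → M.Circuit C × M.Circuit D × C ≢ D × Nonempty (C ∩ D) × ¬ M.Circuit (C △ D)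

  bad-pair : ¬ CircuitDifference M → BadPair
  bad-pair ¬cd with anySubset? (λ C → anySubset? (λ D → Circuit? C ×-dec (Circuit? D ×-dec
    (¬? (C ≟ˢ D) ×-dec (nonempty? (C ∩ D) ×-dec ¬? (Circuit? (C △ D)))))))
  ... | yes found = found
  ... | no ¬∃ = contradiction (λ C D cC cD C≢D C∩D → decidable-stable (Circuit? (C △ D))
          (λ ¬c → ¬∃ (C , D , cC , cD , C≢D , C∩D , ¬c))) ¬cd

  restrict-circuit⁺ : ∀ {X C} → M.Circuit C → C ⊆ X → Matroid.Circuit (M ↾ X) C
  restrict-circuit⁺ (C⊆E , ¬iC , min) C⊆X = (λ x∈C → x∈p∩q⁺ (C⊆E x∈C , C⊆X x∈C)) ,
    ¬iC ∘ proj₁ , λ D D⊂C → min D D⊂C , ⊆-trans (proj₁ D⊂C) C⊆X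

  restrict-circuit⁻ : ∀ {X C} → Matroid.Circuit (M ↾ X) C → M.Circuit C × C ⊆ X
  restrict-circuit⁻ {X} (C⊆ , ¬iC , min) =
    (p∩q⊆p M.E X ∘ C⊆ , (λ iC → ¬iC (iC , p∩q⊆q M.E X ∘ C⊆)) , λ D D⊂C → proj₁ (min D D⊂C)) , p∩q⊆q M.E X ∘ C⊆

  restrict-cd : ∀ {X} → CircuitDifference M → CircuitDifference (M ↾ X)
  restrict-cd cd C D cC cD C≢D C∩D =
    let cC′ , C⊆X = restrict-circuit⁻ cC ; cD′ , D⊆X = restrict-circuit⁻ cD
    in restrict-circuit⁺ (cd C D cC′ cD′ C≢D C∩D) (△-⊆ C⊆X D⊆X)

  -- Suppose `C` contains `e` but not `f`. Some base avoids `f`; extending `C - e` from it gives a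
  -- base that avoids both `e` and `f`, so the pair is coindependent and not a cocircuit.
  series-circuit : ∀ {e f C} → Matroid.Circuit (M *) (⁅ e ⁆ ∪ ⁅ f ⁆) → e ≢ f → M.Circuit C → e ∈ C → f ∈ C
  series-circuit {e} {f} {C} (ef⊆E , ¬co , min) e≢f circ e∈C with f ∈? C
  ... | yes f∈C = f∈C
  ... | no f∉C with min ⁅ f ⁆ (q⊆p∪q ⁅ e ⁆ ⁅ f ⁆ , e , p⊆p∪q ⁅ f ⁆ (x∈⁅x⁆ e) , x≢y⇒x∉⁅y⁆ e≢f)
  ...   | B , bB , f⊆ with base-⊇-circuit circ e∈C bB
  ...     | K , bK , _ , K⊆ , e∉K = ⊥-elim (¬co (K , bK , ∪-⊆
            (⁅⁆-⊆ (x∈p∧x∉q⇒x∈p─q (ef⊆E (p⊆p∪q ⁅ f ⁆ (x∈⁅x⁆ e))) e∉K))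
            (⁅⁆-⊆ (x∈p∧x∉q⇒x∈p─q (ef⊆E (q⊆p∪q ⁅ e ⁆ ⁅ f ⁆ (x∈⁅x⁆ f))) f∉K))))
    where
    f∉K : f ∉ K
    f∉K f∈K with x∈p∪q⁻ (C - e) B (K⊆ f∈K)
    ... | inj₁ f∈C-e = f∉C (proj₁ (∈-⁻ C f∈C-e))
    ... | inj₂ f∈B = x∈p─q⇒x∉q M.E B (f⊆ (x∈⁅x⁆ f)) f∈B

  module SeriesContraction {e f} (e≢f : e ≢ f) (cocircuit : Matroid.Circuit (M *) (⁅ e ⁆ ∪ ⁅ f ⁆)) where

    e∈E : e ∈ M.E
    e∈E = proj₁ cocircuit (p⊆p∪q ⁅ f ⁆ (x∈⁅x⁆ e))

    indep-⁅e⁆ : M.Indep ⁅ e ⁆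
    indep-⁅e⁆ with Indep? ⁅ e ⁆
    ... | yes i = i
    ... | no ¬i with proj₂ (proj₂ cocircuit) ⁅ f ⁆ (q⊆p∪q ⁅ e ⁆ ⁅ f ⁆ , e , p⊆p∪q ⁅ f ⁆ (x∈⁅x⁆ e) , x≢y⇒x∉⁅y⁆ e≢f)
    ...   | B , bB , f⊆ = ⊥-elim (proj₁ (proj₂ cocircuit) (B , bB , ∪-⊆
              (⁅⁆-⊆ (x∈p∧x∉q⇒x∈p─q e∈E (λ e∈B → ¬i (indep-⊆ (⁅⁆-⊆ e∈B) (proj₁ bB))))) f⊆))

    -- Contraction is deletion conjugated by duality, so the witness `B` is a maximal coindependent
    -- set avoiding `e`. Extending `e` from a base `T` disjoint from `B` gives a base `K` whose
    -- complement contains `B`; maximality makes it `B`, and then `I` lies in `K`.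
    contract-indep⁻ : ∀ {I} → Matroid.Indep (M ／ ⁅ e ⁆) I → e ∉ I × M.Indep (I ∪ ⁅ e ⁆)
    contract-indep⁻ {I} (B , (((T , bT , B⊆) , B⊆∁e) , max) , I⊆)
      with extend indep-⁅e⁆ (proj₁ bT)
    ... | K , e⊆K , K⊆ , iK , T≤K = (λ e∈I → contradiction (x∈⁅x⁆ e)
            (x∈∁p⇒x∉p (p∩q⊆q M.E (∁ ⁅ e ⁆) (p─q⊆p _ B (I⊆ e∈I))))) , indep-⊆ (∪-⊆ I⊆K e⊆K) iK
      where
      E-K≡B : M.E ─ K ≡ B
      E-K≡B = max (M.E ─ K)
        ((K , max-base bT iK T≤K , λ x∈ → x∈) ,
         λ x∈ → x∉p⇒x∈∁p (λ x∈e → x∈p─q⇒x∉q M.E K x∈ (e⊆K x∈e)))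
        (λ x∈B → x∈p∧x∉q⇒x∈p─q (p─q⊆p M.E T (B⊆ x∈B)) (x∉K x∈B))
        where
        x∉K : ∀ {x} → x ∈ B → x ∉ K
        x∉K x∈B x∈K with x∈p∪q⁻ ⁅ e ⁆ T (K⊆ x∈K)
        ... | inj₁ x∈e = x∈∁p⇒x∉p (B⊆∁e x∈B) x∈e
        ... | inj₂ x∈T = x∈p─q⇒x∉q M.E T (B⊆ x∈B) x∈T

      I⊆K : I ⊆ K
      I⊆K {x} x∈I with x ∈? K
      ... | yes x∈K = x∈K
      ... | no x∉K = contradiction
        (subst (x ∈_) E-K≡B (x∈p∧x∉q⇒x∈p─q (p∩q⊆p M.E (∁ ⁅ e ⁆) (p─q⊆p _ B (I⊆ x∈I))) x∉K))
        (x∈p─q⇒x∉q (M.E ∩ ∁ ⁅ e ⁆) B (I⊆ x∈I))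

    contract-indep⁺ : ∀ {I} → e ∉ I → M.Indep (I ∪ ⁅ e ⁆) → Matroid.Indep (M ／ ⁅ e ⁆) I
    contract-indep⁺ {I} e∉I iI+e with base-⊇ iI+e
    ... | K , bK , I+e⊆K = M.E ─ K ,
      (((K , bK , λ x∈ → x∈) , λ x∈ → x∉p⇒x∈∁p (λ x∈e → x∈p─q⇒x∉q M.E K x∈ (I+e⊆K (q⊆p∪q I ⁅ e ⁆ x∈e)))) ,
       λ { J ((T , bT , J⊆) , _) E-K⊆J → ⊆-antisym (J⊆E-K J T bT J⊆ E-K⊆J) E-K⊆J }) ,
      λ {x} x∈I → x∈p∧x∉q⇒x∈p─q
        (x∈p∩q⁺ (indep⊆E (proj₁ bK) (I+e⊆K (p⊆p∪q ⁅ e ⁆ x∈I)) , ∉⇒∈∁⁅⁆ (λ { refl → e∉I x∈I })))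
        (λ x∈E-K → x∈p─q⇒x∉q M.E K x∈E-K (I+e⊆K (p⊆p∪q ⁅ e ⁆ x∈I)))
      where
      J⊆E-K : ∀ J T → M.Base T → J ⊆ M.E ─ T → M.E ─ K ⊆ J → J ⊆ M.E ─ K
      J⊆E-K J T (iT , maxT) J⊆ E-K⊆J x∈J = x∈p∧x∉q⇒x∈p─q (p─q⊆p M.E T (J⊆ x∈J))
        (λ x∈K → x∈p─q⇒x∉q M.E T (J⊆ x∈J) (subst (_ ∈_) (maxT K (proj₁ bK) T⊆K) x∈K))
        where
        T⊆K : T ⊆ K
        T⊆K {y} y∈T with y ∈? K
        ... | yes y∈K = y∈K
        ... | no y∉K = contradiction y∈T (x∈p─q⇒x∉q M.E T (J⊆ (E-K⊆J (x∈p∧x∉q⇒x∈p─q (indep⊆E iT y∈T) y∉K))))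

    cocircuit′ : Matroid.Circuit (M *) (⁅ f ⁆ ∪ ⁅ e ⁆)
    cocircuit′ = subst (Matroid.Circuit (M *)) (∪-comm ⁅ e ⁆ ⁅ f ⁆) cocircuit

    e⇒f : ∀ {C} → M.Circuit C → e ∈ C → f ∈ C
    e⇒f = series-circuit cocircuit e≢f

    f⇒e : ∀ {C} → M.Circuit C → f ∈ C → e ∈ C
    f⇒e = series-circuit cocircuit′ (e≢f ∘ sym)

    e∉p-e : (p : Subset n) → e ∉ p - e
    e∉p-e p = x∉p-x p

    -- The arguments about circuits see the contraction only through its ground set and independent
    -- sets, not through its definition by double duality.
    module Contraction (N : Matroid n) (E-N : E N ≡ M.E ∩ ∁ ⁅ e ⁆)
      (indep⁻ : ∀ {I} → Indep N I → e ∉ I × M.Indep (I ∪ ⁅ e ⁆))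
      (indep⁺ : ∀ {I} → e ∉ I → M.Indep (I ∪ ⁅ e ⁆) → Indep N I) where

      private
        module N = Matroid N

      -- For `e` outside `C` this depends on the series pair: a dependency in `D ∪ ⁅ e ⁆` with
      -- `D ⊂ C` would give a circuit through `e`, hence through `f`, so `f` would be in `C`, and
      -- then `e` as well.
      circuit-contract⁺ : ∀ {C} → M.Circuit C → N.Circuit (C - e)
      circuit-contract⁺ {C} circ@(C⊆E , ¬iC , min) =
        (λ x∈ → let x∈C , x≢e = ∈-⁻ C x∈ in subst (_ ∈_) (sym E-N) (x∈p∩q⁺ (C⊆E x∈C , ∉⇒∈∁⁅⁆ x≢e))) ,
        (λ i → ¬iC (indep-⊆ C⊆ (proj₂ (indep⁻ i)))) , below
        where
        C⊆ : C ⊆ (C - e) ∪ ⁅ e ⁆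
        C⊆ {y} y∈C with y Fin.≟ e
        ... | yes refl = ∈∪⁅⁆ (C - e) e
        ... | no y≢e = p⊆p∪q ⁅ e ⁆ (x∈p∧x≢y⇒x∈p-y y∈C y≢e)

        below : ∀ D → D ⊂ C - e → N.Indep D
        below D (D⊆ , x , x∈ , x∉D) = indep⁺ (λ e∈D → e∉p-e C (D⊆ e∈D)) iD+e
          where
          D⊆C : D ⊆ C
          D⊆C = p─q⊆p C ⁅ e ⁆ ∘ D⊆

          x∉D+e : x ∉ D ∪ ⁅ e ⁆
          x∉D+e = ∉-∪ x∉D (x≢y⇒x∉⁅y⁆ (proj₂ (∈-⁻ C x∈)))

          iD+e : M.Indep (D ∪ ⁅ e ⁆)
          iD+e with e ∈? C
          ... | yes e∈C = min (D ∪ ⁅ e ⁆) (∪-⊆ D⊆C (⁅⁆-⊆ e∈C) , x , proj₁ (∈-⁻ C x∈) , x∉D+e)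
          ... | no e∉C with Indep? (D ∪ ⁅ e ⁆)
          ...   | yes i = i
          ...   | no ¬i with circuit-in (∪-⊆ (C⊆E ∘ D⊆C) (⁅⁆-⊆ e∈E)) ¬i
          ...     | F , cF , F⊆ with e ∈? F
          ...       | no e∉F = contradiction
                      (min F ((λ y∈F → D⊆C (F⊆D y∈F)) , x , proj₁ (∈-⁻ C x∈) , x∉D ∘ F⊆D)) (proj₁ (proj₂ cF))
            where
            F⊆D : F ⊆ D
            F⊆D {y} y∈F = ∈∪⁅⁆⁻ D (F⊆ y∈F) (λ { refl → e∉F y∈F })
          ...       | yes e∈F = contradiction
                      (f⇒e circ (D⊆C (∈∪⁅⁆⁻ D (F⊆ (e⇒f cF e∈F)) (e≢f ∘ sym)))) e∉C

      circuit-contract⁻ : ∀ {C} → N.Circuit C → ∃ λ D → M.Circuit D × D - e ≡ C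
      circuit-contract⁻ {C} (C⊆ , ¬iC , min)
        with circuit-in {C ∪ ⁅ e ⁆} (∪-⊆ (p∩q⊆p M.E (∁ ⁅ e ⁆) ∘ C⊆′) (⁅⁆-⊆ e∈E)) (¬iC ∘ indep⁺ e∉C)
        where
        C⊆′ : C ⊆ M.E ∩ ∁ ⁅ e ⁆
        C⊆′ = subst (_ ∈_) E-N ∘ C⊆

        e∉C : e ∉ C
        e∉C e∈C = x∈∁p⇒x∉p (p∩q⊆q M.E (∁ ⁅ e ⁆) (C⊆′ e∈C)) (x∈⁅x⁆ e)
      ... | D , circ , D⊆ = D , circ , decidable-stable ((D - e) ≟ˢ C)
        (λ D-e≢C → proj₁ (proj₂ (circuit-contract⁺ circ)) (min (D - e) (⊆∧≢⇒⊂ D-e⊆C D-e≢C)))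
        where
        D-e⊆C : D - e ⊆ C
        D-e⊆C x∈ = let x∈D , x≢e = ∈-⁻ D x∈ in ∈∪⁅⁆⁻ C (D⊆ x∈D) x≢e

      -- Whether `e` belongs to a set can be read off from `f`, which survives the contraction.
      contract-injective : ∀ {C D} → (e ∈ C → f ∈ C) → (f ∈ C → e ∈ C) → (e ∈ D → f ∈ D) → (f ∈ D → e ∈ D) →
        C - e ≡ D - e → C ≡ D
      contract-injective Ce Cf De Df eq = ⊆-antisym (half Ce Df eq) (half De Cf (sym eq))
        where
        half : ∀ {C D} → (e ∈ C → f ∈ C) → (f ∈ D → e ∈ D) → C - e ≡ D - e → C ⊆ D
        half {C} {D} Ce Df eq {x} x∈C with x Fin.≟ e
        ... | no x≢e = proj₁ (∈-⁻ D (subst (x ∈_) eq (x∈p∧x≢y⇒x∈p-y x∈C x≢e)))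
        ... | yes refl = Df (proj₁ (∈-⁻ D (subst (f ∈_) eq (x∈p∧x≢y⇒x∈p-y (Ce x∈C) (e≢f ∘ sym)))))

      contract-∩ : ∀ {C D} → M.Circuit C → M.Circuit D → Nonempty (C ∩ D) → Nonempty ((C - e) ∩ (D - e))
      contract-∩ {C} {D} cC cD (x , x∈) with x∈p∩q⁻ C D x∈ | x Fin.≟ e
      ... | x∈C , x∈D | no x≢e = x , x∈p∩q⁺ (x∈p∧x≢y⇒x∈p-y x∈C x≢e , x∈p∧x≢y⇒x∈p-y x∈D x≢e)
      ... | x∈C , x∈D | yes refl = f , x∈p∩q⁺ (x∈p∧x≢y⇒x∈p-y (e⇒f cC x∈C) (e≢f ∘ sym) , x∈p∧x≢y⇒x∈p-y (e⇒f cD x∈D) (e≢f ∘ sym))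

      contract-cd : CircuitDifference M → CircuitDifference N
      contract-cd cd C′ D′ cC′ cD′ C′≢D′ (x , x∈)
        with circuit-contract⁻ cC′ | circuit-contract⁻ cD′
      ... | C , cC , refl | D , cD , refl = subst N.Circuit (△--distrib C D e)
        (circuit-contract⁺ (cd C D cC cD (λ { refl → C′≢D′ refl })
          (let x∈C , x∈D = x∈p∩q⁻ (C - e) (D - e) x∈
           in x , x∈p∩q⁺ (proj₁ (∈-⁻ C x∈C) , proj₁ (∈-⁻ D x∈D)))))

      uncontract-cd : CircuitDifference N → CircuitDifference M
      uncontract-cd cd C D cC cD C≢D C∩D
        with circuit-contract⁻ (cd (C - e) (D - e) (circuit-contract⁺ cC) (circuit-contract⁺ cD)
          (C≢D ∘ contract-injective (e⇒f cC) (f⇒e cC) (e⇒f cD) (f⇒e cD)) (contract-∩ cC cD C∩D))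
      ... | F , cF , eq = subst M.Circuit (contract-injective (e⇒f cF) (f⇒e cF)
        (transfer (e⇒f cC) (f⇒e cC) (e⇒f cD) (f⇒e cD)) (transfer (f⇒e cC) (e⇒f cC) (f⇒e cD) (e⇒f cD))
        (trans eq (sym (△--distrib C D e)))) cF
        where
        transfer : ∀ {x y} → (x ∈ C → y ∈ C) → (y ∈ C → x ∈ C) → (x ∈ D → y ∈ D) → (y ∈ D → x ∈ D) → x ∈ C △ D → y ∈ C △ D
        transfer C→ C← D→ D← x∈ with ∈△⁻ C D x∈
        ... | inj₁ (x∈C , x∉D) = ∈△⁺ˡ C D (C→ x∈C) (x∉D ∘ D←)
        ... | inj₂ (x∉C , x∈D) = ∈△⁺ʳ C D (x∉C ∘ C←) (D→ x∈D)

    open Contraction (M ／ ⁅ e ⁆) refl contract-indep⁻ contract-indep⁺ public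

series-minor-cd : {M N : Matroid n} → N SeriesMinorOf M → CircuitDifference M → CircuitDifference N
series-minor-cd ε cd = cd
series-minor-cd {M = M} (delete {e} _ ◅ steps) cd =
  series-minor-cd steps (MatroidProperties.restrict-cd M {∁ ⁅ e ⁆} cd)
series-minor-cd {M = M} (contract e≢f cocircuit ◅ steps) cd =
  series-minor-cd steps (MatroidProperties.SeriesContraction.contract-cd M e≢f cocircuit cd)

-- The one-step form of an excluded series minor. A series pair is impossible because
-- `uncontract-cd` would lift the property back to `M`; without one, a proper series minor starts
-- with a deletion, and `series-minor-cd` carries the property along the remaining steps.
Minimal : Matroid n → Set
Minimal M = ¬ CircuitDifference M × (∀ {e} → e ∈ E M → CircuitDifference (M ╲ ⁅ e ⁆)) ×
  (∀ {e f} → e ≢ f → ¬ Matroid.Circuit (M *) (⁅ e ⁆ ∪ ⁅ f ⁆))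

excluded⇒minimal : {M : Matroid n} → ExcludedSeriesMinor CircuitDifference M → Minimal M
excluded⇒minimal {M = M} (¬cd , proper) = ¬cd ,
  (λ {e} e∈E → proper (M ╲ ⁅ e ⁆) (delete e∈E ◅ ε) (λ eq → e∉∁ e (subst (e ∈_) (sym (cong E eq)) e∈E))) ,
  λ {e} e≢f cocircuit → let module S = MatroidProperties.SeriesContraction M e≢f cocircuit in
    ¬cd (S.uncontract-cd (proper (M ／ ⁅ e ⁆) (contract e≢f cocircuit ◅ ε)
      (λ eq → e∉∁ e (subst (e ∈_) (sym (cong E eq)) S.e∈E))))
  where
  e∉∁ : ∀ e → e ∉ E M ∩ ∁ ⁅ e ⁆
  e∉∁ e e∈ = x∈∁p⇒x∉p (p∩q⊆q (E M) (∁ ⁅ e ⁆) e∈) (x∈⁅x⁆ e)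

minimal⇒excluded : {M : Matroid n} → Minimal M → ExcludedSeriesMinor CircuitDifference M
minimal⇒excluded {M = M} (¬cd , del , cosimple) = ¬cd , proper
  where
  proper : ∀ N → N SeriesMinorOf M → N ≢ M → CircuitDifference N
  proper N ε N≢M = contradiction refl N≢M
  proper N (delete e∈E ◅ steps) _ = series-minor-cd steps (del e∈E)
  proper N (contract e≢f cocircuit ◅ _) _ = contradiction cocircuit (cosimple e≢f)

-- Nullity and uniform matroids

Element-≡ : {p : Subset n} {x y : ∃ λ z → z ∈ p} → proj₁ x ≡ proj₁ y → x ≡ y
Element-≡ {x = x , x∈} {.x , x∈′} refl = cong (x ,_) (∈-irrelevant x∈ x∈′)

Corresponds : (M : Matroid m) (N : Matroid n) → Element M ↔ Element N → Subset m → Subset n → Set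
Corresponds M N f I J = ∀ (x : Element M) → proj₁ x ∈ I ⇔ proj₁ (Inverse.to f x) ∈ J

module _ (M : Matroid m) (N : Matroid n) (f : Element M ↔ Element N) where
  private
    module f = Inverse f

  corresponds-∣∣ : ∀ {I J} → I ⊆ E M → J ⊆ E N → Corresponds M N f I J → ∣ I ∣ ≡ ∣ J ∣
  corresponds-∣∣ {I} {J} I⊆ J⊆ corr = ℕ.≤-antisym
    (∣∣-injection I J (λ x∈ → proj₁ (f.to (_ , I⊆ x∈)))
      (λ x∈ → Equivalence.to (corr (_ , I⊆ x∈)) x∈)
      (λ x∈ y∈ eq → cong proj₁ (trans (sym (f.strictlyInverseʳ _)) (trans (cong f.from (Element-≡ eq)) (f.strictlyInverseʳ _)))))
    (∣∣-injection J I (λ x∈ → proj₁ (f.from (_ , J⊆ x∈)))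
      (λ {x} x∈ → Equivalence.from (corr (f.from (x , J⊆ x∈))) (subst (λ z → proj₁ z ∈ J) (sym (f.strictlyInverseˡ _)) x∈))
      (λ x∈ y∈ eq → cong proj₁ (trans (sym (f.strictlyInverseˡ _)) (trans (cong f.to (Element-≡ eq)) (f.strictlyInverseˡ _)))))

  private
    InImage : Subset m → Fin n → Set
    InImage I y = ∃ λ (y∈ : y ∈ E N) → proj₁ (f.from (y , y∈)) ∈ I

    InImage? : ∀ I → Decidable (InImage I)
    InImage? I y with y ∈? E N
    ... | no y∉ = no (y∉ ∘ proj₁)
    ... | yes y∈ with proj₁ (f.from (y , y∈)) ∈? I
    ...   | yes h = yes (y∈ , h)
    ...   | no ¬h = no λ { (y∈′ , h) → ¬h (subst (λ z → proj₁ (f.from (y , z)) ∈ I) (∈-irrelevant y∈′ y∈) h) }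

  image : Subset m → Subset n
  image I = ⟪ InImage? I ⟫

  image-⊆ : ∀ I → image I ⊆ E N
  image-⊆ I y∈ = proj₁ (∈⟪⟫⁻ (InImage? I) y∈)

  image-corresponds : ∀ I → Corresponds M N f I (image I)
  image-corresponds I x = mk⇔
    (λ x∈ → ∈⟪⟫⁺ (InImage? I) (proj₂ (f.to x) , subst (λ z → proj₁ z ∈ I) (sym (f.strictlyInverseʳ x)) x∈))
    (λ h → subst (λ z → proj₁ z ∈ I) (f.strictlyInverseʳ x) (back (∈⟪⟫⁻ (InImage? I) h)))
    where
    back : InImage I (proj₁ (f.to x)) → proj₁ (f.from (f.to x)) ∈ I
    back (y∈ , h) = subst (λ z → proj₁ (f.from (proj₁ (f.to x) , z)) ∈ I) (∈-irrelevant y∈ (proj₂ (f.to x))) h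

record IsUniform (k : ℕ) (M : Matroid n) : Set where
  field
    indep⇔ : ∀ {I} → I ⊆ E M → Indep M I ⇔ ∣ I ∣ ≤ k
    size   : ∣ E M ∣ ≡ k + 2

≅U⇒uniform : {M : Matroid n} → M ≅ U k (k + 2) → IsUniform k M
≅U⇒uniform {k = k} {M} iso = record
  { indep⇔ = λ {I} I⊆E → subst (λ c → Indep M I ⇔ c ≤ k)
      (sym (corresponds-∣∣ M U′ f I⊆E (image-⊆ M U′ f I) (image-corresponds M U′ f I)))
      (_≅_.preserves iso I⊆E (image-⊆ M U′ f I) (image-corresponds M U′ f I))
  ; size = trans (corresponds-∣∣ M U′ f ⊆-refl ⊆-refl (λ x → mk⇔ (λ _ → ∈⊤) (λ _ → proj₂ x))) (∣⊤∣≡n (k + 2)) }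
  where
  U′ : Matroid (k + 2)
  U′ = U k (k + 2)

  f : Element M ↔ Element U′
  f = _≅_.bijection iso

uniform⇒≅U : {M : Matroid n} → IsUniform k M → M ≅ U k (k + 2)
uniform⇒≅U {k = k} {M} unif = subst (λ c → M ≅ U k c) size record
  { bijection = f
  ; preserves = λ {I} I⊆E J⊆E corr → subst (λ c → Indep M I ⇔ c ≤ k) (corresponds-∣∣ M U′ f I⊆E J⊆E corr) (indep⇔ I⊆E) }
  where
  open IsUniform unif

  U′ : Matroid ∣ E M ∣
  U′ = U k ∣ E M ∣

  f : Element M ↔ Element U′
  f = mk↔ₛ′ (λ (x , x∈) → position (E M) x∈ , ∈⊤) (λ (i , _) → element (E M) i , element-∈ (E M) i)
    (λ (i , _) → Element-≡ (element-injective (E M) (element-position (E M) (element-∈ (E M) i))))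
    (λ (x , x∈) → Element-≡ (element-position (E M) x∈))

∣⁅x⁆∪⁅y⁆∣ : {x y : Fin n} → x ≢ y → ∣ ⁅ x ⁆ ∪ ⁅ y ⁆ ∣ ≡ 2
∣⁅x⁆∪⁅y⁆∣ {x = x} {y} x≢y = trans (∣p∪⁅x⁆∣ ⁅ x ⁆ (x≢y⇒x∉⁅y⁆ (x≢y ∘ sym))) (cong suc (∣⁅x⁆∣≡1 x))

-△-⊆ : (p : Subset n) (x y : Fin n) → (p - x) △ (p - y) ⊆ ⁅ x ⁆ ∪ ⁅ y ⁆
-△-⊆ p x y {w} w∈ with w Fin.≟ x | w Fin.≟ y
... | yes refl | _ = p⊆p∪q ⁅ y ⁆ (x∈⁅x⁆ x)
... | no _ | yes refl = ∈∪⁅⁆ ⁅ x ⁆ y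
... | no w≢x | no w≢y with ∈△⁻ (p - x) (p - y) w∈
...   | inj₁ (w∈ , w∉) = contradiction (x∈p∧x≢y⇒x∈p-y (proj₁ (∈-⁻ p w∈)) w≢y) w∉
...   | inj₂ (w∉ , w∈) = contradiction (x∈p∧x≢y⇒x∈p-y (proj₁ (∈-⁻ p w∈)) w≢x) w∉

module UniformProperties {M : Matroid n} (unif : IsUniform k M) where
  open IsUniform unif
  open MatroidProperties M
  open Matroid M using (indep⊆E)

  small : ∀ {I} → I ⊆ E M → ∣ I ∣ ≤ k → Indep M I
  small I⊆E = Equivalence.from (indep⇔ I⊆E)

  small⁻ : ∀ {I} → Indep M I → ∣ I ∣ ≤ k
  small⁻ iI = Equivalence.to (indep⇔ (indep⊆E iI)) iI

  circuit-size⁺ : ∀ {C} → C ⊆ E M → ∣ C ∣ ≡ suc k → Circuit M C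
  circuit-size⁺ C⊆E C≡ = C⊆E , (λ iC → ℕ.1+n≰n (subst (_≤ k) C≡ (small⁻ iC))) ,
    λ D D⊂C → small (⊆-trans (proj₁ D⊂C) C⊆E) (ℕ.≤-pred (subst (∣ D ∣ <_) C≡ (p⊂q⇒∣p∣<∣q∣ D⊂C)))

  circuit-size⁻ : ∀ {C} → Circuit M C → ∣ C ∣ ≡ suc k
  circuit-size⁻ {C} circ@(C⊆E , ¬iC , _) = ℕ.≤-antisym
    (let x , x∈C = circuit-nonempty circ
     in subst (_≤ suc k) (sym (∣p-x∣ C x∈C)) (s≤s (small⁻ (circuit-- circ x∈C))))
    (ℕ.≰⇒> (¬iC ∘ small C⊆E))

  size-minus : ∀ {x} → x ∈ E M → ∣ E M - x ∣ ≡ suc k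
  size-minus x∈E = ℕ.suc-injective (trans (sym (∣p-x∣ (E M) x∈E)) (trans size (ℕ.+-comm k 2)))

  size-minus₂ : ∀ {x y} → x ∈ E M → y ∈ E M - x → ∣ E M - x - y ∣ ≡ k
  size-minus₂ {x} x∈E y∈ = ℕ.suc-injective (trans (sym (∣p-x∣ (E M - x) y∈)) (size-minus x∈E))

  module _ (2≤k : 2 ≤ k) where

    -- The complements of two elements `x` and `y` are circuits with difference contained in the
    -- pair, and a pair is independent for `k` at least 2. They intersect because `k` elements
    -- remain.
    not-circuit-difference : ¬ CircuitDifference M
    not-circuit-difference cd = proj₁ (proj₂ circuit-△) (small (△-⊆ C⊆E D⊆E) (ℕ.≤-trans (p⊆q⇒∣p∣≤∣q∣ (-△-⊆ (E M) x y)) (subst (_≤ k) (sym (∣⁅x⁆∪⁅y⁆∣ (y≢x ∘ sym))) 2≤k)))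
      where
      x,∈ : ∃ λ x → x ∈ E M
      x,∈ = ∣p∣>0⇒∃ (E M) (subst (0 <_) (trans (ℕ.+-comm 2 k) (sym size)) (s≤s z≤n))

      x = proj₁ x,∈
      x∈E = proj₂ x,∈

      y,∈ : ∃ λ y → y ∈ E M - x
      y,∈ = ∣p∣>0⇒∃ (E M - x) (subst (0 <_) (sym (size-minus x∈E)) (s≤s z≤n))

      y = proj₁ y,∈

      y∈E : y ∈ E M
      y∈E = proj₁ (∈-⁻ (E M) (proj₂ y,∈))

      y≢x : y ≢ x
      y≢x = proj₂ (∈-⁻ (E M) (proj₂ y,∈))

      z,∈ : ∃ λ z → z ∈ E M - x - y
      z,∈ = ∣p∣>0⇒∃ (E M - x - y) (subst (0 <_) (sym (size-minus₂ x∈E (proj₂ y,∈))) (ℕ.≤-trans (s≤s z≤n) 2≤k))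

      C⊆E : E M - x ⊆ E M
      C⊆E = p─q⊆p (E M) ⁅ x ⁆

      D⊆E : E M - y ⊆ E M
      D⊆E = p─q⊆p (E M) ⁅ y ⁆

      circuit-△ : Circuit M ((E M - x) △ (E M - y))
      circuit-△ = cd (E M - x) (E M - y) (circuit-size⁺ C⊆E (size-minus x∈E)) (circuit-size⁺ D⊆E (size-minus y∈E))
        (λ eq → x∉p-x (E M) (subst (y ∈_) eq (proj₂ y,∈)))
        (let z , z∈ = z,∈ ; z∈E-x , z≢y = ∈-⁻ (E M - x) z∈ in
          z , x∈p∩q⁺ (z∈E-x , x∈p∧x≢y⇒x∈p-y (C⊆E z∈E-x) z≢y))

    uniform⇒minimal : Minimal M
    uniform⇒minimal = not-circuit-difference , deletion , cosimple
      where
      -- After deletion of `e` there remain `k + 1` elements, the size of a circuit. So there are no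
      -- two distinct circuits to compare.
      only : ∀ {e C} → e ∈ E M → Circuit M C → C ⊆ ∁ ⁅ e ⁆ → C ≡ E M - e
      only e∈E circ C⊆∁ = ⊆∧∣∣≤⇒≡
        (λ x∈C → x∈p∧x∉q⇒x∈p─q (proj₁ circ x∈C) (x∈∁p⇒x∉p (C⊆∁ x∈C)))
        (ℕ.≤-reflexive (trans (size-minus e∈E) (sym (circuit-size⁻ circ))))

      deletion : ∀ {e} → e ∈ E M → CircuitDifference (M ╲ ⁅ e ⁆)
      deletion e∈E C D cC cD C≢D _ =
        let cC′ , C⊆ = restrict-circuit⁻ cC ; cD′ , D⊆ = restrict-circuit⁻ cD
        in contradiction (trans (only e∈E cC′ C⊆) (sym (only e∈E cD′ D⊆))) C≢D

      cosimple : ∀ {e f} → e ≢ f → ¬ Circuit (M *) (⁅ e ⁆ ∪ ⁅ f ⁆)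
      cosimple {e} {f} e≢f (ef⊆E , ¬co , _) = ¬co (E M - e - f ,
        (iB , λ I iI B⊆I → sym (⊆∧∣∣≤⇒≡ B⊆I (subst (∣ I ∣ ≤_) (sym B≡k) (small⁻ iI)))) ,
        (∪-⊆ (⁅⁆-⊆ (x∈p∧x∉q⇒x∈p─q e∈E (λ e∈ → x∉p-x (E M) (proj₁ (∈-⁻ (E M - e) e∈)))))
          (⁅⁆-⊆ (x∈p∧x∉q⇒x∈p─q f∈E (x∉p-x (E M - e))))))
        where
        e∈E : e ∈ E M
        e∈E = ef⊆E (p⊆p∪q ⁅ f ⁆ (x∈⁅x⁆ e))

        f∈E : f ∈ E M
        f∈E = ef⊆E (∈∪⁅⁆ ⁅ e ⁆ f)

        B≡k : ∣ E M - e - f ∣ ≡ k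
        B≡k = size-minus₂ e∈E (x∈p∧x≢y⇒x∈p-y f∈E (e≢f ∘ sym))

        iB : Indep M (E M - e - f)
        iB = small (p─q⊆p (E M) ⁅ e ⁆ ∘ p─q⊆p (E M - e) ⁅ f ⁆) (ℕ.≤-reflexive B≡k)

-- Cosimplicity and nullity of a minimal violating matroid

module MinimalProperties (M : Matroid n) (minM : Minimal M) where
  open Matroid M using (indep⊆E; base-max)
  open MatroidProperties M

  closed : ∀ {C D y} → Circuit M C → Circuit M D → C ≢ D → Nonempty (C ∩ D) →
    y ∈ E M → y ∉ C → y ∉ D → Circuit M (C △ D)
  closed {C} {D} cC cD C≢D C∩D y∈E y∉C y∉D = proj₁ (restrict-circuit⁻
    (proj₁ (proj₂ minM) y∈E C D (restrict-circuit⁺ cC (avoid y∉C)) (restrict-circuit⁺ cD (avoid y∉D)) C≢D C∩D))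
    where
    avoid : ∀ {F y} → y ∉ F → F ⊆ ∁ ⁅ y ⁆
    avoid y∉F x∈F = ∉⇒∈∁⁅⁆ λ { refl → y∉F x∈F }

  cover : ∀ {C D} → Circuit M C → Circuit M D → C ≢ D → Nonempty (C ∩ D) → ¬ Circuit M (C △ D) →
    ∀ {y} → y ∈ E M → y ∉ D → y ∈ C
  cover {C} cC cD C≢D C∩D ¬c {y} y∈E y∉D with y ∈? C
  ... | yes y∈C = y∈C
  ... | no y∉C = contradiction (closed cC cD C≢D C∩D y∈E y∉C y∉D) ¬c

  -- A violating pair covers the ground set. Hence `M` has no coloops and its dual no loops.
  in-circuit : ∀ {x} → x ∈ E M → ∃ λ C → Circuit M C × x ∈ C
  in-circuit {x} x∈E with bad-pair (proj₁ minM)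
  ... | C , D , cC , cD , C≢D , C∩D , ¬c with x ∈? D
  ...   | yes x∈D = D , cD , x∈D
  ...   | no x∉D = C , cC , cover cC cD C≢D C∩D ¬c x∈E x∉D

  -- Simplicity of the dual: loops are excluded by `in-circuit`, parallel pairs by the last clause
  -- of `Minimal`.
  coindep-pair : ∀ {x y} → x ∈ E M → y ∈ E M → x ≢ y → Coindep (⁅ x ⁆ ∪ ⁅ y ⁆)
  coindep-pair {x} {y} x∈E y∈E x≢y = decidable-stable (Coindep? (⁅ x ⁆ ∪ ⁅ y ⁆))
    (λ ¬co → proj₂ (proj₂ minM) x≢y (∪-⊆ (⁅⁆-⊆ x∈E) (⁅⁆-⊆ y∈E) , ¬co , below))
    where
    single : ∀ {z} → z ∈ E M → Coindep ⁅ z ⁆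
    single z∈E = let C , circ , z∈C = in-circuit z∈E in coindep-⁅⁆ circ z∈C

    below : ∀ D → D ⊂ ⁅ x ⁆ ∪ ⁅ y ⁆ → Coindep D
    below D (D⊆ , z , z∈ , z∉D) with x∈p∪q⁻ ⁅ x ⁆ ⁅ y ⁆ z∈
    ... | inj₂ z∈y with refl ← x∈⁅y⁆⇒x≡y y z∈y = Matroid.indep-⊆ (M *)
      (λ {w} w∈D → ∈∪⁅⁆⁻ ⁅ x ⁆ (D⊆ w∈D) λ { refl → z∉D w∈D }) (single x∈E)
    ... | inj₁ z∈x with refl ← x∈⁅y⁆⇒x≡y x z∈x = Matroid.indep-⊆ (M *)
      (λ {w} w∈D → ∈∪⁅⁆⁻ ⁅ y ⁆ (subst (w ∈_) (∪-comm ⁅ x ⁆ ⁅ y ⁆) (D⊆ w∈D)) λ { refl → z∉D w∈D }) (single y∈E)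

  ∣E∣ : ∀ {B} → Base M B → ∣ E M ∣ ≡ ∣ B ∣ + ∣ E M ─ B ∣
  ∣E∣ {B} bB = trans (∣p∣-split (E M) B) (cong (λ p → ∣ p ∣ + ∣ E M ─ B ∣)
    (⊆-antisym (p∩q⊆q (E M) B) (λ x∈B → x∈p∩q⁺ (indep⊆E (proj₁ bB) x∈B , x∈B))))

  nullity : ∀ {A B} → Base M A → Base M B → ∣ E M ─ A ∣ ≡ ∣ E M ─ B ∣
  nullity {A} {B} bA bB = ℕ.+-cancelˡ-≡ ∣ B ∣ _ _
    (trans (cong (_+ ∣ E M ─ A ∣) (base-size bB bA)) (trans (sym (∣E∣ bA)) (∣E∣ bB)))

  -- For distinct circuits `C` and `D` some base avoids a point of `C` outside `D`. It also misses a
  -- point of `D`, since it cannot contain the circuit.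
  nullity≥2 : ∀ {B} → Base M B → 2 ≤ ∣ E M ─ B ∣
  nullity≥2 {B} bB with bad-pair (proj₁ minM)
  ... | C , D , cC , cD , C≢D , _ with any? (λ x → x ∈? C ×-dec ¬? (x ∈? D))
  ...   | no ¬∃ = contradiction (circuit-⊆ cC cD (λ {x} x∈C → decidable-stable (x ∈? D) (λ x∉D → ¬∃ (x , x∈C , x∉D)))) C≢D
  ...   | yes (x , x∈C , x∉D) with coindep-⁅⁆ cC x∈C
  ...     | A , bA , x⊆ with any? (λ y → y ∈? D ×-dec ¬? (y ∈? A))
  ...       | no ¬∃ = contradiction (Matroid.indep-⊆ M
                (λ {y} y∈D → decidable-stable (y ∈? A) (λ y∉A → ¬∃ (y , y∈D , y∉A))) (proj₁ bA)) (proj₁ (proj₂ cD))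
  ...       | yes (y , y∈D , y∉A) = subst (2 ≤_) (nullity bA bB)
                (subst (_≤ ∣ E M ─ A ∣) (∣⁅x⁆∪⁅y⁆∣ {x = x} {y} (λ { refl → x∉D y∈D }))
                  (p⊆q⇒∣p∣≤∣q∣ (∪-⊆ x⊆ (⁅⁆-⊆ (x∈p∧x∉q⇒x∈p─q (proj₁ cD y∈D) y∉A)))))

  -- Each pair of elements avoids a base, and with nullity 2 that base is the whole complement of
  -- the pair. A set of at most `∣ B ∣` elements misses some pair and lies in such a base.
  nullity-2⇒uniform : ∀ {B} → Base M B → ∣ E M ─ B ∣ ≡ 2 → IsUniform ∣ B ∣ M
  nullity-2⇒uniform {B} bB null = record
    { indep⇔ = λ I⊆E → mk⇔ (base-max bB) (small I⊆E)
    ; size = size }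
    where
    size : ∣ E M ∣ ≡ ∣ B ∣ + 2
    size = trans (∣E∣ bB) (cong (∣ B ∣ +_) null)

    small : ∀ {I} → I ⊆ E M → ∣ I ∣ ≤ ∣ B ∣ → Indep M I
    small {I} I⊆E I≤B
      with ∃∈─ I (E M) (ℕ.≤-trans (s≤s I≤B) (subst (suc ∣ B ∣ ≤_) (sym (trans size (ℕ.+-comm ∣ B ∣ 2))) (ℕ.n≤1+n _)))
    ... | x , x∈E , x∉I
      with ∃∈─ (I ∪ ⁅ x ⁆) (E M) (subst₂ _≤_ (cong suc (sym (∣p∪⁅x⁆∣ I x∉I))) (sym (trans size (ℕ.+-comm ∣ B ∣ 2))) (s≤s (s≤s I≤B)))
    ...   | y , y∈E , y∉I+x with coindep-pair x∈E y∈E (λ { refl → y∉I+x (∈∪⁅⁆ I x) })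
    ...     | A , bA , xy⊆ = Matroid.indep-⊆ M I⊆A (proj₁ bA)
      where
      E-xy : Subset n
      E-xy = E M - x - y

      y∈E-x : y ∈ E M - x
      y∈E-x = x∈p∧x≢y⇒x∈p-y y∈E (λ { refl → y∉I+x (∈∪⁅⁆ I x) })

      E-xy≤A : ∣ E-xy ∣ ≤ ∣ A ∣
      E-xy≤A = ℕ.≤-reflexive (trans (ℕ.suc-injective (ℕ.suc-injective
        (trans (cong suc (sym (∣p-x∣ (E M - x) y∈E-x))) (trans (sym (∣p-x∣ (E M) x∈E)) (trans size (ℕ.+-comm ∣ B ∣ 2))))))
        (base-size bB bA))

      A⊆E-xy : A ⊆ E-xy
      A⊆E-xy z∈A = x∈p∧x≢y⇒x∈p-y (x∈p∧x≢y⇒x∈p-y (indep⊆E (proj₁ bA) z∈A)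
        (λ { refl → x∈p─q⇒x∉q (E M) A (xy⊆ (p⊆p∪q ⁅ y ⁆ (x∈⁅x⁆ x))) z∈A }))
        (λ { refl → x∈p─q⇒x∉q (E M) A (xy⊆ (∈∪⁅⁆ ⁅ x ⁆ y)) z∈A })

      I⊆A : I ⊆ A
      I⊆A z∈I = subst (_ ∈_) (sym (⊆∧∣∣≤⇒≡ A⊆E-xy E-xy≤A)) (x∈p∧x≢y⇒x∈p-y (x∈p∧x≢y⇒x∈p-y (I⊆E z∈I)
        (λ { refl → x∉I z∈I })) (λ { refl → y∉I+x (p⊆p∪q ⁅ x ⁆ z∈I) }))

  uniform⇒2≤ : ∀ {k} → IsUniform k M → 2 ≤ k
  uniform⇒2≤ {k} unif with bad-pair (proj₁ minM)
  ... | C , D , cC , cD , C≢D , (w , w∈) , ¬c = go k refl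
    where
    open UniformProperties unif

    rest : ∀ {C D} → Circuit M C → Circuit M D → (∀ {y} → y ∈ E M → y ∉ D → y ∈ C) → ∣ C ─ D ∣ ≡ 1
    rest {C} {D} cC cD cov = ℕ.+-cancelˡ-≡ ∣ D ∣ _ _ (trans
      (sym (trans (∣p∣-split (E M) D) (cong₂ _+_ (cong ∣_∣ (⊆-antisym (p∩q⊆q (E M) D) (λ x∈D → x∈p∩q⁺ (proj₁ cD x∈D , x∈D))))
        (cong ∣_∣ (⊆-antisym (λ x∈ → x∈p∧x∉q⇒x∈p─q (cov (p─q⊆p (E M) D x∈) (x∈p─q⇒x∉q (E M) D x∈)) (x∈p─q⇒x∉q (E M) D x∈))
          (λ x∈ → x∈p∧x∉q⇒x∈p─q (proj₁ cC (p─q⊆p C D x∈)) (x∈p─q⇒x∉q C D x∈)))))))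
      (trans (IsUniform.size unif) (trans (ℕ.+-suc k 1) (cong (_+ 1) (sym (circuit-size⁻ cD))))))

    C─D : ∣ C ─ D ∣ ≡ 1
    C─D = rest cC cD (cover cC cD C≢D (w , w∈) ¬c)

    D─C : ∣ D ─ C ∣ ≡ 1
    D─C = rest cD cC (cover cD cC (C≢D ∘ sym) (w , subst (w ∈_) (∩-comm C D) w∈)
      (¬c ∘ subst (Circuit M) (△-comm D C)))

    C∩D : ∣ C ∩ D ∣ ≡ k
    C∩D = ℕ.suc-injective (trans (trans (ℕ.+-comm 1 ∣ C ∩ D ∣) (trans (cong (∣ C ∩ D ∣ +_) (sym C─D)) (sym (∣p∣-split C D)))) (circuit-size⁻ cC))

    C△D : ∣ C △ D ∣ ≡ 2
    C△D = trans (∣p∣-split (C △ D) C) (cong₂ _+_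
      (trans (cong ∣_∣ (⊆-antisym
        (λ x∈ → let x∈△ , x∈C = x∈p∩q⁻ (C △ D) C x∈ in x∈p∧x∉q⇒x∈p─q x∈C (λ x∈D → ∉△ C D x∈C x∈D x∈△))
        (λ x∈ → let x∈C = p─q⊆p C D x∈ in x∈p∩q⁺ (∈△⁺ˡ C D x∈C (x∈p─q⇒x∉q C D x∈) , x∈C)))) C─D)
      (trans (cong ∣_∣ (⊆-antisym
        (λ x∈ → let x∉C = x∈p─q⇒x∉q (C △ D) C x∈ in x∈p∧x∉q⇒x∈p─q
          (in-D x∉C (∈△⁻ C D (p─q⊆p (C △ D) C x∈))) x∉C)
        (λ x∈ → let x∉C = x∈p─q⇒x∉q D C x∈ in x∈p∧x∉q⇒x∈p─q (∈△⁺ʳ C D x∉C (p─q⊆p D C x∈)) x∉C))) D─C))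
      where
      in-D : ∀ {x} → x ∉ C → (x ∈ C × x ∉ D) ⊎ (x ∉ C × x ∈ D) → x ∈ D
      in-D x∉C (inj₁ (x∈C , _)) = contradiction x∈C x∉C
      in-D x∉C (inj₂ (_ , x∈D)) = x∈D

    -- A violating pair covers `E M`, which forces `∣ C ∩ D ∣ ≡ k` and `∣ C △ D ∣ ≡ 2`. So `k = 0`
    -- contradicts the common element, and for `k = 1` the difference has circuit size.
    go : ∀ l → l ≡ k → 2 ≤ k
    go zero refl with () ← subst (0 <_) C∩D (ℕ.≤-trans (ℕ.≤-reflexive (sym (∣⁅x⁆∣≡1 w))) (p⊆q⇒∣p∣≤∣q∣ (⁅⁆-⊆ w∈)))
    go (suc zero) refl = contradiction (circuit-size⁺ (△-⊆ (proj₁ cC) (proj₁ cD)) C△D) ¬c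
    go (suc (suc _)) refl = s≤s (s≤s z≤n)

-- Binary representations

dot-comb : (W : Fin m → Subset k) (a : Subset m) (u : Subset k) →
  dot (comb W a) u ≡ dot a (tabulate (λ j → dot (W j) u))
dot-comb W []      u = dot-⊥ˡ u
dot-comb W (b ∷ a) u = trans (dot-△ˡ (scale b (W zero)) (comb (W ∘ suc) a) u)
  (cong₂ _xor_ (dot-scaleˡ b (W zero) u) (dot-comb (W ∘ suc) a u))

dot-true : (a u : Subset k) → dot a u ≡ true → ∃ λ j → lookup a j ≡ true × lookup u j ≡ true
dot-true [] [] ()
dot-true (b ∷ a) (c ∷ u) eq with b in b≡ | c in c≡
... | true  | true  = zero , refl , refl
... | true  | false = let j , aj , uj = dot-true a u eq in suc j , aj , uj
... | false | _     = let j , aj , uj = dot-true a u eq in suc j , aj , uj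

all-false⇒⊥ : (a : Subset k) → (∀ j → lookup a j ≡ false) → a ≡ ⊥
all-false⇒⊥ a eq = lookup-ext λ j → trans (eq j) (sym (lookup-⊥ j))

-- Separated is linear independence (see Free⇔Separated), so this says that V
-- is a spanning representation of M * over GF(2).
record Represents (M : Matroid n) (V : Fin n → Subset k) : Set where
  field
    indep⇔ : ∀ {I} → I ⊆ E M → Indep (M *) I ⇔ Separated V I
    spans  : ∀ a → (∀ {x} → x ∈ E M → dot a (V x) ≡ false) → a ≡ ⊥

module Represented {M : Matroid n} {V : Fin n → Subset k} (rep : Represents M V) where
  open Matroid M using (indep⊆E)
  open MatroidProperties M
  open Represents rep

  supp? : ∀ a → Decidable (λ x → x ∈ E M × dot a (V x) ≡ true)
  supp? a x = x ∈? E M ×-dec dot a (V x) Bool.≟ true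

  supp : Subset k → Subset n
  supp a = ⟪ supp? a ⟫

  ∈supp⁺ : ∀ a {x} → x ∈ E M → dot a (V x) ≡ true → x ∈ supp a
  ∈supp⁺ a x∈E ax = ∈⟪⟫⁺ (supp? a) (x∈E , ax)

  ∈supp⁻ : ∀ a {x} → x ∈ supp a → x ∈ E M × dot a (V x) ≡ true
  ∈supp⁻ a = ∈⟪⟫⁻ (supp? a)

  ∉supp : ∀ a {x} → x ∈ E M → x ∉ supp a → dot a (V x) ≡ false
  ∉supp a x∈E x∉ = Bool.¬-not (λ ax → x∉ (∈supp⁺ a x∈E ax))

  supp-△ : ∀ a b → supp (a △ b) ≡ supp a △ supp b
  supp-△ a b = ⊆-antisym to from
    where
    to : supp (a △ b) ⊆ supp a △ supp b
    to {x} x∈ with ∈supp⁻ (a △ b) x∈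
    ... | x∈E , abx with x ∈? supp a | x ∈? supp b
    ...   | yes x∈a | no x∉b = ∈△⁺ˡ (supp a) (supp b) x∈a x∉b
    ...   | no x∉a | yes x∈b = ∈△⁺ʳ (supp a) (supp b) x∉a x∈b
    ...   | yes x∈a | yes x∈b with () ← trans (sym abx) (trans (dot-△ˡ a b (V x))
              (cong₂ _xor_ (proj₂ (∈supp⁻ a x∈a)) (proj₂ (∈supp⁻ b x∈b))))
    ...   | no x∉a | no x∉b with () ← trans (sym abx) (trans (dot-△ˡ a b (V x))
              (cong₂ _xor_ (∉supp a x∈E x∉a) (∉supp b x∈E x∉b)))

    from : supp a △ supp b ⊆ supp (a △ b)
    from {x} x∈ with ∈△⁻ (supp a) (supp b) x∈
    ... | inj₁ (x∈a , x∉b) = let x∈E , ax = ∈supp⁻ a x∈a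
            in ∈supp⁺ (a △ b) x∈E (trans (dot-△ˡ a b (V x)) (cong₂ _xor_ ax (∉supp b x∈E x∉b)))
    ... | inj₂ (x∉a , x∈b) = let x∈E , bx = ∈supp⁻ b x∈b
            in ∈supp⁺ (a △ b) x∈E (trans (dot-△ˡ a b (V x)) (cong₂ _xor_ (∉supp a x∈E x∉a) bx))

  coindep⇒free : ∀ {I} → Coindep I → Free V I
  coindep⇒free {I} co@(B , _ , I⊆) =
    Equivalence.from (Free⇔Separated V) (Equivalence.to (indep⇔ (p─q⊆p (E M) B ∘ I⊆)) co)

  free⇒coindep : ∀ {I} → I ⊆ E M → Free V I → Coindep I
  free⇒coindep I⊆E free = Equivalence.from (indep⇔ I⊆E) (Equivalence.to (Free⇔Separated V) free)

  spanned-zero : ∀ {a J u} → (∀ {x} → x ∈ J → dot a (V x) ≡ false) → Spanned V J u → dot a u ≡ false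
  spanned-zero {a} zeros (C , C⊆J , refl) = dot-comb-zero V a C (zeros ∘ C⊆J)

  spanned-∈ : ∀ {J x} → x ∈ J → Spanned V J (V x)
  spanned-∈ {x = x} x∈J = ⁅ x ⁆ , ⁅⁆-⊆ x∈J , comb-⁅⁆ V x

  maximal-spans : ∀ {X J} → X ⊆ E M → J ⊆ X → Coindep J →
    (∀ K → Coindep K × K ⊆ X → J ⊆ K → K ≡ J) → ∀ {x} → x ∈ X → Spanned V J (V x)
  maximal-spans {X} {J} X⊆E J⊆X co max {x} x∈X = decidable-stable (Spanned? V J (V x)) λ ¬span →
    ¬span (spanned-∈ (subst (x ∈_) (max (J ∪ ⁅ x ⁆)
      (free⇒coindep (X⊆E ∘ J+x⊆X) (Free-∪⁅⁆ (coindep⇒free co) ¬span) , J+x⊆X) (p⊆p∪q ⁅ x ⁆)) (∈∪⁅⁆ J x)))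
    where
    J+x⊆X : J ∪ ⁅ x ⁆ ⊆ X
    J+x⊆X = ∪-⊆ J⊆X (⁅⁆-⊆ x∈X)

  -- If `C` were inside a base `B`, then `a` would vanish on the complement of `B`. That complement
  -- is a maximal coindependent set, so its vectors span all the others and `a` would be zero.
  supp-dep : ∀ {a C} → a ≢ ⊥ → supp a ⊆ C → ¬ Indep M C
  supp-dep {a} {C} a≢⊥ a⊆C iC with base-⊇ iC
  ... | B , (iB , maxB) , C⊆B = a≢⊥ (spans a zeros)
    where
    max : ∀ K → Coindep K × K ⊆ E M → E M ─ B ⊆ K → K ≡ E M ─ B
    max K ((T , (iT , maxT) , K⊆) , _) E-B⊆K = ⊆-antisym
      (λ x∈K → subst (λ S → _ ∈ E M ─ S) (sym (maxT B iB T⊆B)) (K⊆ x∈K)) E-B⊆K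
      where
      T⊆B : T ⊆ B
      T⊆B {x} x∈T with x ∈? B
      ... | yes x∈B = x∈B
      ... | no x∉B = contradiction x∈T (x∈p─q⇒x∉q (E M) T (K⊆ (E-B⊆K (x∈p∧x∉q⇒x∈p─q (indep⊆E iT x∈T) x∉B))))

    zeros : ∀ {x} → x ∈ E M → dot a (V x) ≡ false
    zeros x∈E = spanned-zero {a} {E M ─ B}
      (λ y∈ → ∉supp a (p─q⊆p (E M) B y∈) (λ y∈a → x∈p─q⇒x∉q (E M) B y∈ (C⊆B (a⊆C y∈a))))
      (maximal-spans ⊆-refl (p─q⊆p (E M) B) (B , (iB , maxB) , ⊆-refl) max x∈E)

  -- `J` is maximal coindependent outside `C`. If it spanned every vector, a base disjoint from `J`
  -- would have to contain `C`. A vector it does not span yields a functional that vanishes on `J`,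
  -- hence on everything outside `C`.
  dep⇒supp : ∀ {C} → C ⊆ E M → ¬ Indep M C → ∃ λ a → a ≢ ⊥ × supp a ⊆ C
  dep⇒supp {C} C⊆E ¬iC
    with maximal {P = λ J → Coindep J × J ⊆ E M ─ C} (λ J → Coindep? J ×-dec J ⊆? (E M ─ C))
      (Matroid.⊥-indep (M *) , ⊥⊆)
  ... | J , (co@(B , bB , J⊆E-B) , J⊆E-C) , _ , max with any? (λ x → x ∈? E M ×-dec ¬? (Spanned? V J (V x)))
  ...   | no ¬∃ = contradiction (Matroid.indep-⊆ M C⊆B (proj₁ bB)) ¬iC
    where
    C⊆B : C ⊆ B
    C⊆B {x} x∈C with x ∈? B
    ... | yes x∈B = x∈B
    ... | no x∉B = ⊥-elim (¬∃ (x , C⊆E x∈C , unspanned))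
      where
      unspanned : ¬ Spanned V J (V x)
      unspanned span with Equivalence.to (indep⇔ (∪-⊆ (p─q⊆p (E M) B ∘ J⊆E-B) (⁅⁆-⊆ (C⊆E x∈C))))
        (B , bB , ∪-⊆ J⊆E-B (⁅⁆-⊆ (x∈p∧x∉q⇒x∈p─q (C⊆E x∈C) x∉B))) (∈∪⁅⁆ J x)
      ... | a , ax , zeros with () ← trans (sym ax) (spanned-zero {a}
        (λ y∈J → zeros (p⊆p∪q ⁅ x ⁆ y∈J) (λ { refl → x∈p─q⇒x∉q (E M) C (J⊆E-C y∈J) x∈C })) span)
  ...   | yes (x , x∈E , ¬span) with fredholm V J (V x)
  ...     | inj₁ span = contradiction span ¬span
  ...     | inj₂ (a , zeros , ax) = a , a≢⊥ , a⊆C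
    where
    a≢⊥ : a ≢ ⊥
    a≢⊥ refl with () ← trans (sym ax) (dot-⊥ˡ (V x))

    a⊆C : supp a ⊆ C
    a⊆C {y} y∈a with y ∈? C
    ... | yes y∈C = y∈C
    ... | no y∉C with ∈supp⁻ a y∈a
    ...   | y∈E , ay with () ← trans (sym ay) (spanned-zero {a} zeros
      (maximal-spans (p─q⊆p (E M) C) J⊆E-C co max (x∈p∧x∉q⇒x∈p─q y∈E y∉C)))

  Point : Set
  Point = Element M

  _≟ᴾ_ : (x y : Point) → Dec (x ≡ y)
  (x , x∈) ≟ᴾ (y , y∈) with x Fin.≟ y
  ... | yes x≡y = yes (Element-≡ x≡y)
  ... | no x≢y = no (x≢y ∘ cong proj₁)

  some-point? : {P : Point → Set} → Decidable P → Dec (∃ P)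
  some-point? {P} P? with any? dec
    where
    dec : Decidable (λ x → ∃ λ (x∈ : x ∈ E M) → P (x , x∈))
    dec x with x ∈? E M
    ... | no x∉ = no (x∉ ∘ proj₁)
    ... | yes x∈ with P? (x , x∈)
    ...   | yes h = yes (x∈ , h)
    ...   | no ¬h = no λ { (x∈′ , h) → ¬h (subst (λ z → P (x , z)) (∈-irrelevant x∈′ x∈) h) }
  ... | yes (x , x∈ , h) = yes ((x , x∈) , h)
  ... | no ¬∃ = no λ { ((x , x∈) , h) → ¬∃ (x , x∈ , h) }

  ev : Subset k → Point → Bool
  ev a (x , _) = dot a (V x)

  supp-⊆⁺ : ∀ {a b} → (∀ x → ev a x ≡ true → ev b x ≡ true) → supp a ⊆ supp b
  supp-⊆⁺ {a} {b} a≼b x∈ = let x∈E , ax = ∈supp⁻ a x∈ in ∈supp⁺ b x∈E (a≼b (_ , x∈E) ax)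

  supp-⊆⁻ : ∀ {a b} → supp a ⊆ supp b → ∀ x → ev a x ≡ true → ev b x ≡ true
  supp-⊆⁻ {a} {b} a⊆b (x , x∈E) ax = proj₂ (∈supp⁻ b (a⊆b (∈supp⁺ a x∈E ax)))

  faithful : ∀ {a} → (∀ x → ev a x ≡ false) → a ≡ ⊥
  faithful {a} zeros = spans a (λ x∈E → zeros (_ , x∈E))

  supp-injective : ∀ {a b} → supp a ≡ supp b → a ≡ b
  supp-injective {a} {b} eq = p△q≡⊥⇒p≡q a b (spans (a △ b) λ x∈E →
    ∉supp (a △ b) x∈E (λ x∈ → ∉⊥ (subst (_ ∈_) (trans (supp-△ a b) (trans (cong (_△ supp b) eq) (△-self (supp b)))) x∈)))

  open Functionals _≟ᴾ_ some-point? ev (λ a b x → dot-△ˡ a b (V (proj₁ x))) faithful (λ a → ∣ supp a ∣)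
    (λ {a} {b} a≼b a≢b → p⊂q⇒∣p∣<∣q∣ (⊆∧≢⇒⊂ (supp-⊆⁺ {a} {b} a≼b) (a≢b ∘ supp-injective))) public

  circ⇒circuit : ∀ {a} → Circ a → Circuit M (supp a)
  circ⇒circuit {a} (a≢⊥ , min) = proj₁ ∘ ∈supp⁻ a , supp-dep a≢⊥ ⊆-refl , λ D D⊂ →
    decidable-stable (Matroid.Indep? M D) λ ¬iD →
      let b , b≢⊥ , b⊆D = dep⇒supp (proj₁ ∘ ∈supp⁻ a ∘ proj₁ D⊂) ¬iD
      in ⊂-irref refl (⊆-⊂-trans (subst (λ c → supp c ⊆ D) (min b b≢⊥ (supp-⊆⁻ {b} {a} (proj₁ D⊂ ∘ b⊆D))) b⊆D) D⊂)

  circuit⇒circ : ∀ {C} → Circuit M C → ∃ λ a → Circ a × supp a ≡ C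
  circuit⇒circ {C} circ@(C⊆E , ¬iC , min) with dep⇒supp C⊆E ¬iC
  ... | a , a≢⊥ , a⊆C = a , (a≢⊥ , λ b b≢⊥ b≼a → supp-injective
          (trans (equal b≢⊥ (⊆-trans (supp-⊆⁺ {b} {a} b≼a) a⊆C)) (sym (equal a≢⊥ a⊆C)))) , equal a≢⊥ a⊆C
    where
    equal : ∀ {b} → b ≢ ⊥ → supp b ⊆ C → supp b ≡ C
    equal {b} b≢⊥ b⊆C = decidable-stable (supp b ≟ˢ C)
      (λ b≢C → supp-dep b≢⊥ ⊆-refl (min (supp b) (⊆∧≢⇒⊂ b⊆C b≢C)))

  circuit-supp⇒circ : ∀ {a} → Circuit M (supp a) → Circ a
  circuit-supp⇒circ {a} circ = from (circuit⇒circ circ)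
    where
    from : (∃ λ b → Circ b × supp b ≡ supp a) → Circ a
    from (b , circ-b , eq) = subst Circ (supp-injective eq) circ-b

-- Fundamental circuits and the binary representation

record FundamentalSystem (M : Matroid n) (T : Subset n) : Set where
  field
    base    : Base M T
    C       : Fin ∣ E M ─ T ∣ → Subset n
    circuit : ∀ j → Circuit M (C j)
    C⊆  : ∀ j → C j ⊆ T ∪ ⁅ element (E M ─ T) j ⁆

  b : Fin ∣ E M ─ T ∣ → Fin n
  b = element (E M ─ T)

  -- Columns of the matrix whose rows are the fundamental circuits. The rows are to span all
  -- circuits, so the columns are to represent the dual.
  vectors : Fin n → Subset ∣ E M ─ T ∣
  vectors y = tabulate (λ j → lookup (C j) y)

fundamental-system : {M : Matroid n} {T : Subset n} → Base M T → FundamentalSystem M T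
fundamental-system {M = M} {T} bT = record
  { base = bT ; C = λ j → proj₁ (fund j)
  ; circuit = λ j → proj₁ (proj₂ (fund j)) ; C⊆ = λ j → proj₁ (proj₂ (proj₂ (fund j))) }
  where
  fund : ∀ j → ∃ λ C → Circuit M C × C ⊆ T ∪ ⁅ element (E M ─ T) j ⁆ × element (E M ─ T) j ∈ C
  fund j = MatroidProperties.fundamental M bT (p─q⊆p (E M) T (element-∈ (E M ─ T) j))
    (x∈p─q⇒x∉q (E M) T (element-∈ (E M ─ T) j))

module FundamentalProperties {M : Matroid n} {T : Subset n} (system : FundamentalSystem M T) where
  open Matroid M using (indep-⊆)
  open MatroidProperties M
  open FundamentalSystem system

  -- For `y` in `D` but not in `F`, extending `D - y` from `T` gives a base inside
  -- `(T ∪ ⁅ x ⁆) - y`. The sizes agree, so it is that whole set and contains the circuit `F`.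
  circuit-unique : ∀ {x D F} → x ∉ T → Circuit M D → Circuit M F → D ⊆ T ∪ ⁅ x ⁆ → F ⊆ T ∪ ⁅ x ⁆ → D ≡ F
  circuit-unique {x} x∉T cD cF D⊆ F⊆ = ⊆-antisym (half cD cF D⊆ F⊆) (half cF cD F⊆ D⊆)
    where
    half : ∀ {D F} → Circuit M D → Circuit M F → D ⊆ T ∪ ⁅ x ⁆ → F ⊆ T ∪ ⁅ x ⁆ → D ⊆ F
    half {D} {F} cD cF D⊆ F⊆ {y} y∈D with y ∈? F
    ... | yes y∈F = y∈F
    ... | no y∉F with base-⊇-circuit cD y∈D base
    ...   | K , bK , D-y⊆K , K⊆ , y∉K = contradiction (indep-⊆ F⊆K (proj₁ bK)) (proj₁ (proj₂ cF))
      where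
      K⊆T+x-y : K ⊆ (T ∪ ⁅ x ⁆) - y
      K⊆T+x-y {z} z∈K with x∈p∪q⁻ (D - y) T (K⊆ z∈K)
      ... | inj₁ z∈D-y = let z∈D , z≢y = ∈-⁻ D z∈D-y in x∈p∧x≢y⇒x∈p-y (D⊆ z∈D) z≢y
      ... | inj₂ z∈T = x∈p∧x≢y⇒x∈p-y (p⊆p∪q ⁅ x ⁆ z∈T) λ { refl → y∉K z∈K }

      K≡ : K ≡ (T ∪ ⁅ x ⁆) - y
      K≡ = ⊆∧∣∣≤⇒≡ K⊆T+x-y (ℕ.≤-reflexive (trans
        (ℕ.suc-injective (trans (sym (∣p-x∣ (T ∪ ⁅ x ⁆) (D⊆ y∈D))) (∣p∪⁅x⁆∣ T x∉T))) (base-size base bK)))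

      F⊆K : F ⊆ K
      F⊆K {z} z∈F = subst (z ∈_) (sym K≡) (x∈p∧x≢y⇒x∈p-y (F⊆ z∈F) λ { refl → y∉F z∈F })

  b∈E : ∀ j → b j ∈ E M
  b∈E j = p─q⊆p (E M) T (element-∈ (E M ─ T) j)

  b∉T : ∀ j → b j ∉ T
  b∉T j = x∈p─q⇒x∉q (E M) T (element-∈ (E M ─ T) j)

  b∈C : ∀ j → b j ∈ C j
  b∈C j with b j ∈? C j
  ... | yes h = h
  ... | no b∉C = contradiction (indep-⊆ (λ {y} y∈C → ∈∪⁅⁆⁻ T (C⊆ j y∈C) (λ { refl → b∉C y∈C })) (proj₁ base))
          (proj₁ (proj₂ (circuit j)))

  vectors-b : ∀ j → vectors (b j) ≡ ⁅ j ⁆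
  vectors-b j = lookup-ext λ i → trans (Vec.lookup∘tabulate _ i) (at i)
    where
    at : ∀ i → lookup (C i) (b j) ≡ lookup ⁅ j ⁆ i
    at i with i Fin.≟ j
    ... | yes refl = trans (Vec.[]=⇒lookup (b∈C j)) (sym (Vec.[]=⇒lookup (x∈⁅x⁆ j)))
    ... | no i≢j = trans (lookup-∉ (C i) (λ b∈ → b∉T j (∈∪⁅⁆⁻ T (C⊆ i b∈)
            (λ eq → i≢j (sym (element-injective (E M ─ T) eq))))))
          (sym (lookup-∉ ⁅ j ⁆ (x≢y⇒x∉⁅y⁆ i≢j)))

  IsCycle : Subset n → Set
  IsCycle Z = ∃ λ a → ∀ y → lookup Z y ≡ dot a (vectors y)

  C-cycle : ∀ j → IsCycle (C j)
  C-cycle j = ⁅ j ⁆ , λ y → sym (trans (dot-⁅⁆ˡ j (vectors y)) (Vec.lookup∘tabulate _ j))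

  △-cycle : ∀ {Y Z} → IsCycle Y → IsCycle Z → IsCycle (Y △ Z)
  △-cycle {Y} {Z} (a , eqa) (c , eqc) = a △ c , λ y →
    trans (lookup-△ Y Z y) (trans (cong₂ _xor_ (eqa y) (eqc y)) (sym (dot-△ˡ a c (vectors y))))

  not-within-T : ∀ {F} → Circuit M F → ∃ λ z → z ∈ F × z ∉ T
  not-within-T {F} cF with any? (λ z → z ∈? F ×-dec ¬? (z ∈? T))
  ... | yes found = found
  ... | no ¬∃ = contradiction (indep-⊆ (λ {z} z∈F → decidable-stable (z ∈? T) (λ z∉T → ¬∃ (z , z∈F , z∉T))) (proj₁ base))
          (proj₁ (proj₂ cF))

  module _ (minM : Minimal M) (nullity≥3 : 3 ≤ ∣ E M ─ T ∣) where
    open MinimalProperties M minM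

    -- A circuit with at least two elements x, y outside T is the difference
    -- of two circuits with fewer elements outside T: with K a base containing
    -- D - x and t in T ─ K, one of them is the circuit F in K ∪ ⁅ t ⁆.
    -- As the nullity is at least 3, D and F do not cover M.
    decompose : ∀ {D x y} → Circuit M D → x ∈ D → x ∉ T → y ∈ D → y ∉ T → y ≢ x →
      ∃ λ F → Circuit M F × Circuit M (D △ F) × F ─ T ⊂ D ─ T × (D △ F) ─ T ⊂ D ─ T
    decompose {D} {x} {y} cD x∈D x∉T y∈D y∉T y≢x with base-⊇-circuit cD x∈D base
    ... | K , bK , D-x⊆K , K⊆ , x∉K with any? (λ t → t ∈? T ×-dec ¬? (t ∈? K))
    ...   | no ¬∃ = contradiction (subst (y ∈_) (sym T≡K) (D-x⊆K (x∈p∧x≢y⇒x∈p-y y∈D y≢x))) y∉T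
      where
      T≡K : T ≡ K
      T≡K = ⊆∧∣∣≤⇒≡ (λ {z} z∈T → decidable-stable (z ∈? K) (λ z∉K → ¬∃ (z , z∈T , z∉K)))
        (ℕ.≤-reflexive (base-size bK base))
    ...   | yes (t , t∈T , t∉K) with fundamental bK (Matroid.indep⊆E M (proj₁ base) t∈T) t∉K
    ...     | F , cF , F⊆ , t∈F with not-within-T cF | ∃∈─ (⁅ x ⁆ ∪ ⁅ t ⁆) (E M ─ K) (subst₂ _≤_
                (cong suc (sym (∣⁅x⁆∪⁅y⁆∣ {x = x} {t} λ { refl → x∉T t∈T }))) (nullity base bK) nullity≥3)
    ...       | u , u∈F , u∉T | z , z∈ , z∉ = F , cF , cD△F ,
                  (F─T⊆ , x , x∈p∧x∉q⇒x∈p─q x∈D x∉T , λ x∈ → x∉F (p─q⊆p F T x∈)) ,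
                  (D△F─T⊆ , u , x∈p∧x∉q⇒x∈p─q u∈D u∉T , λ h → ∉△ D F u∈D u∈F (p─q⊆p (D △ F) T h))
      where
      x∉F : x ∉ F
      x∉F x∈F = x∉K (∈∪⁅⁆⁻ K (F⊆ x∈F) λ { refl → x∉T t∈T })

      F⇒D : ∀ {w} → w ∈ F → w ∉ T → w ∈ D
      F⇒D {w} w∈F w∉T with x∈p∪q⁻ (D - x) T (K⊆ (∈∪⁅⁆⁻ K (F⊆ w∈F) λ { refl → w∉T t∈T }))
      ... | inj₁ w∈D-x = proj₁ (∈-⁻ D w∈D-x)
      ... | inj₂ w∈T = contradiction w∈T w∉T

      u∈D : u ∈ D
      u∈D = F⇒D u∈F u∉T

      cD△F : Circuit M (D △ F)
      cD△F = closed cD cF (λ { refl → x∉F x∈D })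
        (u , x∈p∩q⁺ (u∈D , u∈F)) (p─q⊆p (E M) K z∈)
        (λ z∈D → x∈p─q⇒x∉q (E M) K z∈ (D-x⊆K (x∈p∧x≢y⇒x∈p-y z∈D λ { refl → z∉ (p⊆p∪q ⁅ t ⁆ (x∈⁅x⁆ x)) })))
        (λ z∈F → x∈p─q⇒x∉q (E M) K z∈ (∈∪⁅⁆⁻ K (F⊆ z∈F) λ { refl → z∉ (∈∪⁅⁆ ⁅ x ⁆ t) }))

      F─T⊆ : F ─ T ⊆ D ─ T
      F─T⊆ w∈ = x∈p∧x∉q⇒x∈p─q (F⇒D (p─q⊆p F T w∈) (x∈p─q⇒x∉q F T w∈)) (x∈p─q⇒x∉q F T w∈)

      D△F─T⊆ : (D △ F) ─ T ⊆ D ─ T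
      D△F─T⊆ {w} w∈ with x∈p─q⇒x∉q (D △ F) T w∈ | ∈△⁻ D F (p─q⊆p (D △ F) T w∈)
      ... | w∉T | inj₁ (w∈D , _) = x∈p∧x∉q⇒x∈p─q w∈D w∉T
      ... | w∉T | inj₂ (_ , w∈F) = x∈p∧x∉q⇒x∈p─q (F⇒D w∈F w∉T) w∉T

    -- Induction on the number of elements outside `T`. With a single one, `D` is a fundamental
    -- circuit by `circuit-unique`; with more, `decompose` splits it.
    circuit-cycle : ∀ {D} → Circuit M D → IsCycle D
    circuit-cycle {D} cD = go ∣ D ─ T ∣ cD ℕ.≤-refl
      where
      go : ∀ d {D} → Circuit M D → ∣ D ─ T ∣ ≤ d → IsCycle D
      go d {D} cD D≤d with not-within-T cD
      ... | x , x∈D , x∉T with any? (λ y → y ∈? D ×-dec (¬? (y ∈? T) ×-dec ¬? (y Fin.≟ x)))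
      ...   | no ¬∃ = subst IsCycle (circuit-unique x∉T (circuit j) cD Cj⊆ D⊆) (C-cycle j)
        where
        x∈E─T : x ∈ E M ─ T
        x∈E─T = x∈p∧x∉q⇒x∈p─q (proj₁ cD x∈D) x∉T

        j : Fin ∣ E M ─ T ∣
        j = position (E M ─ T) x∈E─T

        Cj⊆ : C j ⊆ T ∪ ⁅ x ⁆
        Cj⊆ z∈ = subst (λ w → _ ∈ T ∪ ⁅ w ⁆) (element-position (E M ─ T) x∈E─T) (C⊆ j z∈)

        D⊆ : D ⊆ T ∪ ⁅ x ⁆
        D⊆ {z} z∈D with z ∈? T | z Fin.≟ x
        ... | yes z∈T | _ = p⊆p∪q ⁅ x ⁆ z∈T
        ... | no _ | yes refl = ∈∪⁅⁆ T x
        ... | no z∉T | no z≢x = contradiction (z , z∈D , z∉T , z≢x) ¬∃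
      go d {D} cD D≤d | x , x∈D , x∉T | yes (y , y∈D , y∉T , y≢x)
        with decompose cD x∈D x∉T y∈D y∉T y≢x
      go zero cD D≤d | _ | _ | F , _ , _ , F⊂D , _ = contradiction (ℕ.≤-trans (p⊂q⇒∣p∣<∣q∣ F⊂D) D≤d) λ ()
      go (suc d) {D} cD D≤d | _ | _ | F , cF , cD△F , F⊂D , D△F⊂D =
        subst IsCycle (△-cancelʳ D F) (△-cycle {D △ F} {F} (go d cD△F (less D△F⊂D)) (go d cF (less F⊂D)))
        where
        less : ∀ {p} → p ⊂ D ─ T → ∣ p ∣ ≤ d
        less p⊂ = ℕ.≤-pred (ℕ.≤-trans (p⊂q⇒∣p∣<∣q∣ p⊂) D≤d)

module Representation {M : Matroid n} {T : Subset n} (system : FundamentalSystem M T) (minM : Minimal M)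
  (nullity≥3 : 3 ≤ ∣ E M ─ T ∣) where
  open MatroidProperties M
  open FundamentalSystem system
  open FundamentalProperties system

  private
    module MP = MinimalProperties M minM

    big : ∀ {S} → Base M S → 3 ≤ ∣ E M ─ S ∣
    big bS = subst (3 ≤_) (MP.nullity base bS) nullity≥3

  -- The fundamental circuit of `x` with respect to a base disjoint from `I` meets `I` only in `x`,
  -- and as a cycle it is a functional.
  coindep⇒separated : ∀ {I} → Coindep I → Separated vectors I
  coindep⇒separated {I} (S , bS , I⊆) {x} x∈I
    with fundamental bS (p─q⊆p (E M) S (I⊆ x∈I)) (x∈p─q⇒x∉q (E M) S (I⊆ x∈I))
  ... | D , cD , D⊆ , x∈D with circuit-cycle minM nullity≥3 cD
  ...   | a , eq = a , trans (sym (eq x)) (Vec.[]=⇒lookup x∈D) , λ {y} y∈I y≢x →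
            trans (sym (eq y)) (lookup-∉ D (λ y∈D → x∈p─q⇒x∉q (E M) S (I⊆ y∈I) (∈∪⁅⁆⁻ S (D⊆ y∈D) y≢x)))

  -- Let the base `S` extend a maximal independent set `J` outside `I`, and suppose it contains some
  -- `s` of `I`. The functional of `s`, rewritten with respect to `S`, uses a fundamental circuit
  -- through `s`, whose element `x` outside `S` is not in `I`. By maximality `J ∪ ⁅ x ⁆` contains a
  -- circuit; it must be that fundamental circuit, yet it avoids `s`.
  separated⇒coindep : ∀ {I} → I ⊆ E M → Separated vectors I → Coindep I
  separated⇒coindep {I} I⊆E sep
    with maximal {P = λ J → Indep M J × J ⊆ E M ─ I} (λ J → Matroid.Indep? M J ×-dec J ⊆? (E M ─ I))
      (Matroid.⊥-indep M , ⊥⊆)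
  ... | J , (iJ , J⊆) , _ , max with base-⊇ iJ
  ...   | S , bS , J⊆S with any? (λ s → s ∈? I ×-dec s ∈? S)
  ...     | no ¬∃ = S , bS , λ {x} x∈I → x∈p∧x∉q⇒x∈p─q (I⊆E x∈I) (λ x∈S → ¬∃ (x , x∈I , x∈S))
  ...     | yes (s , s∈I , s∈S) = contradiction-at (fundamental-system bS) (sep s∈I)
    where
    module _ (system′ : FundamentalSystem M S) where
      private
        module S = FundamentalSystem system′
        module SP = FundamentalProperties system′

      cycle : ∀ j → SP.IsCycle (C j)
      cycle j = SP.circuit-cycle minM (big bS) (circuit j)

      -- The fundamental circuits of `T` are cycles with respect to `S` too, so each functional can
      -- be rewritten in the coordinates of `S`.
      translate : ∀ a → ∃ λ a′ → ∀ y → dot a (vectors y) ≡ dot a′ (S.vectors y)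
      translate a = comb (λ j → proj₁ (cycle j)) a , λ y →
        trans (cong (dot a) (Vec.tabulate-cong λ j → proj₂ (cycle j) y))
          (sym (dot-comb (λ j → proj₁ (cycle j)) a (S.vectors y)))

      impossible : ∀ {a a′} → (∀ y → dot a (vectors y) ≡ dot a′ (S.vectors y)) →
        (∀ {y} → y ∈ I → y ≢ s → dot a (vectors y) ≡ false) →
        ∀ {i} → lookup a′ i ≡ true → s ∈ S.C i → ∀ {x} → S.b i ≡ x → Coindep I
      impossible {a} {a′} same zeros {i} a′i s∈Ci {x} refl
        with circuit-in (∪-⊆ (p─q⊆p (E M) I ∘ J⊆) (⁅⁆-⊆ (SP.b∈E i))) J+x-dep
        where
        s≢x : s ≢ x
        s≢x s≡x = SP.b∉T i (subst (_∈ S) s≡x s∈S)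

        ax : dot a (vectors x) ≡ true
        ax = trans (same x) (trans (cong (dot a′) (SP.vectors-b i)) (trans (dot-⁅⁆ʳ a′ i) a′i))

        x∉I : x ∉ I
        x∉I x∈I = contradiction (trans (sym ax) (zeros x∈I (s≢x ∘ sym))) λ ()

        J+x-dep : ¬ Indep M (J ∪ ⁅ x ⁆)
        J+x-dep iJ+x = SP.b∉T i (J⊆S (subst (x ∈_) (max (J ∪ ⁅ x ⁆)
          (iJ+x , ∪-⊆ J⊆ (⁅⁆-⊆ (x∈p∧x∉q⇒x∈p─q (SP.b∈E i) x∉I))) (p⊆p∪q ⁅ x ⁆)) (∈∪⁅⁆ J x)))
      ... | D , cD , D⊆ = contradiction s∈I (x∈p─q⇒x∉q (E M) I (J⊆ (∈∪⁅⁆⁻ J (D⊆ s∈D) (λ s≡x → SP.b∉T i (subst (_∈ S) s≡x s∈S)))))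
        where
        s∈D : s ∈ D
        s∈D = subst (s ∈_) (SP.circuit-unique (SP.b∉T i) (S.circuit i) cD (S.C⊆ i)
          (∪-⊆ (p⊆p∪q ⁅ x ⁆ ∘ J⊆S) (q⊆p∪q S ⁅ x ⁆) ∘ D⊆)) s∈Ci

      contradiction-at : (∃ λ a → dot a (vectors s) ≡ true × (∀ {y} → y ∈ I → y ≢ s → dot a (vectors y) ≡ false)) →
        Coindep I
      contradiction-at (a , as , zeros) with translate a
      ... | a′ , same with dot-true a′ (S.vectors s) (trans (sym (same s)) as)
      ...   | i , a′i , s∈ = impossible {a} {a′} same (λ {y} → zeros {y}) a′i
                (Vec.lookup⇒[]= s (S.C i) (trans (sym (Vec.lookup∘tabulate _ i)) s∈)) refl

  represents : Represents M vectors
  represents = record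
    { indep⇔ = λ I⊆E → mk⇔ coindep⇒separated (separated⇒coindep I⊆E)
    ; spans = λ a zeros → all-false⇒⊥ a λ j → trans (sym (dot-⁅⁆ʳ a j))
        (trans (cong (dot a) (sym (vectors-b j))) (zeros (b∈E j))) }

-- Normal form of the dual representation

φ₀ : Subset (suc k)
φ₀ = ⁅ zero ⁆

dot-φ₀ : (x : Subset (suc k)) → dot φ₀ x ≡ lookup x zero
dot-φ₀ = dot-⁅⁆ˡ zero

-- A representation of the dual of M in which all points except e lie in the
-- affine geometry of vectors with first coordinate 1.
record NormalForm (M : Matroid n) (d : ℕ) : Set where
  field
    V          : Fin n → Subset (suc d)
    represents : Represents M V
    e          : Fin n
    e∈E        : e ∈ E M
    e-linear   : lookup (V e) zero ≡ false
    affine     : ∀ {x} → x ∈ E M → x ≢ e → lookup (V x) zero ≡ true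
    V-inj      : ∀ {x y} → x ∈ E M → y ∈ E M → V x ≡ V y → x ≡ y
    V-e≢⊥      : V e ≢ ⊥
    hits       : ∀ {α β} → α ≢ ⊥ → α ≢ φ₀ → β ≢ ⊥ → β ≢ φ₀ → β ≢ α → β ≢ α △ φ₀ →
                 ∃ λ z → z ∈ E M × z ≢ e × dot α (V z) ≡ false × dot β (V z) ≡ false

front-adjoint-injective : (φ : Subset (suc k)) (j : Fin (suc k)) (φj : lookup φ j ≡ true) →
  ∀ {a b} → Embedding.adjoint (front φ j φj) a ≡ Embedding.adjoint (front φ j φj) b → a ≡ b
front-adjoint-injective {k} φ j φj {a₀ ∷ a} {b₀ ∷ b} eq = cong₂ _∷_ heads (tails heads)
  where
  value : ∀ c (p : Subset k) → lookup (scale c φ △ insertAt p j false) j ≡ c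
  value c p = trans (lookup-△ (scale c φ) _ j) (trans (cong₂ _xor_ (at c) (Vec.insertAt-lookup p j false)) (Bool.xor-identityʳ c))
    where
    at : ∀ c → lookup (scale c φ) j ≡ c
    at true  = φj
    at false = lookup-⊥ j

  heads : a₀ ≡ b₀
  heads = trans (sym (value a₀ a)) (trans (cong (λ p → lookup p j) eq) (value b₀ b))

  tails : a₀ ≡ b₀ → a ≡ b
  tails refl = trans (sym (Vec.removeAt-insertAt a j false)) (trans (cong (λ p → removeAt p j)
    (trans (sym (△-cancelˡ (scale a₀ φ) _)) (trans (cong (scale a₀ φ △_) eq) (△-cancelˡ (scale a₀ φ) _))))
    (Vec.removeAt-insertAt b j false))

Embedding-adjoint-△ : ∀ {l} (g : Embedding k l) (a b : Subset l) →
  Embedding.adjoint g (a △ b) ≡ Embedding.adjoint g a △ Embedding.adjoint g b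
Embedding-adjoint-△ g a b = lookup-ext λ j → trans (sym (dot-⁅⁆ʳ (G.adjoint (a △ b)) j))
  (trans (sym (G.dot-to (a △ b) ⁅ j ⁆)) (trans (dot-△ˡ a b (G.to ⁅ j ⁆))
  (trans (cong₂ _xor_ (G.dot-to a ⁅ j ⁆) (G.dot-to b ⁅ j ⁆))
  (trans (sym (dot-△ˡ (G.adjoint a) (G.adjoint b) ⁅ j ⁆)) (dot-⁅⁆ʳ (G.adjoint a △ G.adjoint b) j)))))
  where
  module G = Embedding g

module Normalise {M : Matroid n} {d : ℕ} {V : Fin n → Subset (suc d)} (rep : Represents M V)
  {φ : Subset (suc d)} {j : Fin (suc d)} (φj : lookup φ j ≡ true) (e : Element M) where
  open Represented rep using (Hits)
  open Represents rep
  open Embedding (front φ j φj)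

  adjoint-inj : ∀ {a b} → adjoint a ≡ adjoint b → a ≡ b
  adjoint-inj = front-adjoint-injective φ j φj

  adjoint-⊥ : adjoint ⊥ ≡ ⊥
  adjoint-⊥ = trans (cong adjoint (sym (△-self ⊥))) (trans (Embedding-adjoint-△ (front φ j φj) ⊥ ⊥) (△-self (adjoint ⊥)))

  adjoint-φ₀ : adjoint φ₀ ≡ φ
  adjoint-φ₀ = lookup-ext λ i → trans (sym (dot-⁅⁆ʳ (adjoint φ₀) i)) (trans (sym (dot-to φ₀ ⁅ i ⁆))
    (trans (dot-φ₀ (to ⁅ i ⁆)) (dot-⁅⁆ʳ φ i)))

  normal-form : (∀ x → x ∈ E M → x ≢ proj₁ e → dot φ (V x) ≡ true) → dot φ (V (proj₁ e)) ≡ false →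
    (∀ {x y} → x ∈ E M → y ∈ E M → V x ≡ V y → x ≡ y) → V (proj₁ e) ≢ ⊥ → Hits φ e → NormalForm M d
  normal-form on off V-inj V-e≢⊥ hits = record
    { V = to ∘ V
    ; represents = record
      { indep⇔ = λ I⊆E → mk⇔ (separated⁺ V ∘ Equivalence.to (indep⇔ I⊆E)) (Equivalence.from (indep⇔ I⊆E) ∘ separated⁻ V)
      ; spans = λ a zeros → adjoint-inj (trans (spans (adjoint a) (λ x∈E → trans (sym (dot-to a _)) (zeros x∈E))) (sym adjoint-⊥)) }
    ; e = proj₁ e ; e∈E = proj₂ e ; e-linear = off ; affine = λ x∈E x≢e → on _ x∈E x≢e
    ; V-inj = λ x∈E y∈E eq → V-inj x∈E y∈E (injective eq)
    ; V-e≢⊥ = λ eq → V-e≢⊥ (injective (trans eq (sym to-⊥)))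
    ; hits = λ {α} {β} α≢⊥ α≢φ β≢⊥ β≢φ β≢α β≢α+φ →
        let (z , z∈E) , z≢e , αz , βz = hits {adjoint α} {adjoint β}
              (α≢⊥ ∘ adjoint-inj ∘ (λ eq → trans eq (sym adjoint-⊥))) (α≢φ ∘ adjoint-inj ∘ (λ eq → trans eq (sym adjoint-φ₀)))
              (β≢⊥ ∘ adjoint-inj ∘ (λ eq → trans eq (sym adjoint-⊥))) (β≢φ ∘ adjoint-inj ∘ (λ eq → trans eq (sym adjoint-φ₀)))
              (β≢α ∘ adjoint-inj)
              (β≢α+φ ∘ adjoint-inj ∘ (λ eq → trans eq (trans (cong (adjoint α △_) (sym adjoint-φ₀)) (sym (Embedding-adjoint-△ (front φ j φj) α φ₀)))))
        in z , z∈E , z≢e ∘ Element-≡ , trans (dot-to α (V z)) αz , trans (dot-to β (V z)) βz }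

module ToNormalForm {M : Matroid n} (minM : Minimal M) {d : ℕ} {V : Fin n → Subset (suc d)} (rep : Represents M V) where
  open MatroidProperties M renaming (BadPair to Difference-fails)
  open MinimalProperties M minM using (closed; coindep-pair)
  open Represents rep using (indep⇔)
  open Represented rep

  functionals-closed : Closed
  functionals-closed {a} {b} ca cb a≢b {x , x∈E} {y , y∈E} ax bx ay by = circuit-supp⇒circ
    (subst (Circuit M) (sym (supp-△ a b)) (closed (circ⇒circuit ca) (circ⇒circuit cb) (a≢b ∘ supp-injective)
      (x , x∈p∩q⁺ (∈supp⁺ a x∈E ax , ∈supp⁺ b x∈E bx)) y∈E
      (λ y∈ → clash (proj₂ (∈supp⁻ a y∈)) ay) (λ y∈ → clash (proj₂ (∈supp⁻ b y∈)) by)))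

  separate-points : ∀ {x y} → x ∈ E M → y ∈ E M → x ≢ y → ∃ λ a → dot a (V x) ≢ dot a (V y)
  separate-points {x} {y} x∈E y∈E x≢y =
    let a , ax , zeros = Equivalence.to (indep⇔ (∪-⊆ (⁅⁆-⊆ x∈E) (⁅⁆-⊆ y∈E))) (coindep-pair x∈E y∈E x≢y)
                           (p⊆p∪q ⁅ y ⁆ (x∈⁅x⁆ x))
    in a , λ eq → clash (trans (sym eq) ax) (zeros (∈∪⁅⁆ ⁅ x ⁆ y) (x≢y ∘ sym))

  open BadPair functionals-closed

  separate : ∀ {x y} → x ≢ y → ∃ λ a → ev a x ≢ ev a y
  separate {x , x∈E} {y , y∈E} x≢y = separate-points x∈E y∈E (x≢y ∘ Element-≡)

  open Separated (λ {x} {y} → separate {x} {y})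

  normal-form-of : ∀ {c₁ c₂ c₃ c₄ e} → Split c₁ c₂ c₃ c₄ e → NormalForm M d
  normal-form-of {c₁} {c₂} {c₃} {c₄} {e} s = from (Split.some-13 s)
    where
    open Shift s

    from-coordinate : (∃ λ j → lookup φ j ≡ true) → NormalForm M d
    from-coordinate (j , φj) = Normalise.normal-form rep φj e
      (λ x x∈E x≢e → ev-φ {x , x∈E} (x≢e ∘ cong proj₁)) ev-φ-e
      (λ {x} {y} x∈E y∈E eq → decidable-stable (x Fin.≟ y) (λ x≢y →
        let a , ax≢ay = separate-points x∈E y∈E x≢y in ax≢ay (cong (dot a) eq)))
      (λ eq → clash (Split.e∈c₁ s) (trans (cong (dot c₁) eq) (dot-⊥ʳ c₁)))
      (AlmostAffine.hits {φ} {e} ev-φ-e ev-φ all-circ)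

    from : ∃ (Values c₁ c₂ c₃ c₄ true false true false) → NormalForm M d
    -- A point of `c₃` lies in `φ`, so `φ` has a coordinate equal to 1 that can be exchanged for the
    -- first one.
    from (p , _ , _ , p₃ , p₄) = let j , φj , _ = dot-true φ (V (proj₁ p)) (_⊕_ {c₃} {c₄} {p} p₃ p₄) in from-coordinate (j , φj)

  normal-form : NormalForm M d
  normal-form = from (bad-pair (proj₁ minM))
    where
    from-circs : ∀ {C D x} → (∃ λ a → Circ a × supp a ≡ C) → (∃ λ b → Circ b × supp b ≡ D) →
      C ≢ D → x ∈ C → x ∈ D → ¬ Circuit M (C △ D) → NormalForm M d
    from-circs {x = x} (a , ca , refl) (b , cb , refl) a≢b x∈a x∈b ¬c =
      let x∈E , ax = ∈supp⁻ a x∈a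
          _ , bx = ∈supp⁻ b x∈b
          _ , _ , s = split-exists {a} {b} {x , x∈E} ca cb (a≢b ∘ cong supp) ax bx
            (λ circ → ¬c (subst (Circuit M) (supp-△ a b) (circ⇒circuit circ)))
      in normal-form-of s

    from : Difference-fails → NormalForm M d
    from (C , D , cC , cD , C≢D , (x , x∈) , ¬c) =
      let x∈C , x∈D = x∈p∩q⁻ C D x∈
      in from-circs (circuit⇒circ cC) (circuit⇒circ cD) C≢D x∈C x∈D ¬c

minimal⇒normal-form : {M : Matroid n} (minM : Minimal M) {T : Subset n} (bT : Base M T) →
  3 ≤ ∣ E M ─ T ∣ → ∃ λ d → NormalForm M (suc (suc d))
minimal⇒normal-form {M = M} minM {T} bT nullity≥3 = go nullity≥3 (Representation.represents (fundamental-system bT) minM nullity≥3)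
  where
  -- The nullity is generalised to `r`, so that matching on `3 ≤ r` exposes three successors in the
  -- type of the vectors.
  go : ∀ {r} {V : Fin _ → Subset r} → 3 ≤ r → Represents M V → ∃ λ d → NormalForm M (suc (suc d))
  go (s≤s (s≤s (s≤s {n = d} _))) rep = d , ToNormalForm.normal-form minM rep

-- `φ₀` and `a` span at most four functionals, and dimension 3 leaves room outside. It suffices to
-- differ from `a` in the second coordinate, which `φ₀` does not touch.
third : (a : Subset (suc (suc (suc k)))) → ∃ λ β → β ≢ ⊥ × β ≢ φ₀ × β ≢ a × β ≢ a △ φ₀
third (a₀ ∷ true ∷ a) = false ∷ false ∷ true ∷ ⊥ , (λ ()) , (λ ()) , (λ ()) , (λ ())
third (a₀ ∷ false ∷ a) = false ∷ true ∷ ⊥ , (λ ()) , (λ ()) , (λ ()) , (λ ())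

annihilator : (u : Subset (suc (suc (suc k)))) → ∃ λ b → b ≢ ⊥ × b ≢ φ₀ × dot b u ≡ false
annihilator u@(_ ∷ false ∷ _ ∷ _) = ⁅ suc zero ⁆ , (λ ()) , (λ ()) , dot-⁅⁆ˡ (suc zero) u
annihilator u@(_ ∷ true ∷ false ∷ _) = ⁅ suc (suc zero) ⁆ , (λ ()) , (λ ()) , dot-⁅⁆ˡ (suc (suc zero)) u
annihilator u@(_ ∷ true ∷ true ∷ _) = ⁅ suc zero ⁆ △ ⁅ suc (suc zero) ⁆ , (λ ()) , (λ ()) ,
  trans (dot-△ˡ ⁅ suc zero ⁆ ⁅ suc (suc zero) ⁆ u)
    (cong₂ _xor_ (dot-⁅⁆ˡ (suc zero) u) (dot-⁅⁆ˡ (suc (suc zero)) u))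

≢⊥⇒∃ : (u : Subset k) → u ≢ ⊥ → ∃ λ j → lookup u j ≡ true
≢⊥⇒∃ u u≢⊥ with any? (λ j → lookup u j Bool.≟ true)
... | yes found = found
... | no ¬∃ = contradiction (all-false⇒⊥ u λ j → Bool.¬-not (λ h → ¬∃ (j , h))) u≢⊥

module FromNormalForm {M : Matroid n} {d : ℕ} (nf : NormalForm M (suc (suc d))) where
  open NormalForm nf
  open MatroidProperties M
  open Represented represents

  private
    ẽ : Point
    ẽ = e , e∈E

    ev-e : ev φ₀ ẽ ≡ false
    ev-e = trans (dot-φ₀ (V e)) e-linear

    ev-φ₀ : ∀ {x} → x ≢ ẽ → ev φ₀ x ≡ true
    ev-φ₀ {x , x∈E} x≢e = trans (dot-φ₀ (V x)) (affine x∈E (x≢e ∘ Element-≡))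

  all-circ : ∀ {a} → a ≢ ⊥ → a ≢ φ₀ → Circ a
  all-circ = AlmostAffine.all-circ {φ₀} {ẽ} ev-e ev-φ₀ third
    (λ α≢⊥ α≢φ β≢⊥ β≢φ β≢α β≢α+φ → let z , z∈E , z≢e , αz , βz = hits α≢⊥ α≢φ β≢⊥ β≢φ β≢α β≢α+φ
      in (z , z∈E) , z≢e ∘ cong proj₁ , αz , βz)

  φ₀-not-circ : ¬ Circ φ₀
  φ₀-not-circ (_ , min) =
    let b , b≢⊥ , b≢φ , be = annihilator (V e)
    in b≢φ (min b b≢⊥ (λ x bx → ev-φ₀ {x} (λ { refl → clash bx be })))

  -- A functional `a` that is 1 at `e` and its translate `a △ φ₀` are circuits sharing `e`. Their
  -- sum is `φ₀`, which is not a circuit, for it lies above every functional that vanishes at `e`.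
  not-circuit-difference : ¬ CircuitDifference M
  not-circuit-difference cd = from (≢⊥⇒∃ (V e) V-e≢⊥)
    where
    from : (∃ λ j → lookup (V e) j ≡ true) → _
    from (j , ej) = φ₀-not-circ (circuit-supp⇒circ (subst (Circuit M)
      (trans (sym (supp-△ a a′)) (cong supp (△-cancelˡ a φ₀)))
      (cd (supp a) (supp a′) (circ⇒circuit (all-circ (nonzero {a} {ẽ} ae) (differ {a} {φ₀} {ẽ} ae ev-e)))
        (circ⇒circuit (all-circ (nonzero {a′} {ẽ} ae′) (differ {a′} {φ₀} {ẽ} ae′ ev-e)))
        (a≢a′ ∘ supp-injective)
        (e , x∈p∩q⁺ (∈supp⁺ a e∈E ae , ∈supp⁺ a′ e∈E ae′)))))
      where
      a a′ : Subset (suc (suc (suc d)))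
      a = ⁅ j ⁆
      a′ = a △ φ₀

      ae : dot a (V e) ≡ true
      ae = trans (dot-⁅⁆ˡ j (V e)) ej

      ae′ : dot a′ (V e) ≡ true
      ae′ = trans (dot-△ˡ a φ₀ (V e)) (cong₂ _xor_ ae ev-e)

      a≢a′ : a ≢ a′
      a≢a′ eq = contradiction (trans (sym (△-cancelˡ a φ₀)) (trans (cong (a △_) (sym eq)) (△-self a))) λ ()

  is-e : ∀ {z} → z ∈ E M → dot φ₀ (V z) ≡ false → z ≡ e
  is-e {z} z∈E φz = decidable-stable (z Fin.≟ e) (λ z≢e → clash (trans (dot-φ₀ (V z)) (affine z∈E z≢e)) φz)

  -- The only sum to fear is `φ₀`. It vanishes at `x`, where both functionals are 1, and at `y`,
  -- where both are 0; but `e` is its only zero in `E M`, so `x` and `y` would coincide.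
  △-circuit : ∀ {C D x y} → (∃ λ a → Circ a × supp a ≡ C) → (∃ λ b → Circ b × supp b ≡ D) →
    C ≢ D → x ∈ C → x ∈ D → y ∈ E M → y ∉ C → y ∉ D → Circuit M (C △ D)
  △-circuit {x = x} {y} (a , _ , refl) (b , _ , refl) a≢b x∈a x∈b y∈E y∉a y∉b =
    subst (Circuit M) (supp-△ a b) (circ⇒circuit (all-circ (△-≢⊥ (a≢b ∘ cong supp)) a+b≢φ))
    where
    φ-at : ∀ {z c} → a △ b ≡ φ₀ → dot a (V z) ≡ c → dot b (V z) ≡ c → dot φ₀ (V z) ≡ false
    φ-at {z} {c} eq az bz = trans (cong (λ f → dot f (V z)) (sym eq))
      (trans (dot-△ˡ a b (V z)) (trans (cong₂ _xor_ az bz) (Bool.xor-same c)))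

    a+b≢φ : a △ b ≢ φ₀
    a+b≢φ eq = y∉a (subst (_∈ supp a) (trans
      (is-e (proj₁ (∈supp⁻ a x∈a)) (φ-at eq (proj₂ (∈supp⁻ a x∈a)) (proj₂ (∈supp⁻ b x∈b))))
      (sym (is-e y∈E (φ-at eq (∉supp a y∈E y∉a) (∉supp b y∈E y∉b))))) x∈a)

  normal-form⇒minimal : Minimal M
  normal-form⇒minimal = not-circuit-difference , deletion , cosimple
    where
    deletion : ∀ {y} → y ∈ E M → CircuitDifference (M ╲ ⁅ y ⁆)
    deletion {y} y∈E C D cC cD C≢D (x , x∈) =
      let cC′ , C⊆ = restrict-circuit⁻ cC ; cD′ , D⊆ = restrict-circuit⁻ cD ; x∈C , x∈D = x∈p∩q⁻ C D x∈
      in restrict-circuit⁺ (△-circuit (circuit⇒circ cC′) (circuit⇒circ cD′) C≢D x∈C x∈D y∈E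
           (λ y∈C → x∈∁p⇒x∉p (C⊆ y∈C) (x∈⁅x⁆ y)) (λ y∈D → x∈∁p⇒x∉p (D⊆ y∈D) (x∈⁅x⁆ y)))
           (△-⊆ C⊆ D⊆)

    V≢⊥ : ∀ {x} → x ∈ E M → V x ≢ ⊥
    V≢⊥ {x} x∈E eq with x Fin.≟ e
    ... | yes refl = V-e≢⊥ eq
    ... | no x≢e = clash (affine x∈E x≢e) (trans (cong (λ p → lookup p zero) eq) (lookup-⊥ {suc (suc (suc d))} zero))

    separator : ∀ {x y} → x ∈ E M → y ∈ E M → x ≢ y → ∃ λ a → dot a (V x) ≡ true × dot a (V y) ≡ false
    separator {x} {y} x∈E y∈E x≢y with fredholm V ⁅ y ⁆ (V x)
    ... | inj₂ (a , zeros , ax) = a , ax , zeros (x∈⁅x⁆ y)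
    ... | inj₁ (C , C⊆ , eq) with y ∈? C
    ...   | yes y∈C = contradiction (V-inj x∈E y∈E (trans (sym eq) (trans (cong (comb V) (⊆-antisym C⊆ (⁅⁆-⊆ y∈C))) (comb-⁅⁆ V y)))) x≢y
    ...   | no y∉C = contradiction (trans (sym eq) (trans (cong (comb V) (⊆-antisym
              (λ {z} z∈C → contradiction (subst (_∈ C) (x∈⁅y⁆⇒x≡y y (C⊆ z∈C)) z∈C) y∉C) ⊥⊆)) (comb-⊥ V))) (V≢⊥ x∈E)

    cosimple : ∀ {x y} → x ≢ y → ¬ Circuit (M *) (⁅ x ⁆ ∪ ⁅ y ⁆)
    cosimple {x} {y} x≢y (xy⊆E , ¬co , _) = ¬co (Equivalence.from (Represents.indep⇔ represents xy⊆E) sep)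
      where
      x∈E : x ∈ E M
      x∈E = xy⊆E (p⊆p∪q ⁅ y ⁆ (x∈⁅x⁆ x))

      y∈E : y ∈ E M
      y∈E = xy⊆E (∈∪⁅⁆ ⁅ x ⁆ y)

      sep : Separated V (⁅ x ⁆ ∪ ⁅ y ⁆)
      sep {z} z∈ with x∈p∪q⁻ ⁅ x ⁆ ⁅ y ⁆ z∈
      ... | inj₁ z∈x with refl ← x∈⁅y⁆⇒x≡y x z∈x = let a , ax , ay = separator x∈E y∈E x≢y
              in a , ax , λ w∈ w≢x → trans (cong (λ w → dot a (V w)) (x∈⁅y⁆⇒x≡y y (other w∈ w≢x))) ay
        where
        other : ∀ {w} → w ∈ ⁅ x ⁆ ∪ ⁅ y ⁆ → w ≢ x → w ∈ ⁅ y ⁆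
        other w∈ w≢x = ∈∪⁅⁆⁻ ⁅ y ⁆ (subst (_ ∈_) (∪-comm ⁅ x ⁆ ⁅ y ⁆) w∈) w≢x
      ... | inj₂ z∈y with refl ← x∈⁅y⁆⇒x≡y y z∈y = let a , ay , ax = separator y∈E x∈E (x≢y ∘ sym)
              in a , ay , λ w∈ w≢y → trans (cong (λ w → dot a (V w)) (x∈⁅y⁆⇒x≡y x (∈∪⁅⁆⁻ ⁅ x ⁆ w∈ w≢y))) ax

-- Affine geometries

element-bijection : (M : Matroid m) (N : Matroid n) (t : Fin m → Fin n) → (∀ {x} → x ∈ E M → t x ∈ E N) →
  (∀ {x y} → x ∈ E M → y ∈ E M → t x ≡ t y → x ≡ y) → (∀ {y} → y ∈ E N → ∃ λ x → x ∈ E M × t x ≡ y) →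
  Element M ↔ Element N
element-bijection M N t into inj onto = mk↔ₛ′ (λ (x , x∈) → t x , into x∈)
  (λ (y , y∈) → proj₁ (onto y∈) , proj₁ (proj₂ (onto y∈)))
  (λ (y , y∈) → Element-≡ (proj₂ (proj₂ (onto y∈))))
  (λ (x , x∈) → Element-≡ (inj (proj₁ (proj₂ (onto (into x∈)))) x∈ (proj₂ (proj₂ (onto (into x∈))))))

≅-sym : {M : Matroid m} {N : Matroid n} → M ≅ N → N ≅ M
≅-sym {M = M} {N} iso = record
  { bijection = mk↔ₛ′ f.from f.to f.strictlyInverseʳ f.strictlyInverseˡ
  ; preserves = λ {I} {J} I⊆ J⊆ corr →
      let p = _≅_.preserves iso J⊆ I⊆ λ x → mk⇔
                (λ x∈J → Equivalence.from (corr (f.to x)) (subst (λ z → proj₁ z ∈ J) (sym (f.strictlyInverseʳ x)) x∈J))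
                (λ fx∈I → subst (λ z → proj₁ z ∈ J) (f.strictlyInverseʳ x) (Equivalence.to (corr (f.to x)) fx∈I))
      in mk⇔ (Equivalence.from p) (Equivalence.to p) }
  where
  module f = Inverse (_≅_.bijection iso)

module _ {M : Matroid m} {N : Matroid n} (f : Element M ↔ Element N)
  {V : Fin m → Subset k} {W : Fin n → Subset k} (same : ∀ x → W (proj₁ (Inverse.to f x)) ≡ V (proj₁ x)) where
  private
    module f = Inverse f

  separated-transport : ∀ {I J} → I ⊆ E M → J ⊆ E N → Corresponds M N f I J → Separated V I ⇔ Separated W J
  separated-transport {I} {J} I⊆ J⊆ corr = mk⇔ there′ back
    where
    there′ : Separated V I → Separated W J
    there′ sep {y} y∈J =
      let a , ax , zeros = sep {proj₁ (f.from (y , J⊆ y∈J))} (in-I y∈J)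
      in a , trans (cong (dot a) (W-from y∈J)) ax , λ {w} w∈J w≢y → trans (cong (dot a) (W-from w∈J))
           (zeros (in-I w∈J) (λ eq → w≢y (cong proj₁ (trans (sym (f.strictlyInverseˡ (w , J⊆ w∈J)))
             (trans (cong f.to (Element-≡ eq)) (f.strictlyInverseˡ (y , J⊆ y∈J)))))))
      where
      in-I : ∀ {y} (y∈J : y ∈ J) → proj₁ (f.from (y , J⊆ y∈J)) ∈ I
      in-I {y} y∈J = Equivalence.from (corr (f.from (y , J⊆ y∈J)))
        (subst (λ z → proj₁ z ∈ J) (sym (f.strictlyInverseˡ (y , J⊆ y∈J))) y∈J)

      W-from : ∀ {y} (y∈J : y ∈ J) → W y ≡ V (proj₁ (f.from (y , J⊆ y∈J)))
      W-from {y} y∈J = trans (cong (W ∘ proj₁) (sym (f.strictlyInverseˡ (y , J⊆ y∈J)))) (same (f.from (y , J⊆ y∈J)))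

    back : Separated W J → Separated V I
    back sep {x} x∈I =
      let a , ax , zeros = sep (Equivalence.to (corr (x , I⊆ x∈I)) x∈I)
      in a , trans (cong (dot a) (sym (same (x , I⊆ x∈I)))) ax , λ {w} w∈I w≢x →
           trans (cong (dot a) (sym (same (w , I⊆ w∈I)))) (zeros (Equivalence.to (corr (w , I⊆ w∈I)) w∈I)
             (λ eq → w≢x (cong proj₁ (trans (sym (f.strictlyInverseʳ (w , I⊆ w∈I)))
               (trans (cong f.from (Element-≡ eq)) (f.strictlyInverseʳ (x , I⊆ x∈I)))))))

record VectorRepresented (M : Matroid n) (V : Fin n → Subset k) : Set where
  constructor vector-represented
  field
    indep⇔ : ∀ {I} → I ⊆ E M → Indep M I ⇔ Separated V I

restrict-represented : {M : Matroid n} {V : Fin n → Subset k} {X : Subset n} →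
  VectorRepresented M V → VectorRepresented (M ↾ X) V
restrict-represented {M = M} {V} {X} (vector-represented indep⇔) = vector-represented λ I⊆ → mk⇔ (to I⊆) (from I⊆)
  where
  to : ∀ {I} → I ⊆ E (M ↾ X) → Indep (M ↾ X) I → Separated V I
  to I⊆ (iI , _) = Equivalence.to (indep⇔ (p∩q⊆p (E M) X ∘ I⊆)) iI

  from : ∀ {I} → I ⊆ E (M ↾ X) → Separated V I → Indep (M ↾ X) I
  from I⊆ sep = Equivalence.from (indep⇔ (p∩q⊆p (E M) X ∘ I⊆)) sep , p∩q⊆q (E M) X ∘ I⊆

embedding⇒≅ : ∀ {l} {M : Matroid m} {N : Matroid n} {V : Fin m → Subset k} {W : Fin n → Subset l} →
  VectorRepresented M V → VectorRepresented N W → (f : Element M ↔ Element N) (g : Embedding k l) →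
  (∀ x → W (proj₁ (Inverse.to f x)) ≡ Embedding.to g (V (proj₁ x))) → M ≅ N
embedding⇒≅ {M = M} {N} {V} {W} (vector-represented indepM) (vector-represented indepN) f g same = record
  { bijection = f
  ; preserves = λ I⊆ J⊆ corr →
      let t = separated-transport {M = M} {N} f {Embedding.to g ∘ V} {W} same I⊆ J⊆ corr
      in mk⇔ (Equivalence.from (indepN J⊆) ∘ Equivalence.to t ∘ Embedding.separated⁺ g V ∘ Equivalence.to (indepM I⊆))
             (Equivalence.from (indepM I⊆) ∘ Embedding.separated⁻ g V ∘ Equivalence.from t ∘ Equivalence.to (indepN J⊆)) }

first : Subset (suc k) → Bool
first u = lookup u zero

first≢⊥ : {u : Subset (suc k)} → first u ≡ true → u ≢ ⊥
first≢⊥ () refl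

module Geometry (d : ℕ) where

  V : Fin (2 ^ suc d) → Subset (suc d)
  V = vec (suc d)

  coordinate : ∀ x j → lookup (V x) j ≡ vector (suc d) x j
  coordinate x j = Vec.lookup∘tabulate (vector (suc d) x) j

  nonzero? : Decidable (λ x → ∃ λ j → vector (suc d) x j ≡ true)
  nonzero? x = any? (λ j → vector (suc d) x j Bool.≟ true)

  ∈PG⁺ : ∀ {x} → V x ≢ ⊥ → x ∈ E (PG d)
  ∈PG⁺ {x} Vx≢⊥ = let j , h = ≢⊥⇒∃ (V x) Vx≢⊥
    in x∈p∩q⁺ (∈⊤ , ∈⟪⟫⁺ nonzero? (j , trans (sym (coordinate x j)) h))

  ∈PG⁻ : ∀ {x} → x ∈ E (PG d) → V x ≢ ⊥
  ∈PG⁻ {x} x∈ eq = let j , h = ∈⟪⟫⁻ nonzero? (p∩q⊆q ⊤ _ x∈)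
    in contradiction (trans (sym h) (trans (sym (coordinate x j)) (trans (cong (λ u → lookup u j) eq) (lookup-⊥ j)))) λ ()

  ∈linear⁺ : ∀ {x} → first (V x) ≡ false → x ∈ tabulate (λ x → not (vector (suc d) x zero))
  ∈linear⁺ {x} h = Vec.lookup⇒[]= x _ (trans (Vec.lookup∘tabulate _ x) (cong not (trans (sym (coordinate x zero)) h)))

  ∈linear⁻ : ∀ {x} → x ∈ tabulate (λ x → not (vector (suc d) x zero)) → first (V x) ≡ false
  ∈linear⁻ {x} x∈ = trans (coordinate x zero) (Bool.not-injective
    (trans (sym (Vec.lookup∘tabulate (λ x → not (vector (suc d) x zero)) x)) (Vec.[]=⇒lookup x∈)))

  ∈H⁺ : ∀ {x} → V x ≢ ⊥ → first (V x) ≡ false → x ∈ H d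
  ∈H⁺ Vx≢⊥ h = x∈p∩q⁺ (∈PG⁺ Vx≢⊥ , ∈linear⁺ h)

  ∈H⁻ : ∀ {x} → x ∈ H d → V x ≢ ⊥ × first (V x) ≡ false
  ∈H⁻ x∈ = let x∈PG , h = x∈p∩q⁻ (E (PG d)) _ x∈ in ∈PG⁻ x∈PG , ∈linear⁻ h

  ∈AG⁺ : ∀ {x} → first (V x) ≡ true → x ∈ E (AG d)
  ∈AG⁺ h = x∈p∩q⁺ (∈PG⁺ (first≢⊥ h) , x∉p⇒x∈∁p (λ x∈H → contradiction (trans (sym h) (proj₂ (∈H⁻ x∈H))) λ ()))

  ∈AG⁻ : ∀ {x} → x ∈ E (AG d) → first (V x) ≡ true
  ∈AG⁻ {x} x∈ = let x∈PG , x∈∁H = x∈p∩q⁻ (E (PG d)) (∁ (H d)) x∈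
    in Bool.¬-not {first (V x)} {false} (λ h → x∈∁p⇒x∉p x∈∁H (∈H⁺ (∈PG⁻ x∈PG) h))

  ∈AG+⁺ : ∀ {e x} → first (V x) ≡ true → x ∈ E (AG+ d e)
  ∈AG+⁺ {e} h = x∈p∩q⁺ (∈PG⁺ (first≢⊥ h) , x∉p⇒x∈∁p (λ x∈ →
    contradiction (trans (sym h) (proj₂ (∈H⁻ (p─q⊆p (H d) ⁅ e ⁆ x∈)))) λ ()))

  e∈AG+ : ∀ {e} → e ∈ H d → e ∈ E (AG+ d e)
  e∈AG+ {e} e∈H = x∈p∩q⁺ (p∩q⊆p (E (PG d)) _ e∈H , x∉p⇒x∈∁p (x∉p-x (H d)))

  ∈AG+⁻ : ∀ {e x} → x ∈ E (AG+ d e) → x ≢ e → first (V x) ≡ true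
  ∈AG+⁻ {e} {x} x∈ x≢e = let x∈PG , x∈∁ = x∈p∩q⁻ (E (PG d)) (∁ (H d - e)) x∈
    in Bool.¬-not {first (V x)} {false} (λ h → x∈∁p⇒x∉p x∈∁ (x∈p∧x≢y⇒x∈p-y (∈H⁺ (∈PG⁻ x∈PG) h) x≢e))

  PG-represented : VectorRepresented (PG d) V
  PG-represented = restrict-represented {M = vectorMatroid (vector (suc d))} (vector-represented λ _ → mk⇔
    (Equivalence.to (Free⇔Separated V) ∘ Equivalence.to (LI⇔Free coordinate))
    (Equivalence.from (LI⇔Free coordinate) ∘ Equivalence.from (Free⇔Separated V)))

  AG-represented : VectorRepresented (AG d) V
  AG-represented = restrict-represented PG-represented

  AG+-represented : ∀ {e X} → VectorRepresented (AG+ d e ╲ X) V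
  AG+-represented = restrict-represented (restrict-represented PG-represented)

-- Affine bases, and copies of affine geometries as flats

module Flat where
  AffineBasis : (d l : ℕ) → Set
  AffineBasis d l = ∃ λ I → I ⊆ E (AG d) × Free (Geometry.V d) I × ∣ I ∣ ≡ l

  -- Some vector `u` is not spanned. If it is not affine, then `φ₀` or `u △ φ₀`, which both have
  -- first coordinate 1, is not spanned either, since their sum is `u`.
  extend-basis : ∀ {d l} → l < suc d → AffineBasis d l → AffineBasis d (suc l)
  extend-basis {d} {l} l<d (I , I⊆ , free , size) = from (not-spanned V I (subst (_< suc d) (sym size) l<d))
    where
    open Geometry d

    add : ∀ u → first u ≡ true → ¬ Spanned V I u → AffineBasis d (suc l)
    add u u₀ ¬span = I ∪ ⁅ index u ⁆ ,
      ∪-⊆ I⊆ (⁅⁆-⊆ (∈AG⁺ (trans (cong first (vec-index u)) u₀))) ,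
      Free-∪⁅⁆ free ¬span′ , trans (∣p∪⁅x⁆∣ I x∉I) (cong suc size)
      where
      ¬span′ : ¬ Spanned V I (V (index u))
      ¬span′ = ¬span ∘ subst (Spanned V I) (vec-index u)

      x∉I : index u ∉ I
      x∉I x∈I = ¬span′ (⁅ index u ⁆ , ⁅⁆-⊆ x∈I , comb-⁅⁆ V (index u))

    spanned-△ : ∀ {u w} → Spanned V I u → Spanned V I w → Spanned V I (u △ w)
    spanned-△ (C , C⊆ , refl) (D , D⊆ , refl) = C △ D , △-⊆ C⊆ D⊆ , comb-△ V C D

    from : (∃ λ u → ¬ Spanned V I u) → AffineBasis d (suc l)
    from (u , ¬span) with first u in u₀ | Spanned? V I φ₀
    ... | true  | _ = add u u₀ ¬span
    ... | false | no ¬span-φ = add φ₀ refl ¬span-φ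
    ... | false | yes span-φ = add (u △ φ₀) (trans (lookup-△ u φ₀ zero) (cong (_xor true) u₀))
            (λ span → ¬span (subst (Spanned V I) (△-cancelʳ u φ₀) (spanned-△ span span-φ)))

  affine-basis : ∀ d l → l ≤ suc d → AffineBasis d l
  affine-basis d zero _ = ⊥ , ⊥⊆ , (λ D D⊆⊥ _ → ⊆-antisym D⊆⊥ ⊥⊆) , ∣⊥∣≡0 (2 ^ suc d)
  affine-basis d (suc l) l<d = extend-basis l<d (affine-basis d l (ℕ.≤-trans (ℕ.n≤1+n l) l<d))

  ∣AG∣ : ∀ d → 2 ^ d ≤ ∣ E (AG d) ∣
  ∣AG∣ d = subst (_≤ ∣ E (AG d) ∣) (∣⊤∣≡n (2 ^ d)) (∣∣-injection ⊤ (E (AG d))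
    (λ {x} _ → index (true ∷ vec d x)) (λ {x} _ → ∈AG⁺ (cong first (vec-index (true ∷ vec d x))))
    (λ {x} {y} _ _ eq → vec-injective d (Vec.∷-injectiveʳ (index-injective {p = true ∷ vec d x} {true ∷ vec d y} eq))))
    where open Geometry d

  -- The affine span of a free set J of affine vectors has at most 2^(∣J∣-1)
  -- elements: after removal of j from the coefficient set, membership of j is
  -- determined by parity.
  module AffineSpan {n k} (V : Fin n → Subset (suc k)) (V-inj : ∀ {x y} → V x ≡ V y → x ≡ y)
    (J : Subset n) (affine : ∀ {x} → x ∈ J → first (V x) ≡ true) where

    InSpan : Fin n → Set
    InSpan y = first (V y) ≡ true × Spanned V J (V y)

    InSpan? : Decidable InSpan
    InSpan? y = first (V y) Bool.≟ true ×-dec Spanned? V J (V y)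

    span : Subset n
    span = ⟪ InSpan? ⟫

    determined : ∀ {j} → j ∈ J → ∀ {C D} → C - j ≡ D - j → first (comb V C) ≡ true → first (comb V D) ≡ true → C ⊆ D
    determined {j} j∈J {C} {D} eq C₀ D₀ {x} x∈C with x Fin.≟ j
    ... | no x≢j = proj₁ (∈-⁻ D (subst (x ∈_) eq (x∈p∧x≢y⇒x∈p-y x∈C x≢j)))
    ... | yes refl with x ∈? D
    ...   | yes x∈D = x∈D
    ...   | no x∉D = contradiction (trans (sym D₀) D-first) λ ()
      where
      C≡ : C ≡ D △ ⁅ x ⁆
      C≡ = ⊆-antisym C⊆ ⊆C
        where
        C⊆ : C ⊆ D △ ⁅ x ⁆
        C⊆ {z} z∈C with z Fin.≟ x
        ... | yes refl = ∈△⁺ʳ D ⁅ x ⁆ x∉D (x∈⁅x⁆ x)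
        ... | no z≢x = ∈△⁺ˡ D ⁅ x ⁆ (proj₁ (∈-⁻ D (subst (z ∈_) eq (x∈p∧x≢y⇒x∈p-y z∈C z≢x)))) (x≢y⇒x∉⁅y⁆ z≢x)

        ⊆C : D △ ⁅ x ⁆ ⊆ C
        ⊆C {z} z∈ with ∈△⁻ D ⁅ x ⁆ z∈
        ... | inj₁ (z∈D , z∉x) = proj₁ (∈-⁻ C (subst (z ∈_) (sym eq) (x∈p∧x≢y⇒x∈p-y z∈D (x∉⁅y⁆⇒x≢y z∉x))))
        ... | inj₂ (_ , z∈x) = subst (_∈ C) (sym (x∈⁅y⁆⇒x≡y x z∈x)) x∈C

      D-first : first (comb V D) ≡ false
      D-first = trans (cong (first ∘ comb V) (sym (trans (cong (_△ ⁅ x ⁆) C≡) (△-cancelʳ D ⁅ x ⁆))))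
        (trans (cong first (comb-△ V C ⁅ x ⁆)) (trans (lookup-△ (comb V C) _ zero)
          (cong₂ _xor_ C₀ (trans (cong first (comb-⁅⁆ V x)) (affine j∈J)))))

    ∣span∣ : ∀ {j} → j ∈ J → ∣ span ∣ ≤ 2 ^ ∣ J - j ∣
    ∣span∣ {j} j∈J = Fin.injective⇒≤ {f = code} inj
      where
      in-span : ∀ i → InSpan (element span i)
      in-span i = ∈⟪⟫⁻ InSpan? (element-∈ span i)

      coeff : Fin ∣ span ∣ → Subset n
      coeff i = proj₁ (proj₂ (in-span i))

      coeff⊆ : ∀ i → coeff i - j ⊆ J - j
      coeff⊆ i x∈ = let x∈C , x≢j = ∈-⁻ (coeff i) x∈ in x∈p∧x≢y⇒x∈p-y (proj₁ (proj₂ (proj₂ (in-span i))) x∈C) x≢j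

      coeff-comb : ∀ i → comb V (coeff i) ≡ V (element span i)
      coeff-comb i = proj₂ (proj₂ (proj₂ (in-span i)))

      coeff-first : ∀ i → first (comb V (coeff i)) ≡ true
      coeff-first i = trans (cong first (coeff-comb i)) (proj₁ (in-span i))

      code : Fin ∣ span ∣ → Fin (2 ^ ∣ J - j ∣)
      code i = encode (J - j) (coeff i - j)

      inj : ∀ {i i′} → code i ≡ code i′ → i ≡ i′
      inj {i} {i′} eq = element-injective span (V-inj (trans (sym (coeff-comb i)) (trans (cong (comb V) same) (coeff-comb i′))))
        where
        same- : coeff i - j ≡ coeff i′ - j
        same- = encode-injective (J - j) (coeff⊆ i) (coeff⊆ i′) eq

        same : coeff i ≡ coeff i′
        same = ⊆-antisym (determined j∈J same- (coeff-first i) (coeff-first i′))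
          (determined j∈J (sym same-) (coeff-first i′) (coeff-first i))

module AffineFlat {d : ℕ} {N : Matroid n} {k : ℕ} {V : Fin n → Subset (suc k)} (V-inj : ∀ {x y} → V x ≡ V y → x ≡ y)
  (repN : VectorRepresented N V) (affine : ∀ {x} → x ∈ E N → first (V x) ≡ true) (iso : N ≅ AG d) where
  open Flat
  open Geometry d using (AG-represented)

  private
    osi : AG d ≅ N
    osi = ≅-sym iso

  free⇒∣∣≤ : ∀ {K} → K ⊆ E N → Free V K → ∣ K ∣ ≤ suc d
  free⇒∣∣≤ {K} K⊆ free = subst (_≤ suc d)
    (sym (corresponds-∣∣ N (AG d) f K⊆ (image-⊆ N (AG d) f K) (image-corresponds N (AG d) f K)))
    (Free-∣∣≤ (Equivalence.from (Free⇔Separated (vec (suc d))) (Equivalence.to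
      (VectorRepresented.indep⇔ AG-represented (image-⊆ N (AG d) f K))
      (Equivalence.to (_≅_.preserves iso K⊆ (image-⊆ N (AG d) f K) (image-corresponds N (AG d) f K))
        (Equivalence.from (VectorRepresented.indep⇔ repN K⊆) (Equivalence.to (Free⇔Separated V) free))))))
    where
    f : Element N ↔ Element (AG d)
    f = _≅_.bijection iso

  basis : ∃ λ J → J ⊆ E N × Free V J × ∣ J ∣ ≡ suc d
  basis = from (affine-basis d (suc d) ℕ.≤-refl)
    where
    f : Element (AG d) ↔ Element N
    f = _≅_.bijection osi

    from : AffineBasis d (suc d) → ∃ λ J → J ⊆ E N × Free V J × ∣ J ∣ ≡ suc d
    from (I , I⊆ , free , size) = image (AG d) N f I , J⊆ ,
      Equivalence.from (Free⇔Separated V) (Equivalence.to (VectorRepresented.indep⇔ repN J⊆)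
        (Equivalence.to (_≅_.preserves osi I⊆ J⊆ corr) (Equivalence.from (VectorRepresented.indep⇔ AG-represented I⊆)
          (Equivalence.to (Free⇔Separated (vec (suc d))) free)))) ,
      trans (sym (corresponds-∣∣ (AG d) N f I⊆ J⊆ corr)) size
      where
      J⊆ : image (AG d) N f I ⊆ E N
      J⊆ = image-⊆ (AG d) N f I

      corr : Corresponds (AG d) N f I (image (AG d) N f I)
      corr = image-corresponds (AG d) N f I

  module _ {J : Subset n} (J⊆ : J ⊆ E N) (free : Free V J) (size : ∣ J ∣ ≡ suc d) where
    open AffineSpan V V-inj J (affine ∘ J⊆)

    E⊆span : E N ⊆ span
    E⊆span {y} y∈ = ∈⟪⟫⁺ InSpan? (affine y∈ , decidable-stable (Spanned? V J (V y)) λ ¬span →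
      ℕ.1+n≰n (subst (_≤ suc d) (trans (∣p∪⁅x⁆∣ J (λ y∈J → ¬span (⁅ y ⁆ , ⁅⁆-⊆ y∈J , comb-⁅⁆ V y))) (cong suc size))
        (free⇒∣∣≤ (∪-⊆ J⊆ (⁅⁆-⊆ y∈)) (Free-∪⁅⁆ free ¬span))))

    -- A copy of `AG d` is automatically a whole flat: it has at least `2 ^ d` points, and the
    -- affine span of its `d + 1` basis vectors has at most that many.
    span≡E : E N ≡ span
    span≡E = ⊆∧∣∣≤⇒≡ E⊆span (ℕ.≤-trans (∣span∣ (proj₂ some))
      (subst₂ (λ a b → 2 ^ a ≤ b) (ℕ.suc-injective (trans (sym size) (∣p-x∣ J (proj₂ some))))
        (corresponds-∣∣ (AG d) N (_≅_.bijection osi) ⊆-refl ⊆-refl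
          (λ x → mk⇔ (λ _ → proj₂ (Inverse.to (_≅_.bijection osi) x)) (λ _ → proj₂ x)))
        (∣AG∣ d)))
      where
      some : ∃ λ j → j ∈ J
      some = ∣p∣>0⇒∃ J (subst (0 <_) (sym size) (s≤s z≤n))

    spanned-∈E : ∀ {y} → first (V y) ≡ true → Spanned V J (V y) → y ∈ E N
    spanned-∈E {y} h span = subst (y ∈_) (sym span≡E) (∈⟪⟫⁺ InSpan? (h , span))

module ToGeometry {M : Matroid n} {d : ℕ} (nf : NormalForm M (suc (suc d))) where
  private
    module NF = NormalForm nf

    D : ℕ
    D = suc (suc d)

  open Geometry D

  e′ : Fin (2 ^ suc D)
  e′ = index (NF.V NF.e)

  e′∈H : e′ ∈ H D
  e′∈H = ∈H⁺ (NF.V-e≢⊥ ∘ trans (sym (vec-index (NF.V NF.e)))) (trans (cong first (vec-index (NF.V NF.e))) NF.e-linear)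

  IsPoint? : ∀ y → Dec (∃ λ x → x ∈ E M × NF.V x ≡ V y)
  IsPoint? y = any? (λ x → x ∈? E M ×-dec NF.V x ≟ˢ V y)

  Missing? : ∀ y → Dec (y ∈ E (AG+ D e′) × ¬ (∃ λ x → x ∈ E M × NF.V x ≡ V y))
  Missing? y = y ∈? E (AG+ D e′) ×-dec ¬? (IsPoint? y)

  X : Subset (2 ^ suc D)
  X = ⟪ Missing? ⟫

  X⊆ : X ⊆ E (AG+ D e′)
  X⊆ = proj₁ ∘ ∈⟪⟫⁻ Missing?

  ∉X⇒point : ∀ {y} → y ∈ E (AG+ D e′) → y ∉ X → ∃ λ x → x ∈ E M × NF.V x ≡ V y
  ∉X⇒point {y} y∈ y∉X = decidable-stable (IsPoint? y) (λ ¬∃ → y∉X (∈⟪⟫⁺ Missing? (y∈ , ¬∃)))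

  point⇒∉X : ∀ {x} → x ∈ E M → index (NF.V x) ∉ X
  point⇒∉X {x} x∈E i∈X = proj₂ (∈⟪⟫⁻ Missing? i∈X) (x , x∈E , sym (vec-index (NF.V x)))

  e′∉X : e′ ∉ X
  e′∉X = point⇒∉X NF.e∈E

  index∈AG+ : ∀ {x} → x ∈ E M → index (NF.V x) ∈ E (AG+ D e′)
  index∈AG+ {x} x∈E = by (x Fin.≟ NF.e)
    where
    by : Dec (x ≡ NF.e) → index (NF.V x) ∈ E (AG+ D e′)
    by (yes x≡e) = subst (λ z → index (NF.V z) ∈ E (AG+ D e′)) (sym x≡e) (e∈AG+ e′∈H)
    by (no x≢e) = ∈AG+⁺ (trans (cong first (vec-index (NF.V x))) (NF.affine x∈E x≢e))

  bijection : Element (M *) ↔ Element (AG+ D e′ ╲ X)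
  bijection = element-bijection (M *) (AG+ D e′ ╲ X) (λ x → index (NF.V x))
    (λ x∈ → x∈p∩q⁺ (index∈AG+ x∈ , x∉p⇒x∈∁p (point⇒∉X x∈)))
    (λ {x} {y} x∈ y∈ eq → NF.V-inj x∈ y∈ (index-injective {p = NF.V x} {NF.V y} eq))
    (λ {y} y∈ → let x , x∈ , eq = ∉X⇒point (p∩q⊆p (E (AG+ D e′)) (∁ X) y∈) (x∈∁p⇒x∉p (p∩q⊆q (E (AG+ D e′)) (∁ X) y∈))
                in x , x∈ , trans (cong index eq) (index-vec (suc D) y))

  identity : ∀ {k} → Embedding k k
  identity = record { to = id ; adjoint = id ; lift = id ; dot-to = λ _ _ → refl ; dot-lift = λ _ _ → refl }

  iso : (M *) ≅ (AG+ D e′ ╲ X)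
  iso = embedding⇒≅ {V = NF.V} {V} (vector-represented (Represents.indep⇔ NF.represents)) AG+-represented
    bijection identity (λ (x , _) → vec-index (NF.V x))

  -- A copy inside `X` would be a full flat of codimension two. Completing its basis by `x₁` and
  -- `x₂` presents it by two equations, and `hits` puts a point of `M` on it, which cannot be
  -- missing.
  no-flat : ¬ ((AG D ↾ X) Contains AG d)
  no-flat (Y , Y⊆ , N≅) = conclude AF.basis
    where
    N : Matroid (2 ^ suc D)
    N = AG D ↾ X ↾ Y

    affine : ∀ {x} → x ∈ E N → first (V x) ≡ true
    affine x∈ = ∈AG⁻ (p∩q⊆p (E (AG D)) X (p∩q⊆p (E (AG D ↾ X)) Y x∈))

    repN : VectorRepresented N V
    repN = restrict-represented (restrict-represented AG-represented)

    module AF = AffineFlat {N = N} (vec-injective (suc D)) repN affine N≅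

    extension : ∀ {I : Subset (2 ^ suc D)} → Free V I → ∣ I ∣ < suc D → ∃ λ x → x ∉ I × Free V (I ∪ ⁅ x ⁆)
    extension {I} free I<D =
      let u , ¬span = not-spanned V I I<D
          ¬span′ = ¬span ∘ subst (Spanned V I) (vec-index u)
      in index u , (λ i∈I → ¬span′ (⁅ index u ⁆ , ⁅⁆-⊆ i∈I , comb-⁅⁆ V (index u))) , Free-∪⁅⁆ free ¬span′

    conclude : ¬ (∃ λ J → J ⊆ E N × Free V J × ∣ J ∣ ≡ suc d)
    conclude (J , J⊆ , free , size) =
      let x₁ , x₁∉ , free₁ = extension free (subst (_< suc D) (sym size) (s≤s (ℕ.n≤1+n (suc d))))
          size₁ = trans (∣p∪⁅x⁆∣ J x₁∉) (cong suc size)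
          x₂ , x₂∉ , free₂ = extension free₁ (subst (_< suc D) (sym size₁) ℕ.≤-refl)
      in two-more x₁∉ x₂∉ free₂ (trans (∣p∪⁅x⁆∣ (J ∪ ⁅ x₁ ⁆) x₂∉) (cong suc size₁))
      where
      module _ {x₁ x₂} (x₁∉J : x₁ ∉ J) (x₂∉ : x₂ ∉ J ∪ ⁅ x₁ ⁆) (free₂ : Free V ((J ∪ ⁅ x₁ ⁆) ∪ ⁅ x₂ ⁆))
        (size₂ : ∣ (J ∪ ⁅ x₁ ⁆) ∪ ⁅ x₂ ⁆ ∣ ≡ suc D) where
        K : Subset (2 ^ suc D)
        K = (J ∪ ⁅ x₁ ⁆) ∪ ⁅ x₂ ⁆

        x₁∈K : x₁ ∈ K
        x₁∈K = p⊆p∪q ⁅ x₂ ⁆ (∈∪⁅⁆ J x₁)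

        x₂∈K : x₂ ∈ K
        x₂∈K = ∈∪⁅⁆ (J ∪ ⁅ x₁ ⁆) x₂

        J⊆K : J ⊆ K
        J⊆K = p⊆p∪q ⁅ x₂ ⁆ ∘ p⊆p∪q ⁅ x₁ ⁆

        x₁≢x₂ : x₁ ≢ x₂
        x₁≢x₂ eq = x₂∉ (subst (_∈ J ∪ ⁅ x₁ ⁆) eq (∈∪⁅⁆ J x₁))

        K-spans : ∀ u → Spanned V K u
        K-spans u = decidable-stable (Spanned? V K u) λ ¬span →
          let ¬span′ = ¬span ∘ subst (Spanned V K) (vec-index u)
          in ℕ.1+n≰n (subst (_≤ suc D)
               (trans (∣p∪⁅x⁆∣ K (λ i∈K → ¬span′ (⁅ index u ⁆ , ⁅⁆-⊆ i∈K , comb-⁅⁆ V (index u)))) (cong suc size₂))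
               (Free-∣∣≤ (Free-∪⁅⁆ free₂ ¬span′)))

        -- α and β are the coordinates of x₁ and x₂ with respect to the basis K,
        -- so the points of the flat α = β = 0 are spanned by J.
        absurd : (∃ λ α → dot α (V x₁) ≡ true × (∀ {y} → y ∈ K → y ≢ x₁ → dot α (V y) ≡ false)) →
          (∃ λ β → dot β (V x₂) ≡ true × (∀ {y} → y ∈ K → y ≢ x₂ → dot β (V y) ≡ false)) → False
        absurd (α , α₁ , α₀) (β , β₂ , β₀) = on-flat (NF.hits {α} {β}
            (λ { refl → differs α₁ (dot-⊥ˡ (V x₁)) })
            (λ { refl → differs (φ-j) (α-j) })
            (λ { refl → differs β₂ (dot-⊥ˡ (V x₂)) })
            (λ { refl → differs (φ-j) (β-j) })
            (λ { refl → differs α₁ (β₀ x₁∈K x₁≢x₂) })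
            (λ eq → differs (trans (cong (λ f → dot f (V j)) eq) (trans (dot-△ˡ α φ₀ (V j)) (cong₂ _xor_ α-j φ-j))) β-j))
          where
          differs : {b : Bool} → b ≡ true → b ≡ false → False
          differs refl ()

          j,∈ : ∃ λ j → j ∈ J
          j,∈ = ∣p∣>0⇒∃ J (subst (0 <_) (sym size) (s≤s z≤n))

          j = proj₁ j,∈

          φ-j : dot φ₀ (V j) ≡ true
          φ-j = trans (dot-φ₀ (V j)) (affine (J⊆ (proj₂ j,∈)))

          α-j : dot α (V j) ≡ false
          α-j = α₀ (J⊆K (proj₂ j,∈)) (λ eq → x₁∉J (subst (_∈ J) eq (proj₂ j,∈)))

          β-j : dot β (V j) ≡ false
          β-j = β₀ (J⊆K (proj₂ j,∈)) (λ eq → x₂∉ (p⊆p∪q ⁅ x₁ ⁆ (subst (_∈ J) eq (proj₂ j,∈))))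

          on-flat : (∃ λ z → z ∈ E M × z ≢ NF.e × dot α (NF.V z) ≡ false × dot β (NF.V z) ≡ false) → False
          on-flat (z , z∈E , z≢e , αz , βz) = point⇒∉X z∈E (p∩q⊆q (E (AG D)) X (p∩q⊆p (E (AG D ↾ X)) Y
            (AF.spanned-∈E J⊆ free size (trans (cong first (vec-index (NF.V z))) (NF.affine z∈E z≢e))
              (subst (Spanned V J) (sym (vec-index (NF.V z))) (in-J (K-spans (NF.V z)))))))
            where
            in-J : Spanned V K (NF.V z) → Spanned V J (NF.V z)
            in-J (C , C⊆ , eq) = C , (λ {y} y∈C → ∈∪⁅⁆⁻ J (∈∪⁅⁆⁻ (J ∪ ⁅ x₁ ⁆) (C⊆ y∈C)
                (λ { refl → differs (dot-comb-one V β C y∈C β₂ (λ w∈C → β₀ (C⊆ w∈C))) (trans (cong (dot β) eq) βz) }))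
                (λ { refl → differs (dot-comb-one V α C y∈C α₁ (λ w∈C → α₀ (C⊆ w∈C))) (trans (cong (dot α) eq) αz) })) , eq

        two-more : False
        two-more = absurd (Equivalence.to (Free⇔Separated V) free₂ x₁∈K) (Equivalence.to (Free⇔Separated V) free₂ x₂∈K)

-- Parametrised flats of codimension two

module KernelFlat {d : ℕ} (α β : Subset (suc (suc (suc d)))) (α≢⊥ : α ≢ ⊥) (α≢φ : α ≢ φ₀)
  (β≢⊥ : β ≢ ⊥) (β≢φ : β ≢ φ₀) (β≢α : β ≢ α) (β≢α+φ : β ≢ α △ φ₀) where

  -- Solving an equation for a coordinate other than the first leaves the first one unchanged, so
  -- that the parametrisation matches affine points with affine points.
  tail-coordinate : ∀ {k} {a : Subset (suc k)} → a ≢ ⊥ → a ≢ φ₀ → ∃ λ j → lookup a (suc j) ≡ true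
  tail-coordinate {a = true ∷ a} a≢⊥ a≢φ = ≢⊥⇒∃ a (λ { refl → a≢φ refl })
  tail-coordinate {a = false ∷ a} a≢⊥ a≢φ = ≢⊥⇒∃ a (λ { refl → a≢⊥ refl })

  first-kernel : ∀ {k} (a : Subset (suc (suc k))) (j : Fin (suc k)) (x : Subset (suc k)) →
    first (Embedding.to (kernel a (suc j)) x) ≡ first x
  first-kernel a j (_ ∷ _) = refl

  adjoint-φ₀ : ∀ {k} (a : Subset (suc (suc k))) (j : Fin (suc k)) → Embedding.adjoint (kernel a (suc j)) φ₀ ≡ φ₀
  adjoint-φ₀ {k} a j = trans (cong (λ b → scale b (removeAt a (suc j)) △ removeAt φ₀ (suc j)) (lookup-⊥ j))
    (trans (△-identityˡ (removeAt φ₀ (suc j))) (cong (true ∷_) (removeAt-⊥ j)))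
    where
    removeAt-⊥ : ∀ {k} (j : Fin (suc k)) → removeAt (⊥ {suc k}) j ≡ ⊥
    removeAt-⊥ zero = refl
    removeAt-⊥ {suc k} (suc j) = cong (false ∷_) (removeAt-⊥ j)

  module _ {i} (αi : lookup α (suc i) ≡ true) where

    gα : Embedding (suc (suc d)) (suc (suc (suc d)))
    gα = kernel α (suc i)

    β′ : Subset (suc (suc d))
    β′ = Embedding.adjoint gα β

    β′≢⊥ : β′ ≢ ⊥
    β′≢⊥ eq = by (kernel-adjoint-⊥ α αi {β} eq)
      where
      by : ¬ (β ≡ ⊥ ⊎ β ≡ α)
      by (inj₁ h) = β≢⊥ h
      by (inj₂ h) = β≢α h

    β′≢φ : β′ ≢ φ₀
    β′≢φ eq = by (kernel-adjoint-⊥ α αi {β △ φ₀} (trans (Embedding-adjoint-△ gα β φ₀)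
        (trans (cong₂ _△_ eq (adjoint-φ₀ α i)) (△-self φ₀))))
      where
      by : ¬ (β △ φ₀ ≡ ⊥ ⊎ β △ φ₀ ≡ α)
      by (inj₁ h) = β≢φ (p△q≡⊥⇒p≡q β φ₀ h)
      by (inj₂ h) = β≢α+φ (trans (sym (△-cancelʳ β φ₀)) (cong (_△ φ₀) h))

    module _ {j} (β′j : lookup β′ (suc j) ≡ true) where

      gβ : Embedding (suc d) (suc (suc d))
      gβ = kernel β′ (suc j)

      g : Embedding (suc d) (suc (suc (suc d)))
      g = gα ∘ᴱ gβ

      g-first : ∀ x → first (Embedding.to g x) ≡ first x
      g-first x = trans (first-kernel α i (Embedding.to gβ x)) (first-kernel β′ j x)

      g-α : ∀ x → dot α (Embedding.to g x) ≡ false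
      g-α x = kernel-dot α αi (Embedding.to gβ x)

      g-β : ∀ x → dot β (Embedding.to g x) ≡ false
      g-β x = trans (Embedding.dot-to gα β (Embedding.to gβ x)) (kernel-dot β′ β′j x)

      g-onto : ∀ {y} → dot α y ≡ false → dot β y ≡ false → ∃ λ x → Embedding.to g x ≡ y
      g-onto {y} αy βy = removeAt u (suc j) , trans (cong (Embedding.to gα) (kernel-onto β′ β′j β′u)) (kernel-onto α αi αy)
        where
        u : Subset (suc (suc d))
        u = removeAt y (suc i)

        β′u : dot β′ u ≡ false
        β′u = trans (sym (Embedding.dot-to gα β u)) (trans (cong (dot β) (kernel-onto α αi αy)) βy)

  -- The kernel of `α`, then inside it the kernel of the restriction `β′` of `β`. The conditions on
  -- `β` say that neither `β` nor `β △ φ₀` restricts to zero, so `β′` can again be solved for a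
  -- coordinate other than the first.
  parametrisation : ∃ λ (g : Embedding (suc d) (suc (suc (suc d)))) →
    (∀ x → first (Embedding.to g x) ≡ first x) × (∀ x → dot α (Embedding.to g x) ≡ false) ×
    (∀ x → dot β (Embedding.to g x) ≡ false) ×
    (∀ {y} → dot α y ≡ false → dot β y ≡ false → ∃ λ x → Embedding.to g x ≡ y)
  parametrisation =
    let i , αi = tail-coordinate α≢⊥ α≢φ
        j , βj = tail-coordinate (β′≢⊥ αi) (β′≢φ αi)
    in g αi βj , g-first αi βj , g-α αi βj , g-β αi βj , g-onto αi βj

  module G = Geometry (suc (suc d))
  module G₀ = Geometry d

  InFlat? : ∀ y → Dec (first (G.V y) ≡ true × dot α (G.V y) ≡ false × dot β (G.V y) ≡ false)
  InFlat? y = first (G.V y) Bool.≟ true ×-dec (dot α (G.V y) Bool.≟ false ×-dec dot β (G.V y) Bool.≟ false)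

  flat : Subset (2 ^ suc (suc (suc d)))
  flat = ⟪ InFlat? ⟫

  flat-contains : ∀ {X} → flat ⊆ X → (AG (suc (suc d)) ↾ X) Contains AG d
  flat-contains {X} flat⊆X = flat , flat⊆E , ≅-sym (iso parametrisation)
    where
    flat⊆E : flat ⊆ E (AG (suc (suc d)) ↾ X)
    flat⊆E y∈ = x∈p∩q⁺ (G.∈AG⁺ (proj₁ (∈⟪⟫⁻ InFlat? y∈)) , flat⊆X y∈)

    iso : (∃ λ (g : Embedding (suc d) (suc (suc (suc d)))) →
      (∀ x → first (Embedding.to g x) ≡ first x) × (∀ x → dot α (Embedding.to g x) ≡ false) ×
      (∀ x → dot β (Embedding.to g x) ≡ false) ×
      (∀ {y} → dot α y ≡ false → dot β y ≡ false → ∃ λ x → Embedding.to g x ≡ y)) →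
      AG d ≅ (AG (suc (suc d)) ↾ X ↾ flat)
    iso (g , g-first , g-α , g-β , g-onto) = embedding⇒≅ G₀.AG-represented
      (restrict-represented (restrict-represented G.AG-represented)) f g (λ (x , _) → vec-index (Embedding.to g (G₀.V x)))
      where
      module g = Embedding g

      into : ∀ {x} → x ∈ E (AG d) → index (g.to (G₀.V x)) ∈ E (AG (suc (suc d)) ↾ X ↾ flat)
      into {x} x∈ = x∈p∩q⁺ (flat⊆E in-flat , in-flat)
        where
        in-flat : index (g.to (G₀.V x)) ∈ flat
        in-flat = ∈⟪⟫⁺ InFlat?
          ( trans (cong first (vec-index (g.to (G₀.V x)))) (trans (g-first (G₀.V x)) (G₀.∈AG⁻ x∈))
          , trans (cong (dot α) (vec-index (g.to (G₀.V x)))) (g-α (G₀.V x))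
          , trans (cong (dot β) (vec-index (g.to (G₀.V x)))) (g-β (G₀.V x)) )

      preimage : ∀ {y} → y ∈ E (AG (suc (suc d)) ↾ X ↾ flat) → ∃ λ x → x ∈ E (AG d) × index (g.to (G₀.V x)) ≡ y
      preimage {y} y∈ =
        let y₀ , αy , βy = ∈⟪⟫⁻ InFlat? (p∩q⊆q (E (AG (suc (suc d)) ↾ X)) flat y∈)
            u , gu = g-onto αy βy
        in index u ,
           G₀.∈AG⁺ (trans (cong first (vec-index u)) (trans (sym (g-first u)) (trans (cong first gu) y₀))) ,
           trans (cong index (trans (cong g.to (vec-index u)) gu)) (index-vec (suc (suc (suc d))) y)

      f : Element (AG d) ↔ Element (AG (suc (suc d)) ↾ X ↾ flat)
      f = element-bijection (AG d) (AG (suc (suc d)) ↾ X ↾ flat) (λ x → index (g.to (G₀.V x))) into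
        (λ {x} {y} _ _ eq → vec-injective (suc d) (g.injective (index-injective {p = g.to (G₀.V x)} {g.to (G₀.V y)} eq)))
        preimage

-- Representations are total functions on `Fin n`, whereas an isomorphism provides values at
-- elements only.
totalise : {A : Set} (p : Subset n) → ((∃ λ x → x ∈ p) → A) → A → Fin n → A
totalise p h default x with x ∈? p
... | yes x∈ = h (x , x∈)
... | no _   = default

totalise-at : {A : Set} (p : Subset n) (h : (∃ λ x → x ∈ p) → A) (default : A) →
  ∀ x → totalise p h default (proj₁ x) ≡ h x
totalise-at p h default (x , x∈) with x ∈? p
... | yes x∈′ = cong (λ z → h (x , z)) (∈-irrelevant x∈′ x∈)
... | no x∉ = contradiction x∈ x∉

module FromGeometry {M : Matroid n} {d : ℕ} {e : Fin (2 ^ suc (suc (suc d)))} (e∈H : e ∈ H (suc (suc d)))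
  {X : Subset (2 ^ suc (suc (suc d)))} (e∉X : e ∉ X) (no-flat : ¬ ((AG (suc (suc d)) ↾ X) Contains AG d))
  {N : Matroid (2 ^ suc (suc (suc d)))} (E-N : E N ≡ E (AG+ (suc (suc d)) e) ∩ ∁ X)
  (N-represented : VectorRepresented N (vec (suc (suc (suc d))))) (iso : (M *) ≅ N) where

  private
    D : ℕ
    D = suc (suc d)

    bij : Element (M *) ↔ Element N
    bij = _≅_.bijection iso

    module f = Inverse bij

  open Geometry D

  W : Fin n → Subset (suc D)
  W = totalise (E M) (λ x → V (proj₁ (f.to x))) ⊥

  W-at : ∀ x → V (proj₁ (f.to x)) ≡ W (proj₁ x)
  W-at x = sym (totalise-at (E M) (λ x → V (proj₁ (f.to x))) ⊥ x)

  ∈N : ∀ {y} → y ∈ E N → y ∈ E (AG+ D e) × y ∉ X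
  ∈N {y} y∈ = let y∈AG+ , y∈∁X = x∈p∩q⁻ (E (AG+ D e)) (∁ X) (subst (y ∈_) E-N y∈) in y∈AG+ , x∈∁p⇒x∉p y∈∁X

  point : ∀ {y} → y ∈ E (AG+ D e) → y ∉ X → ∃ λ x → x ∈ E M × W x ≡ V y
  point {y} y∈ y∉X = proj₁ x , proj₂ x , trans (sym (W-at x)) (cong (λ z → V (proj₁ z)) (f.strictlyInverseˡ (y , y∈N)))
    where
    y∈N : y ∈ E N
    y∈N = subst (y ∈_) (sym E-N) (x∈p∩q⁺ (y∈ , x∉p⇒x∈∁p y∉X))

    x : Element M
    x = f.from (y , y∈N)

  e-point : ∃ λ x → x ∈ E M × W x ≡ V e
  e-point = point (e∈AG+ e∈H) e∉X

  W-inj : ∀ {x y} → x ∈ E M → y ∈ E M → W x ≡ W y → x ≡ y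
  W-inj {x} {y} x∈ y∈ eq = cong proj₁ (trans (sym (f.strictlyInverseʳ (x , x∈)))
    (trans (cong f.from (Element-≡ (vec-injective (suc D) (trans (W-at (x , x∈)) (trans eq (sym (W-at (y , y∈))))))))
      (f.strictlyInverseʳ (y , y∈))))

  affine : ∀ {x} → x ∈ E M → W x ≢ V e → first (W x) ≡ true
  affine {x} x∈ Wx≢Ve = trans (cong first (sym (W-at (x , x∈))))
    (∈AG+⁻ (proj₁ (∈N (proj₂ (f.to (x , x∈))))) (λ eq → Wx≢Ve (trans (sym (W-at (x , x∈))) (cong V eq))))

  Hit : Subset (suc D) → Subset (suc D) → Set
  Hit α β = ∃ λ x → x ∈ E M × x ≢ proj₁ e-point × dot α (W x) ≡ false × dot β (W x) ≡ false

  -- If `M` had no such point, the whole affine flat `α = β = 0` would be missing, that is, lie in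
  -- `X`, and `flat-contains` would give a copy of `AG d`.
  hits : ∀ {α β} → α ≢ ⊥ → α ≢ φ₀ → β ≢ ⊥ → β ≢ φ₀ → β ≢ α → β ≢ α △ φ₀ → Hit α β
  hits {α} {β} α≢⊥ α≢φ β≢⊥ β≢φ β≢α β≢α+φ = decidable-stable hit? λ ¬hit →
    no-flat (F.flat-contains (λ {y} y∈ → decidable-stable (y ∈? X) (λ y∉X → ¬hit (missed (∈⟪⟫⁻ F.InFlat? y∈) y∉X))))
    where
    module F = KernelFlat α β α≢⊥ α≢φ β≢⊥ β≢φ β≢α β≢α+φ

    hit? : Dec (Hit α β)
    hit? = any? (λ x → x ∈? E M ×-dec (¬? (x Fin.≟ proj₁ e-point) ×-dec
      (dot α (W x) Bool.≟ false ×-dec dot β (W x) Bool.≟ false)))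

    missed : ∀ {y} → first (V y) ≡ true × dot α (V y) ≡ false × dot β (V y) ≡ false → y ∉ X → Hit α β
    missed {y} (y₀ , αy , βy) y∉X =
      let x , x∈ , eq = point (∈AG+⁺ y₀) y∉X
      in x , x∈ ,
         (λ x≡ → contradiction (trans (sym y₀) (trans (cong first (trans (sym eq) (trans (cong W x≡) (proj₂ (proj₂ e-point)))))
           (proj₂ (∈H⁻ e∈H)))) λ ()) ,
         trans (cong (dot α) eq) αy , trans (cong (dot β) eq) βy

  affine′ : ∀ {x} → x ∈ E M → x ≢ proj₁ e-point → first (W x) ≡ true
  affine′ x∈ x≢ = affine x∈ (λ eq → x≢ (W-inj x∈ (proj₁ (proj₂ e-point)) (trans eq (sym (proj₂ (proj₂ e-point))))))

  -- An affine point with `a △ φ₀ = 0` has `a = 1`, so `hits` applied to `a △ φ₀` refutes a nonzero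
  -- `a` other than `φ₀`. For `a = φ₀` any affine point will do, and the flat through `⁅ suc zero ⁆`
  -- is an arbitrary choice to obtain one.
  spans : ∀ a → (∀ {x} → x ∈ E M → dot a (W x) ≡ false) → a ≡ ⊥
  spans a zeros = decidable-stable (a ≟ˢ ⊥) λ a≢⊥ → by a≢⊥ (a ≟ˢ φ₀) (third (a △ φ₀)) (third ⁅ suc zero ⁆)
    where
    Third : Subset (suc D) → Set
    Third a = ∃ λ β → β ≢ ⊥ × β ≢ φ₀ × β ≢ a × β ≢ a △ φ₀

    differs : ∀ {x} → x ∈ E M → x ≢ proj₁ e-point → dot φ₀ (W x) ≡ false → False
    differs {x} x∈ x≢ h = contradiction (trans (sym (affine′ x∈ x≢)) (trans (sym (dot-φ₀ (W x))) h)) λ ()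

    by : a ≢ ⊥ → Dec (a ≡ φ₀) → Third (a △ φ₀) → Third ⁅ suc zero ⁆ → False
    by _ (yes refl) _ (β , β≢⊥ , β≢φ , β≢b , β≢b+φ) =
      let x , x∈ , x≢ , _ = hits (λ ()) (λ ()) β≢⊥ β≢φ β≢b β≢b+φ in differs x∈ x≢ (zeros x∈)
    by a≢⊥ (no a≢φ) (β , β≢⊥ , β≢φ , β≢a+φ , β≢a+φ+φ) _ =
      let x , x∈ , x≢ , a+φ-x , _ = hits (△-≢⊥ a≢φ)
            (λ eq → a≢⊥ (trans (sym (△-cancelʳ a φ₀)) (trans (cong (_△ φ₀) eq) (△-self φ₀)))) β≢⊥ β≢φ β≢a+φ β≢a+φ+φ
      in differs x∈ x≢ (trans (sym (trans (dot-△ˡ a φ₀ (W x)) (cong (_xor dot φ₀ (W x)) (zeros x∈)))) a+φ-x)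

  normal-form : NormalForm M D
  normal-form = record
    { V = W
    ; represents = record { indep⇔ = indep⇔ ; spans = spans }
    ; e = proj₁ e-point ; e∈E = proj₁ (proj₂ e-point)
    ; e-linear = trans (cong first (proj₂ (proj₂ e-point))) (proj₂ (∈H⁻ e∈H))
    ; affine = affine′
    ; V-inj = W-inj
    ; V-e≢⊥ = λ eq → proj₁ (∈H⁻ e∈H) (trans (sym (proj₂ (proj₂ e-point))) eq)
    ; hits = hits }
    where
    indep⇔ : ∀ {I} → I ⊆ E M → Indep (M *) I ⇔ Separated W I
    indep⇔ {I} I⊆ = mk⇔
      (Equivalence.from transport ∘ Equivalence.to (VectorRepresented.indep⇔ N-represented J⊆) ∘ Equivalence.to (_≅_.preserves iso I⊆ J⊆ corr))
      (Equivalence.from (_≅_.preserves iso I⊆ J⊆ corr) ∘ Equivalence.from (VectorRepresented.indep⇔ N-represented J⊆) ∘ Equivalence.to transport)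
      where
      J : Subset (2 ^ suc D)
      J = image (M *) N bij I

      J⊆ : J ⊆ E N
      J⊆ = image-⊆ (M *) N bij I

      corr : Corresponds (M *) N bij I J
      corr = image-corresponds (M *) N bij I

      transport : Separated W I ⇔ Separated V J
      transport = separated-transport {M = M *} {N} bij W-at I⊆ J⊆ corr

-- A record, so that two instances with definitionally equal dimensions are
-- compared without unfolding the matroids.
record GeometricDual (M : Matroid n) (D d : ℕ) : Set where
  constructor geometric-dual
  field
    {e}     : Fin (2 ^ suc D)
    e∈H     : e ∈ H D
    {X}     : Subset (2 ^ suc D)
    X⊆      : X ⊆ E (AG+ D e)
    e∉X     : e ∉ X
    no-flat : ¬ ((AG D ↾ X) Contains AG d)
    iso     : (M *) ≅ (AG+ D e ╲ X)

normal-form⇒geometric : {M : Matroid n} {d : ℕ} → NormalForm M (suc (suc d)) → GeometricDual M (suc (suc d)) d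
normal-form⇒geometric {M = M} {d} nf = geometric-dual G.e′∈H G.X⊆ G.e′∉X G.no-flat G.iso
  where
  module G = ToGeometry {M = M} {d} nf

geometric⇒normal-form : {M : Matroid n} {d : ℕ} → GeometricDual M (suc (suc d)) d → NormalForm M (suc (suc d))
geometric⇒normal-form {M = M} {d} (geometric-dual {e} e∈H {X} _ e∉X no-flat iso) =
  FromGeometry.normal-form {M = M} {d} {e} e∈H {X} e∉X no-flat {AG+ (suc (suc d)) e ╲ X} refl
    (Geometry.AG+-represented (suc (suc d)) {e} {X}) iso

corollary4p5 : ∀ {n : ℕ} (M : Matroid n) →
    ExcludedSeriesMinor CircuitDifference M ⇔
    ( (∃ λ (k : ℕ) → 2 ≤ k × M ≅ U k (k + 2))
    ⊎ (∃ λ (r : ℕ) → 3 ≤ r ×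
    (∃ λ e → e ∈ H (r ∸ 1) ×
    (∃ λ X → X ⊆ E (AG+ (r ∸ 1) e) × e ∉ X ×
    ¬ ((AG (r ∸ 1) ↾ X) Contains AG (r ∸ 3)) ×
    (M *) ≅ (AG+ (r ∸ 1) e ╲ X)))))
corollary4p5 {n} M = mk⇔ (λ esm → classify (excluded⇒minimal esm)) (λ h → minimal⇒excluded (is-minimal h))
  where
  Uniform : Set
  Uniform = ∃ λ (k : ℕ) → 2 ≤ k × M ≅ U k (k + 2)

  Geometric : ℕ → ℕ → Set
  Geometric D d = ∃ λ e → e ∈ H D × (∃ λ X → X ⊆ E (AG+ D e) × e ∉ X ×
    ¬ ((AG D ↾ X) Contains AG d) × (M *) ≅ (AG+ D e ╲ X))

  from-record : ∀ D d → GeometricDual M D d → Geometric D d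
  from-record D d (geometric-dual e∈H X⊆ e∉X no-flat iso) = _ , e∈H , _ , X⊆ , e∉X , no-flat , iso

  to-record : ∀ D d → Geometric D d → GeometricDual M D d
  to-record D d (_ , e∈H , _ , X⊆ , e∉X , no-flat , iso) = geometric-dual e∈H X⊆ e∉X no-flat iso

  geometric : (∃ λ d → NormalForm M (suc (suc d))) → ∃ λ r → 3 ≤ r × GeometricDual M (r ∸ 1) (r ∸ 3)
  -- `r = d + 3` is the length of the vectors in the normal form, which is the rank of `M *`; with
  -- it both truncated differences compute.
  geometric (d , nf) = suc (suc (suc d)) , s≤s (s≤s (s≤s z≤n)) , normal-form⇒geometric nf

  classify : Minimal M → Uniform ⊎ ∃ λ r → 3 ≤ r × Geometric (r ∸ 1) (r ∸ 3)
  classify minM = by (MatroidProperties.some-base M)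
    where
    module P = MinimalProperties M minM

    by : ∃ (Base M) → Uniform ⊎ ∃ λ r → 3 ≤ r × Geometric (r ∸ 1) (r ∸ 3)
    by (T , bT) = nullity (∣ E M ─ T ∣ ℕ.≟ 2)
      where
      nullity : Dec (∣ E M ─ T ∣ ≡ 2) → Uniform ⊎ ∃ λ r → 3 ≤ r × Geometric (r ∸ 1) (r ∸ 3)
      -- `k` is the rank of `M`, the size of the base `T`.
      nullity (yes eq) = let unif = P.nullity-2⇒uniform bT eq in inj₁ (∣ T ∣ , P.uniform⇒2≤ unif , uniform⇒≅U unif)
      nullity (no ≢2)  =
        let r , 3≤r , geo = geometric (minimal⇒normal-form minM bT (ℕ.≤∧≢⇒< (P.nullity≥2 bT) (≢2 ∘ sym)))
        in inj₂ (r , 3≤r , from-record (r ∸ 1) (r ∸ 3) geo)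

  geometric⇒minimal : ∀ r → 3 ≤ r → GeometricDual M (r ∸ 1) (r ∸ 3) → Minimal M
  geometric⇒minimal (suc (suc (suc d))) _ geo = FromNormalForm.normal-form⇒minimal (geometric⇒normal-form {M = M} {d} geo)
  geometric⇒minimal (suc (suc zero)) (s≤s (s≤s ())) _
  geometric⇒minimal (suc zero) (s≤s ()) _

  is-minimal : Uniform ⊎ (∃ λ r → 3 ≤ r × Geometric (r ∸ 1) (r ∸ 3)) → Minimal M
  is-minimal (inj₁ (k , 2≤k , iso)) = UniformProperties.uniform⇒minimal (≅U⇒uniform iso) 2≤k
  is-minimal (inj₂ (r , 3≤r , geo)) = geometric⇒minimal r 3≤r (to-record (r ∸ 1) (r ∸ 3) geo)
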